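{- Let $K$ be a commutative $\mathbb Q$-algebra, $n\ge1$, and let $F=X-H$ be a polynomial map over $K$ in $n$ variables having symmetric Jacobian matrix, with $H=(H_1,\ldots,H_n)$ homogeneous of degree $3$ and $(JH)^4=0$. Then $F$ is invertible with $$F^{ -1}=X+N^{(1)}+N^{(2)}+N^{(3)}+N^{(4)}+N^{(5)}+N^{(6)}+N^{(7)}.$$ In particular, the degree of $F^{ -1}$ is $\le 15$.
   Context: $X=(X_1,\ldots,X_n)$, and $JH=(D_iH_j)$ with $D_i=\partial/\partial X_i$. "Homogeneous of degree $3$" means each $H_i\in K[X_1,\ldots,X_n]$ is homogeneous of degree $3$ (possibly zero). "Invertible" means that $F$ has an inverse under composition which is a polynomial map over $K$. Such an $F=X-H$ always has a unique formal inverse $G$ (a system of power series $G_i=X_i+\text{higher degree terms}$ with $F\circ G=G\circ F=X$), and when $H$ is homogeneous of degree $d=3$ it has the form $G=X+N^{(1)}+N^{(2)}+N^{(3)}+\cdots$ with $N^{(m)}$ (an $n$-tuple) homogeneous of degree $m(d-1)+1=2m+1$; this defines the $N^{(m)}$. -}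

module Defs where

open import Level using (Level; _⊔_)
open import Algebra.Bundles using (CommutativeRing; Semiring)
open import Algebra.Bundles.Raw using (RawSemiring)
open import Algebra.Morphism.Structures using (module RingMorphisms)
import Algebra.Definitions.RawSemiring as RawSemiringDefs
open import Data.Bool.Base using (if_then_else_)
open import Data.Fin.Base using (Fin; zero; suc; toℕ)
import Data.Fin.Properties as Fin
open import Data.List.Base as List using (List; []; _∷_)
open import Data.Nat.Base using (ℕ; zero; suc; _∸_; _≤_; _<_)
import Data.Nat.Base as ℕ
open import Data.Product.Base using (_×_)
open import Data.Rational.Base using (ℚ)
import Data.Rational.Base as ℚ
open import Data.Vec.Base as Vec using (Vec; []; _∷_)
open import Data.Vec.Functional using (Vector)
open import Relation.Binary.PropositionalEquality using (_≢_)
open import Relation.Nullary.Decidable using (does)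

record CommutativeℚAlgebra (c ℓ : Level) : Set (Level.suc (c ⊔ ℓ)) where
  field
    ring : CommutativeRing c ℓ
  open CommutativeRing ring using (Carrier; rawRing)
  field
    fromℚ    : ℚ → Carrier
    fromℚ-isRingHomomorphism :
      RingMorphisms.IsRingHomomorphism ℚ.+-*-rawRing rawRing fromℚ

-- `α : Exponent n` stands for the monomial X₁^α₁ ⋯ Xₙ^αₙ.

Exponent : ℕ → Set
Exponent = Vec ℕ

degree : ∀ {n} → Exponent n → ℕ
degree = Vec.sum

exponentsOfDegree : ∀ n → ℕ → List (Exponent n)
exponentsOfDegree zero    zero    = [] ∷ []
exponentsOfDegree zero    (suc _) = []
exponentsOfDegree (suc n) d =
  List.concatMap (λ a → List.map (a ∷_) (exponentsOfDegree n (d ∸ a)))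
                 (List.upTo (suc d))

exponentsUpToDegree : ∀ n → ℕ → List (Exponent n)
exponentsUpToDegree n d = List.concatMap (exponentsOfDegree n) (List.upTo (suc d))

module SemiringOps {a b} (S : RawSemiring a b) where
  open RawSemiring S
  open RawSemiringDefs S using (_^_)

  sumOver : {A : Set} → List A → (A → Carrier) → Carrier
  sumOver xs f = List.foldr (λ x s → f x + s) 0# xs

  monomial : ∀ {n} → Vector Carrier n → Exponent n → Carrier
  monomial x []      = 1#
  monomial x (a ∷ α) = (x zero ^ a) * monomial (λ i → x (suc i)) α

module Matrices {a b} (S : RawSemiring a b) where
  open RawSemiring S
  open RawSemiringDefs S using (sum)

  Matrix : ℕ → Set a
  Matrix n = Fin n → Fin n → Carrier

  infix 4 _≈ᴹ_
  _≈ᴹ_ : ∀ {n} → Matrix n → Matrix n → Set b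
  A ≈ᴹ B = ∀ i j → A i j ≈ B i j

  infixl 7 _*ᴹ_
  _*ᴹ_ : ∀ {n} → Matrix n → Matrix n → Matrix n
  (A *ᴹ B) i k = sum (λ j → A i j * B j k)

  0ᴹ 1ᴹ : ∀ {n} → Matrix n
  0ᴹ i j = 0#
  1ᴹ i j = if does (i Fin.≟ j) then 1# else 0#

  infixr 8 _^ᴹ_
  _^ᴹ_ : ∀ {n} → Matrix n → ℕ → Matrix n
  A ^ᴹ zero  = 1ᴹ
  A ^ᴹ suc m = A *ᴹ (A ^ᴹ m)

  IsSymmetric : ∀ {n} → Matrix n → Set b
  IsSymmetric A = ∀ i j → A i j ≈ A j i

module Polynomials {c ℓ} (K : CommutativeRing c ℓ) where
  open CommutativeRing K using (Carrier; _≈_; _+_; _*_; -_; 0#; 1#; semiring)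
  open Semiring semiring using (rawSemiring)
  private module K = RawSemiringDefs rawSemiring

  -- Formal power series K[[X₁,…,Xₙ]]: the value at α is the coefficient
  -- of the monomial α.

  Series : ℕ → Set c
  Series n = Exponent n → Carrier

  infix 4 _≈ˢ_
  _≈ˢ_ : ∀ {n} → Series n → Series n → Set ℓ
  f ≈ˢ g = ∀ α → f α ≈ g α

  constˢ : ∀ {n} → Carrier → Series n
  constˢ k []          = k
  constˢ k (zero  ∷ α) = constˢ k α
  constˢ k (suc _ ∷ α) = 0#

  varˢ : ∀ {n} → Fin n → Series n
  varˢ zero    (zero        ∷ α) = 0#
  varˢ zero    (suc zero    ∷ α) = constˢ 1# α
  varˢ zero    (suc (suc _) ∷ α) = 0#
  varˢ (suc i) (zero  ∷ α) = varˢ i α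
  varˢ (suc i) (suc _ ∷ α) = 0#

  infixl 6 _+ˢ_
  _+ˢ_ : ∀ {n} → Series n → Series n → Series n
  (f +ˢ g) α = f α + g α

  -- The Cauchy product (f g)_α = Σ_{β+γ=α} f_β g_γ, with the sum over
  -- (β , γ) taken one variable at a time.
  infixl 7 _*ˢ_
  _*ˢ_ : ∀ {n} → Series n → Series n → Series n
  (f *ˢ g) []      = f [] * g []
  (f *ˢ g) (a ∷ α) =
    K.sum {suc a} λ i →
      ((λ β → f (toℕ i ∷ β)) *ˢ (λ γ → g ((a ∸ toℕ i) ∷ γ))) α

  seriesRawSemiring : ℕ → RawSemiring c ℓ
  seriesRawSemiring n = record
    { Carrier = Series n
    ; _≈_ = _≈ˢ_
    ; _+_ = _+ˢ_
    ; _*_ = _*ˢ_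
    ; 0#  = constˢ 0#
    ; 1#  = constˢ 1#
    }

  SeriesMap : ℕ → Set c
  SeriesMap n = Vector (Series n) n

  -- g(F) = Σ_β g_β F^β.  Meaningful only when every component of F has
  -- zero constant term: then F^β has order at least |β|, so that only
  -- the β with |β| ≤ |α| contribute to the coefficient of α.
  substˢ : ∀ {m n} → Series m → Vector (Series n) m → Series n
  substˢ {m} {n} g F α =
    SemiringOps.sumOver rawSemiring (exponentsUpToDegree m (degree α)) λ β →
      g β * SemiringOps.monomial (seriesRawSemiring n) F β α

  infixr 9 _∘ˢ_
  _∘ˢ_ : ∀ {n} → SeriesMap n → SeriesMap n → SeriesMap n
  (G ∘ˢ F) i = substˢ (G i) F

  -- K[X₁,…,Xₙ] as a setoid: elements are represented by polynomial
  -- expressions, and two expressions are equal when all their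
  -- coefficients agree.

  infixl 6 _+ᵖ_ _-ᵖ_
  infixl 7 _*ᵖ_

  data Poly (n : ℕ) : Set c where
    con       : Carrier → Poly n
    var       : Fin n → Poly n
    _+ᵖ_ _*ᵖ_ : Poly n → Poly n → Poly n

  _-ᵖ_ : ∀ {n} → Poly n → Poly n → Poly n
  p -ᵖ q = p +ᵖ con (- 1#) *ᵖ q

  coeff : ∀ {n} → Poly n → Series n
  coeff (con k)  = constˢ k
  coeff (var i)  = varˢ i
  coeff (p +ᵖ q) = coeff p +ˢ coeff q
  coeff (p *ᵖ q) = coeff p *ˢ coeff q

  infix 4 _≈ᵖ_
  _≈ᵖ_ : ∀ {n} → Poly n → Poly n → Set ℓ
  p ≈ᵖ q = coeff p ≈ˢ coeff q

  polyRawSemiring : ℕ → RawSemiring c ℓ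
  polyRawSemiring n = record
    { Carrier = Poly n
    ; _≈_ = _≈ᵖ_
    ; _+_ = _+ᵖ_
    ; _*_ = _*ᵖ_
    ; 0#  = con 0#
    ; 1#  = con 1#
    }

  module PolyMatrices (n : ℕ) = Matrices (polyRawSemiring n)

  IsHomogeneous : ∀ {n} → ℕ → Poly n → Set ℓ
  IsHomogeneous d p = ∀ α → degree α ≢ d → coeff p α ≈ 0#

  DegreeAtMost : ∀ {n} → ℕ → Poly n → Set ℓ
  DegreeAtMost d p = ∀ α → d < degree α → coeff p α ≈ 0#

  D : ∀ {n} → Fin n → Poly n → Poly n
  D i (con k)  = con 0#
  D i (var j)  = if does (i Fin.≟ j) then con 1# else con 0#
  D i (p +ᵖ q) = D i p +ᵖ D i q
  D i (p *ᵖ q) = D i p *ᵖ q +ᵖ p *ᵖ D i q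

  substᵖ : ∀ {m n} → Poly m → Vector (Poly n) m → Poly n
  substᵖ (con k)  F = con k
  substᵖ (var i)  F = F i
  substᵖ (p +ᵖ q) F = substᵖ p F +ᵖ substᵖ q F
  substᵖ (p *ᵖ q) F = substᵖ p F *ᵖ substᵖ q F

  PolyMap : ℕ → Set c
  PolyMap n = Vector (Poly n) n

  infix 4 _≈ᵐ_
  _≈ᵐ_ : ∀ {n} → PolyMap n → PolyMap n → Set ℓ
  F ≈ᵐ G = ∀ i → F i ≈ᵖ G i

  X : ∀ {n} → PolyMap n
  X = var

  infixl 6 _+ᵐ_ _-ᵐ_
  _+ᵐ_ _-ᵐ_ : ∀ {n} → PolyMap n → PolyMap n → PolyMap n
  (F +ᵐ G) i = F i +ᵖ G i
  (F -ᵐ G) i = F i -ᵖ G i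

  infixr 9 _∘ᵐ_
  _∘ᵐ_ : ∀ {n} → PolyMap n → PolyMap n → PolyMap n
  (F ∘ᵐ G) i = substᵖ (F i) G

  -- The index convention is (JH)ᵢⱼ = Dᵢ Hⱼ.
  J : ∀ {n} → PolyMap n → PolyMatrices.Matrix n n
  J H i j = D i (H j)

  IsInverse : ∀ {n} → PolyMap n → PolyMap n → Set ℓ
  IsInverse F G = (F ∘ᵐ G ≈ᵐ X) × (G ∘ᵐ F ≈ᵐ X)

  toSeries : ∀ {n} → PolyMap n → SeriesMap n
  toSeries F i = coeff (F i)

  record IsFormalInverse {n} (F : PolyMap n) (G : SeriesMap n) : Set (c ⊔ ℓ) where
    field
      G=X+higher : ∀ i α → degree α ≤ 1 → G i α ≈ varˢ i α
      F∘G=X      : ∀ i → (toSeries F ∘ˢ G) i ≈ˢ varˢ i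
      G∘F=X      : ∀ i → (G ∘ˢ toSeries F) i ≈ˢ varˢ i

  homogeneousComponent : ∀ {n} → ℕ → Series n → Poly n
  homogeneousComponent {n} d g =
    SemiringOps.sumOver (polyRawSemiring n) (exponentsOfDegree n d) λ α →
      con (g α) *ᵖ SemiringOps.monomial (polyRawSemiring n) var α

  -- N⁽ᵐ⁾ for a map X - H with H homogeneous of degree 3 and formal
  -- inverse G; in this case the components of G in even degrees vanish.
  N : ∀ {n} → SeriesMap n → ℕ → PolyMap n
  N G m i = homogeneousComponent (2 ℕ.* m ℕ.+ 1) (G i)

{-# OPTIONS --safe #-}
-- The symmetry makes H x = B x x x for a symmetric trilinear map B which is self-adjoint for the
-- standard pairing ⟨_,_⟩.  The formal inverse y of X - H solves y = X + B y y y; put A = B y y,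
-- so that A⁴ = 0, and yᵢ = Aⁱ y.  Since (1 - 3A) ∂y = ∂X, every vector z of power series is the
-- value δ y at y of a derivation δ of K[[X]].  Hence an identity between expressions in y, B and
-- ⟨_,_⟩ may be differentiated in every direction, and the consequences of A⁴ = 0 obtained in this
-- way show that the Euler derivation, whose value at y is y + 2 y₁ + 6 y₂ + 18 y₃, acts on seven
-- scalars, the first of which is q = ⟨ y , y₁ ⟩ - 2 ⟨ y₁ , y₁ ⟩, by a triangular matrix with
-- diagonal 4, 6, …, 16.  So q has components only in these degrees.  Its gradient is
-- 4 y₁ = 4 (y - X), hence y has components only in the degrees 1, 3, …, 15.  This y is the only
-- formal inverse and a two-sided one, because X - H is injective on tuples of series without
-- constant term.
module Submission where

open import Defs
open import Data.Nat.Base using (ℕ; _≤_)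
open import Data.Product.Base using (Σ-syntax; _×_)

open import Level using (Level; _⊔_)
open import Algebra.Bundles using (AbelianGroup; CommutativeMonoid; CommutativeRing; RawRing; Semiring)
import Algebra.Construct.Pointwise as Pointwise
import Algebra.Definitions.RawSemiring as RawSemiringDefs
open import Algebra.Morphism.Structures using (module RingMorphisms)
import Algebra.Morphism.RingMonomorphism as RingMonomorphism
import Algebra.Properties.AbelianGroup as AbelianGroupProperties
import Algebra.Properties.CommutativeMonoid.Mult as Multiples
import Algebra.Properties.CommutativeSemigroup as CommutativeSemigroupProperties
import Algebra.Properties.Ring as RingProperties
import Algebra.Properties.Semiring.Exp as Exp
import Algebra.Properties.Semiring.Mult as SemiringMult
import Algebra.Properties.Semiring.Sum as SemiringSum
open import Algebra.Structures using (IsCommutativeRing)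
open import Data.Bool.Base using (Bool; true; false; if_then_else_)
open import Data.Fin.Base using (Fin; zero; suc; toℕ)
import Data.Fin.Properties as Fin
open import Data.Integer.Base as ℤ using (ℤ; +_; -[1+_])
import Data.Integer.Properties as ℤ
open import Data.List.Base as List using (List; []; _∷_; _++_)
open import Data.List.Relation.Unary.All as All using (All; []; _∷_)
open import Data.List.Relation.Unary.All.Properties using (++⁺)
open import Data.Nat.Base as ℕ using (zero; suc; _∸_; _<_; z≤n; s≤s)
import Data.Nat.Properties as ℕ
open import Data.Product.Base using (_,_)
open import Data.Product.Properties using (≡-dec)
open import Data.Rational.Base as ℚ using (ℚ; 0ℚ; 1ℚ)
import Data.Rational.Properties as ℚ
open import Data.Sum.Base using (_⊎_; inj₁; inj₂)
open import Data.Vec.Base as Vec using ([]; _∷_)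
open import Function.Base using (_∘_; id)
open import Relation.Binary.Definitions using (DecidableEquality; tri<; tri≈; tri>)
open import Relation.Binary.PropositionalEquality as ≡ using (_≡_; _≢_)
import Relation.Binary.Reasoning.Setoid as SetoidReasoning
open import Relation.Nullary.Decidable using (yes; no; does)
open import Relation.Nullary.Negation using (contradiction)

-- The origin of q is a Legendre transform. By symmetry X - H is the gradient of ½⟨ x , x ⟩ - ¼⟨ x ,
-- B x x x ⟩; the Legendre transform of this function, written in terms of y and diminished by ½⟨ X
-- , X ⟩, is q/4. Passing to scalars pays off because self-adjointness lets the pairing be taken at
-- any edge: a scalar is a tree without a root, every inner node having four neighbours. A tree with
-- m nodes has 2m + 2 leaves, which is its degree in y; the trees behind the seven scalars have 1,
-- ..., 7 nodes, whence their eigenvalues. Working at y rather than at X replaces polarisation: any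
-- z may serve as the derivative of y, so a relation in y alone can be differentiated without
-- leaving the trees. The obstacle is the bulk of linear algebra on trees, uniform in the number of
-- variables. It is done by reflection: trees carry integer coefficients, a growing list of proved
-- rewrite rules normalises them, and an identity is checked by computing that a difference becomes
-- the empty combination. Neither confluence nor completeness has to be proved, only the validity of
-- each rule.

-- Integer multiples and additive maps of abelian groups

module IntegerMultiples {c ℓ} (G : AbelianGroup c ℓ) where
  open AbelianGroup G
  open AbelianGroupProperties G public
  open CommutativeSemigroupProperties commutativeSemigroup public using (interchange; x∙yz≈y∙xz)
  open Multiples commutativeMonoid public renaming (_×_ to _×′_)
  open SetoidReasoning setoid

  infixr 8 _·_
  _·_ : ℤ → Carrier → Carrier
  (+ n)    · x = n ×′ x
  -[1+ n ] · x = (suc n ×′ x) ⁻¹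

  ·-cong : ∀ n {x y} → x ≈ y → n · x ≈ n · y
  ·-cong (+ n)    x≈y = ×-congʳ n x≈y
  ·-cong -[1+ n ] x≈y = ⁻¹-cong (×-congʳ (suc n) x≈y)

  ⊖-· : ∀ m n x → (m ℤ.⊖ n) · x ≈ m ×′ x ∙ (n ×′ x) ⁻¹
  ⊖-· m       zero    x = begin
    (m ℤ.⊖ 0) · x      ≡⟨ ≡.cong (_· x) (ℤ.⊖-≥ {m} ℕ.z≤n) ⟩
    m ×′ x              ≈⟨ identityʳ _ ⟨
    m ×′ x ∙ ε          ≈⟨ ∙-congˡ ε⁻¹≈ε ⟨
    m ×′ x ∙ ε ⁻¹       ∎
  ⊖-· zero    (suc n) x = sym (identityˡ _)
  ⊖-· (suc m) (suc n) x = begin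
    (suc m ℤ.⊖ suc n) · x                     ≡⟨ ≡.cong (_· x) (ℤ.[1+m]⊖[1+n]≡m⊖n m n) ⟩
    (m ℤ.⊖ n) · x                             ≈⟨ ⊖-· m n x ⟩
    m ×′ x ∙ (n ×′ x) ⁻¹                      ≈⟨ identityˡ _ ⟨
    ε ∙ (m ×′ x ∙ (n ×′ x) ⁻¹)                ≈⟨ ∙-congʳ (inverseʳ x) ⟨
    (x ∙ x ⁻¹) ∙ (m ×′ x ∙ (n ×′ x) ⁻¹)       ≈⟨ interchange _ _ _ _ ⟩
    (x ∙ m ×′ x) ∙ (x ⁻¹ ∙ (n ×′ x) ⁻¹)       ≈⟨ ∙-congˡ (⁻¹-∙-comm x _) ⟩
    (suc m ×′ x) ∙ (suc n ×′ x) ⁻¹            ∎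

  ·-distrib-+ : ∀ m n x → (m ℤ.+ n) · x ≈ m · x ∙ n · x
  ·-distrib-+ (+ m)    (+ n)    x = ×-homo-+ x m n
  ·-distrib-+ (+ m)    -[1+ n ] x = ⊖-· m (suc n) x
  ·-distrib-+ -[1+ m ] (+ n)    x = trans (⊖-· n (suc m) x) (comm _ _)
  ·-distrib-+ -[1+ m ] -[1+ n ] x = begin
    (suc (suc (m ℕ.+ n)) ×′ x) ⁻¹                   ≡⟨ ≡.cong (λ k → (suc k ×′ x) ⁻¹) (≡.sym (ℕ.+-suc m n)) ⟩
    ((suc m ℕ.+ suc n) ×′ x) ⁻¹                     ≈⟨ ⁻¹-cong (×-homo-+ x (suc m) (suc n)) ⟩
    (suc m ×′ x ∙ suc n ×′ x) ⁻¹                    ≈⟨ ⁻¹-∙-comm _ _ ⟨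
    (suc m ×′ x) ⁻¹ ∙ (suc n ×′ x) ⁻¹               ∎

  neg-· : ∀ n x → (ℤ.- n) · x ≈ (n · x) ⁻¹
  neg-· (+ zero)  x = sym ε⁻¹≈ε
  neg-· (+ suc n) x = refl
  neg-· -[1+ n ]  x = sym (⁻¹-involutive _)

  ×-·-assoc : ∀ m n x → (+ m ℤ.* n) · x ≈ m ×′ (n · x)
  ×-·-assoc zero    n x = refl
  ×-·-assoc (suc m) n x = begin
    (+ suc m ℤ.* n) · x        ≡⟨ ≡.cong (_· x) (ℤ.suc-* (+ m) n) ⟩
    (n ℤ.+ + m ℤ.* n) · x      ≈⟨ ·-distrib-+ n (+ m ℤ.* n) x ⟩
    n · x ∙ (+ m ℤ.* n) · x    ≈⟨ ∙-congˡ (×-·-assoc m n x) ⟩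
    n · x ∙ m ×′ (n · x)       ∎

  ·-assoc : ∀ m n x → (m ℤ.* n) · x ≈ m · (n · x)
  ·-assoc (+ m)    n x = ×-·-assoc m n x
  ·-assoc -[1+ m ] n x = begin
    (-[1+ m ] ℤ.* n) · x           ≡⟨ ≡.cong (_· x) (≡.sym (ℤ.neg-distribˡ-* (+ suc m) n)) ⟩
    (ℤ.- (+ suc m ℤ.* n)) · x      ≈⟨ neg-· (+ suc m ℤ.* n) x ⟩
    ((+ suc m ℤ.* n) · x) ⁻¹       ≈⟨ ⁻¹-cong (×-·-assoc (suc m) n x) ⟩
    (suc m ×′ (n · x)) ⁻¹          ∎

TorsionFree : ∀ {c ℓ} → AbelianGroup c ℓ → Set (c ⊔ ℓ)
TorsionFree G = ∀ n {x} → suc n ×′ x ≈ ε → x ≈ ε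
  where
  open AbelianGroup G
  open IntegerMultiples G

module _ {c₁ ℓ₁ c₂ ℓ₂} (G : AbelianGroup c₁ ℓ₁) (H : AbelianGroup c₂ ℓ₂) where
  private
    module G = AbelianGroup G
    module H = AbelianGroup H
    module GM = IntegerMultiples G
    module HM = IntegerMultiples H

  record Additive (φ : G.Carrier → H.Carrier) : Set (c₁ ⊔ ℓ₁ ⊔ ℓ₂) where
    field
      cong   : ∀ {x y} → x G.≈ y → φ x H.≈ φ y
      ∙-homo : ∀ x y → φ (x G.∙ y) H.≈ φ x H.∙ φ y

    ε-homo : φ G.ε H.≈ H.ε
    ε-homo = HM.identityˡ-unique _ _ (H.trans (H.sym (∙-homo G.ε G.ε)) (cong (G.identityˡ G.ε)))

    ⁻¹-homo : ∀ x → φ (x G.⁻¹) H.≈ φ x H.⁻¹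
    ⁻¹-homo x = HM.inverseˡ-unique _ _
      (H.trans (H.sym (∙-homo _ _)) (H.trans (cong (G.inverseˡ x)) ε-homo))

    ×-homo : ∀ n x → φ (n GM.×′ x) H.≈ n HM.×′ φ x
    ×-homo zero    x = ε-homo
    ×-homo (suc n) x = H.trans (∙-homo _ _) (H.∙-congˡ (×-homo n x))

    ·-homo : ∀ n x → φ (n GM.· x) H.≈ n HM.· φ x
    ·-homo (+ n)    x = ×-homo n x
    ·-homo -[1+ n ] x = H.trans (⁻¹-homo _) (H.⁻¹-cong (×-homo (suc n) x))

-- Formal integer combinations and their values

module Combinations {t} {T : Set t} (_≟_ : DecidableEquality T) (_<ᵇ_ : T → T → Bool) where

  Lin : Set t
  Lin = List (ℤ × T)

  prepend : ℤ → T → Lin → Lin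
  prepend (+ 0) x l = l
  prepend c     x l = (c , x) ∷ l

  -- Sorting, merging and dropping zeros make a comparison with `[]` a test for linear identities.
  -- Soundness rests on `_≟_` alone; `_<ᵇ_` only decides how often the test succeeds.
  insert : ℤ → T → Lin → Lin
  insert c x [] = prepend c x []
  insert c x ((d , y) ∷ l) with x ≟ y
  ... | yes _ = prepend (c ℤ.+ d) x l
  ... | no  _ = if x <ᵇ y then prepend c x ((d , y) ∷ l) else (d , y) ∷ insert c x l

  infixl 6 _⊕_
  _⊕_ : Lin → Lin → Lin
  []            ⊕ m = m
  ((c , x) ∷ l) ⊕ m = insert c x (l ⊕ m)

  scale : ℤ → Lin → Lin
  scale c = List.map λ (d , x) → c ℤ.* d , x

  infixl 6 _⊝_
  _⊝_ : Lin → Lin → Lin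
  l ⊝ m = l ⊕ scale -[1+ 0 ] m

  [_] : T → Lin
  [ x ] = (+ 1 , x) ∷ []

  module _ {u} {U : Set u} (h : U → Lin) where
    -- The linear extension of `h`; nested, it expands multilinear expressions.
    bind : List (ℤ × U) → Lin
    bind []            = []
    bind ((c , x) ∷ l) = scale c (h x) ⊕ bind l

  module Evaluation {c ℓ} (G : AbelianGroup c ℓ) (f : T → AbelianGroup.Carrier G) where
    open AbelianGroup G
    open IntegerMultiples G
    open SetoidReasoning setoid

    eval : Lin → Carrier
    eval []            = ε
    eval ((c , x) ∷ l) = c · f x ∙ eval l

    eval-prepend : ∀ c x l → eval (prepend c x l) ≈ c · f x ∙ eval l
    eval-prepend (+ zero)  x l = sym (identityˡ _)
    eval-prepend (+ suc n) x l = refl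
    eval-prepend -[1+ n ]  x l = refl

    eval-insert : ∀ c x l → eval (insert c x l) ≈ c · f x ∙ eval l
    eval-insert c x [] = eval-prepend c x []
    eval-insert c x ((d , y) ∷ l) with x ≟ y
    ... | yes ≡.refl = begin
      eval (prepend (c ℤ.+ d) x l)    ≈⟨ eval-prepend (c ℤ.+ d) x l ⟩
      (c ℤ.+ d) · f x ∙ eval l        ≈⟨ ∙-congʳ (·-distrib-+ c d (f x)) ⟩
      c · f x ∙ d · f x ∙ eval l      ≈⟨ assoc _ _ _ ⟩
      c · f x ∙ (d · f x ∙ eval l)    ∎
    ... | no _ with x <ᵇ y
    ...   | true  = eval-prepend c x _
    ...   | false = trans (∙-congˡ (eval-insert c x l)) (x∙yz≈y∙xz _ _ _)

    eval-⊕ : ∀ l m → eval (l ⊕ m) ≈ eval l ∙ eval m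
    eval-⊕ []            m = sym (identityˡ _)
    eval-⊕ ((c , x) ∷ l) m = begin
      eval (insert c x (l ⊕ m))          ≈⟨ eval-insert c x (l ⊕ m) ⟩
      c · f x ∙ eval (l ⊕ m)             ≈⟨ ∙-congˡ (eval-⊕ l m) ⟩
      c · f x ∙ (eval l ∙ eval m)        ≈⟨ assoc _ _ _ ⟨
      c · f x ∙ eval l ∙ eval m          ∎

    ·-additive : ∀ c → Additive G G (c ·_)
    ·-additive c = record { cong = ·-cong c ; ∙-homo = ·-distrib-∙ c }
      where
      ·-distrib-∙ : ∀ c x y → c · (x ∙ y) ≈ c · x ∙ c · y
      ·-distrib-∙ (+ n)    x y = ×-distrib-+ x y n
      ·-distrib-∙ -[1+ n ] x y =
        trans (⁻¹-cong (×-distrib-+ x y (suc n))) (sym (⁻¹-∙-comm _ _))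

    eval-scale : ∀ c l → eval (scale c l) ≈ c · eval l
    eval-scale c []            = sym (Additive.ε-homo (·-additive c))
    eval-scale c ((d , x) ∷ l) = begin
      (c ℤ.* d) · f x ∙ eval (scale c l)   ≈⟨ ∙-cong (·-assoc c d (f x)) (eval-scale c l) ⟩
      c · (d · f x) ∙ c · eval l           ≈⟨ Additive.∙-homo (·-additive c) _ _ ⟨
      c · (d · f x ∙ eval l)               ∎

    eval-⊝ : ∀ l m → eval (l ⊝ m) ≈ eval l ∙ eval m ⁻¹
    eval-⊝ l m = begin
      eval (l ⊝ m)                       ≈⟨ eval-⊕ l (scale -[1+ 0 ] m) ⟩
      eval l ∙ eval (scale -[1+ 0 ] m)   ≈⟨ ∙-congˡ (eval-scale -[1+ 0 ] m) ⟩
      eval l ∙ (eval m ∙ ε) ⁻¹           ≈⟨ ∙-congˡ (⁻¹-cong (identityʳ _)) ⟩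
      eval l ∙ eval m ⁻¹                 ∎

    eval-[] : ∀ x → eval [ x ] ≈ f x
    eval-[] x = trans (identityʳ _) (×-homo-1 (f x))

    ⊝-vanishes : ∀ l m → eval l ≈ eval m → eval (l ⊝ m) ≈ ε
    ⊝-vanishes l m eq = trans (eval-⊝ l m) (x≈y⇒x∙y⁻¹≈ε eq)

module _
  {t u} {T : Set t} (_≟_ : DecidableEquality T) (_<ᵇ_ : T → T → Bool)
  {U : Set u} (_≟′_ : DecidableEquality U) (_<′ᵇ_ : U → U → Bool)
  {c₁ ℓ₁ c₂ ℓ₂} (G : AbelianGroup c₁ ℓ₁) (H : AbelianGroup c₂ ℓ₂)
  (f : T → AbelianGroup.Carrier G) (g : U → AbelianGroup.Carrier H) where
  private
    module G = AbelianGroup G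
    module H = AbelianGroup H
    module GM = IntegerMultiples G
    module HM = IntegerMultiples H
    module T = Combinations _≟_ _<ᵇ_
    module U = Combinations _≟′_ _<′ᵇ_
    module TE = T.Evaluation G f
    module UE = U.Evaluation H g
  open SetoidReasoning H.setoid

  -- An additive map is determined by its values on single terms, so it suffices that `h` computes φ
  -- there.
  eval-bind : ∀ {φ} → Additive G H φ → ∀ {h} → (∀ x → UE.eval (h x) H.≈ φ (f x)) →
              ∀ l → UE.eval (U.bind h l) H.≈ φ (TE.eval l)
  eval-bind {φ} add hx []            = H.sym (Additive.ε-homo add)
  eval-bind {φ} add {h} hx ((c , x) ∷ l) = begin
    UE.eval (U.scale c (h x) U.⊕ U.bind h l)             ≈⟨ UE.eval-⊕ (U.scale c (h x)) _ ⟩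
    UE.eval (U.scale c (h x)) H.∙ UE.eval (U.bind h l)   ≈⟨ H.∙-cong (UE.eval-scale c (h x)) (eval-bind add hx l) ⟩
    c HM.· UE.eval (h x) H.∙ φ (TE.eval l)               ≈⟨ H.∙-congʳ (HM.·-cong c (hx x)) ⟩
    c HM.· φ (f x) H.∙ φ (TE.eval l)                     ≈⟨ H.∙-congʳ (Additive.·-homo add c (f x)) ⟨
    φ (c GM.· f x) H.∙ φ (TE.eval l)                     ≈⟨ Additive.∙-homo add _ _ ⟨
    φ (c GM.· f x G.∙ TE.eval l)                         ∎

-- Trees as expressions in a symmetric trilinear form, and their normal forms

module Trees where
  -- node p q r stands for B p q r, and a pair (s , t) of trees for the scalar ⟨ s , t ⟩.
  data Tree : Set where
    leaf : ℕ → Tree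
    node : Tree → Tree → Tree → Tree

  _≟ᵗ_ : DecidableEquality Tree
  leaf i ≟ᵗ leaf j with i ℕ.≟ j
  ... | yes ≡.refl = yes ≡.refl
  ... | no  i≢j    = no λ { ≡.refl → i≢j ≡.refl }
  leaf _ ≟ᵗ node _ _ _ = no λ ()
  node _ _ _ ≟ᵗ leaf _ = no λ ()
  node p q r ≟ᵗ node p′ q′ r′ with p ≟ᵗ p′
  ... | no p≢ = no λ { ≡.refl → p≢ ≡.refl }
  ... | yes ≡.refl with q ≟ᵗ q′
  ...   | no q≢ = no λ { ≡.refl → q≢ ≡.refl }
  ...   | yes ≡.refl with r ≟ᵗ r′
  ...     | no r≢ = no λ { ≡.refl → r≢ ≡.refl }
  ...     | yes ≡.refl = yes ≡.refl

  -- Any comparison gives a sound normal form; a total order makes it canonical.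
  data Order : Set where less equal greater : Order

  _then_ : Order → Order → Order
  less then _ = less
  equal then o = o
  greater then _ = greater

  compareᵗ : Tree → Tree → Order
  compareᵗ (leaf i)     (leaf j)        = if i ℕ.<ᵇ j then less else if j ℕ.<ᵇ i then greater else equal
  compareᵗ (leaf _)     (node _ _ _)    = less
  compareᵗ (node _ _ _) (leaf _)        = greater
  compareᵗ (node p q r) (node p′ q′ r′) = compareᵗ p p′ then (compareᵗ q q′ then compareᵗ r r′)

  isLt : Order → Bool
  isLt less = true
  isLt _  = false

  _<ᵗ_ : Tree → Tree → Bool
  s <ᵗ t = isLt (compareᵗ s t)

  Pair : Set
  Pair = Tree × Tree

  _≟ᵖ_ : DecidableEquality Pair
  _≟ᵖ_ = ≡-dec _≟ᵗ_ _≟ᵗ_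

  _<ᵖ_ : Pair → Pair → Bool
  (s , t) <ᵖ (s′ , t′) = isLt (compareᵗ s s′ then compareᵗ t t′)

  open module TC = Combinations _≟ᵗ_ _<ᵗ_ public using (Lin; [_]; _⊕_; _⊝_; scale; bind)
  module SC = Combinations _≟ᵖ_ _<ᵖ_

  -- A sorting network for the three arguments of B: compare the first two, the last two, then the
  -- first two again.
  mk₁ mk₂ mk : Tree → Tree → Tree → Tree
  mk₁ p q r = if q <ᵗ p then node q p r else node p q r
  mk₂ p q r = if r <ᵗ q then mk₁ p r q else mk₁ p q r
  mk  p q r = if q <ᵗ p then mk₂ q p r else mk₂ p q r

  module Lookup {t} {T : Set t} (_≟_ : DecidableEquality T) (_<ᵇ_ : T → T → Bool) where
    open module C = Combinations _≟_ _<ᵇ_ using () renaming (Lin to Lin′)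

    Rules : Set t
    Rules = List (T × Lin′)

    look : Rules → T → Lin′
    look []            x = C.[ x ]
    look ((y , l) ∷ R) x with x ≟ y
    ... | yes _ = l
    ... | no  _ = look R x

  open Lookup _≟ᵗ_ _<ᵗ_ public using (Rules; look)
  open Lookup _≟ᵖ_ _<ᵖ_ public using () renaming (Rules to PairRules; look to lookᵖ)

  -- Rewriting proceeds from the leaves inwards: when a node is looked up, its three arguments are
  -- already combinations of rewritten trees, expanded by trilinearity.
  norm : Rules → Tree → Lin
  norm R (leaf i)     = [ leaf i ]
  norm R (node p q r) =
    bind (λ p → bind (λ q → bind (λ r → look R (mk p q r)) (norm R r)) (norm R q)) (norm R p)

  -- An edge (s , t) of the unrooted tree obtained by joining the roots of s and t;
  -- the results are the edges at the leaves of s.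
  rootings : Tree → Tree → List Pair
  rootings (leaf i)     t = (leaf i , t) ∷ []
  rootings (node p q r) t =
    rootings p (mk q r t) ++ (rootings q (mk p r t) ++ rootings r (mk p q t))

  least : Pair → List Pair → Pair
  least p []       = p
  least p (q ∷ qs) = least (if q <ᵖ p then q else p) qs

  -- Self-adjointness makes the pairing independent of the edge at which it is taken. Edges at
  -- leaves are enough, because a pair that starts with a leaf precedes every pair that starts with
  -- a node.
  canonical : Tree → Tree → Pair
  canonical s t = least (s , t) (rootings s t ++ rootings t s)

  normᵖ : Rules → PairRules → Pair → SC.Lin
  normᵖ R P (s , t) =
    SC.bind (λ s → SC.bind (λ t → lookᵖ P (canonical s t)) (norm R t)) (norm R s)

  pairs : Tree → Lin → SC.Lin
  pairs s = SC.bind λ t → SC.[ s , t ]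

  D : (ℕ → Lin) → Tree → Lin
  D δ (leaf i)     = δ i
  D δ (node p q r) =
    bind (λ p → [ node p q r ]) (D δ p) ⊕
    (bind (λ q → [ node p q r ]) (D δ q) ⊕ bind (λ r → [ node p q r ]) (D δ r))

  Dᵖ : (ℕ → Lin) → Pair → SC.Lin
  Dᵖ δ (s , t) = SC.bind (λ s → SC.[ s , t ]) (D δ s) SC.⊕ SC.bind (λ t → SC.[ s , t ]) (D δ t)

  record Form {v ℓᵥ s ℓₛ} (V : AbelianGroup v ℓᵥ) (S : AbelianGroup s ℓₛ) : Set (v ⊔ ℓᵥ ⊔ s ⊔ ℓₛ) where
    private
      module V = AbelianGroup V
      module S = AbelianGroup S
    field
      B        : V.Carrier → V.Carrier → V.Carrier → V.Carrier
      ⟨_,_⟩    : V.Carrier → V.Carrier → S.Carrier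
      B-additive : ∀ v w → Additive V V (λ u → B u v w)
      ⟨⟩-additive : ∀ v → Additive V S (λ u → ⟨ u , v ⟩)
      B-swap₁₂ : ∀ u v w → B u v w V.≈ B v u w
      B-swap₂₃ : ∀ u v w → B u v w V.≈ B u w v
      ⟨⟩-comm  : ∀ u v → ⟨ u , v ⟩ S.≈ ⟨ v , u ⟩
      adjoint  : ∀ u v w x → ⟨ B u v w , x ⟩ S.≈ ⟨ u , B v w x ⟩

    private
      additive-≈ : ∀ {c ℓ} {G : AbelianGroup c ℓ} {φ ψ : V.Carrier → AbelianGroup.Carrier G} →
                   (∀ x → AbelianGroup._≈_ G (φ x) (ψ x)) → Additive V G φ → Additive V G ψ
      additive-≈ {G = G} φ≈ψ add = record
        { cong   = λ x≈y → G.trans (G.sym (φ≈ψ _)) (G.trans (Additive.cong add x≈y) (φ≈ψ _))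
        ; ∙-homo = λ x y → G.trans (G.sym (φ≈ψ _)) (G.trans (Additive.∙-homo add x y) (G.∙-cong (φ≈ψ x) (φ≈ψ y)))
        }
        where module G = AbelianGroup G

    B-additive₂ : ∀ u w → Additive V V (λ v → B u v w)
    B-additive₂ u w = additive-≈ {G = V} (λ v → B-swap₁₂ v u w) (B-additive u w)

    B-additive₃ : ∀ u v → Additive V V (λ w → B u v w)
    B-additive₃ u v = additive-≈ {G = V} (λ w → B-swap₂₃ u w v) (B-additive₂ u v)

    ⟨⟩-additive₂ : ∀ u → Additive V S (λ v → ⟨ u , v ⟩)
    ⟨⟩-additive₂ u = additive-≈ {G = S} (λ v → ⟨⟩-comm v u) (⟨⟩-additive u)

    B-cong : ∀ {u u′ v v′ w w′} → u V.≈ u′ → v V.≈ v′ → w V.≈ w′ → B u v w V.≈ B u′ v′ w′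
    B-cong u≈ v≈ w≈ = V.trans (Additive.cong (B-additive _ _) u≈)
      (V.trans (Additive.cong (B-additive₂ _ _) v≈) (Additive.cong (B-additive₃ _ _) w≈))

    ⟨⟩-cong : ∀ {u u′ v v′} → u V.≈ u′ → v V.≈ v′ → ⟨ u , v ⟩ S.≈ ⟨ u′ , v′ ⟩
    ⟨⟩-cong u≈ v≈ = S.trans (Additive.cong (⟨⟩-additive _) u≈) (Additive.cong (⟨⟩-additive₂ _) v≈)

    Nondegenerate : Set (v ⊔ ℓᵥ ⊔ ℓₛ)
    Nondegenerate = ∀ {u} → (∀ z → ⟨ z , u ⟩ S.≈ S.ε) → u V.≈ V.ε

    Nilpotent : V.Carrier → Set (v ⊔ ℓᵥ)
    Nilpotent x = ∀ z → B x x (B x x (B x x (B x x z))) V.≈ V.ε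

  -- B and the pairing will have constant coefficients, so the Leibniz rules contain no term for the
  -- form itself.
  record Derivation {v ℓᵥ s ℓₛ} {V : AbelianGroup v ℓᵥ} {S : AbelianGroup s ℓₛ} (F : Form V S) :
      Set (v ⊔ ℓᵥ ⊔ s ⊔ ℓₛ) where
    private
      module V = AbelianGroup V
      module S = AbelianGroup S
    open Form F
    field
      dᵥ : V.Carrier → V.Carrier
      dₛ : S.Carrier → S.Carrier
      dᵥ-additive : Additive V V dᵥ
      dₛ-additive : Additive S S dₛ
      leibniz-B  : ∀ u v w → dᵥ (B u v w) V.≈ B (dᵥ u) v w V.∙ (B u (dᵥ v) w V.∙ B u v (dᵥ w))
      leibniz-⟨⟩ : ∀ u v → dₛ ⟨ u , v ⟩ S.≈ ⟨ dᵥ u , v ⟩ S.∙ ⟨ u , dᵥ v ⟩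

  module Calculus {v ℓᵥ s ℓₛ} {V : AbelianGroup v ℓᵥ} {S : AbelianGroup s ℓₛ} (F : Form V S)
                  (ρ : ℕ → AbelianGroup.Carrier V) where
    module V = AbelianGroup V
    module S = AbelianGroup S
    open Form F
    open Additive

    ⟦_⟧ᵗ : Tree → V.Carrier
    ⟦ leaf i ⟧ᵗ     = ρ i
    ⟦ node p q r ⟧ᵗ = B ⟦ p ⟧ᵗ ⟦ q ⟧ᵗ ⟦ r ⟧ᵗ

    ⟦_⟧ᵖ : Pair → S.Carrier
    ⟦ s , t ⟧ᵖ = ⟨ ⟦ s ⟧ᵗ , ⟦ t ⟧ᵗ ⟩

    module VE = TC.Evaluation V ⟦_⟧ᵗ
    module SE = SC.Evaluation S ⟦_⟧ᵖ
    open VE public using () renaming (eval to ⟦_⟧)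
    open SE public using () renaming (eval to ⟦_⟧ˢ)

    eval-bindᵗ : ∀ {φ} → Additive V V φ → ∀ {h} → (∀ x → ⟦ h x ⟧ V.≈ φ ⟦ x ⟧ᵗ) →
                 ∀ l → ⟦ bind h l ⟧ V.≈ φ ⟦ l ⟧
    eval-bindᵗ = eval-bind _≟ᵗ_ _<ᵗ_ _≟ᵗ_ _<ᵗ_ V V ⟦_⟧ᵗ ⟦_⟧ᵗ

    eval-bindᵗᵖ : ∀ {φ} → Additive V S φ → ∀ {h} → (∀ x → ⟦ h x ⟧ˢ S.≈ φ ⟦ x ⟧ᵗ) →
                  ∀ l → ⟦ SC.bind h l ⟧ˢ S.≈ φ ⟦ l ⟧
    eval-bindᵗᵖ = eval-bind _≟ᵗ_ _<ᵗ_ _≟ᵖ_ _<ᵖ_ V S ⟦_⟧ᵗ ⟦_⟧ᵖ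

    eval-bindᵖ : ∀ {φ} → Additive S S φ → ∀ {h} → (∀ x → ⟦ h x ⟧ˢ S.≈ φ ⟦ x ⟧ᵖ) →
                 ∀ l → ⟦ SC.bind h l ⟧ˢ S.≈ φ ⟦ l ⟧ˢ
    eval-bindᵖ = eval-bind _≟ᵖ_ _<ᵖ_ _≟ᵖ_ _<ᵖ_ S S ⟦_⟧ᵖ ⟦_⟧ᵖ

    id-additive : ∀ {c ℓ} (G : AbelianGroup c ℓ) → Additive G G (λ x → x)
    id-additive G = record { cong = λ eq → eq ; ∙-homo = λ _ _ → AbelianGroup.refl G }

    if-≈ : ∀ b {s t x} → ⟦ s ⟧ᵗ V.≈ x → ⟦ t ⟧ᵗ V.≈ x → ⟦ if b then s else t ⟧ᵗ V.≈ x
    if-≈ true  e _ = e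
    if-≈ false _ e = e

    mk₁-≈ : ∀ p q r → ⟦ mk₁ p q r ⟧ᵗ V.≈ ⟦ node p q r ⟧ᵗ
    mk₁-≈ p q r = if-≈ (q <ᵗ p) (B-swap₁₂ _ _ _) V.refl

    mk₂-≈ : ∀ p q r → ⟦ mk₂ p q r ⟧ᵗ V.≈ ⟦ node p q r ⟧ᵗ
    mk₂-≈ p q r = if-≈ (r <ᵗ q) (V.trans (mk₁-≈ p r q) (B-swap₂₃ _ _ _)) (mk₁-≈ p q r)

    mk-≈ : ∀ p q r → ⟦ mk p q r ⟧ᵗ V.≈ ⟦ node p q r ⟧ᵗ
    mk-≈ p q r = if-≈ (q <ᵗ p) (V.trans (mk₂-≈ q p r) (B-swap₁₂ _ _ _)) (mk₂-≈ p q r)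

    Valid : Rules → Set ℓᵥ
    Valid = All λ (t , l) → ⟦ t ⟧ᵗ V.≈ ⟦ l ⟧

    Validᵖ : PairRules → Set ℓₛ
    Validᵖ = All λ (p , l) → ⟦ p ⟧ᵖ S.≈ ⟦ l ⟧ˢ

    look-≈ : ∀ {R} → Valid R → ∀ t → ⟦ look R t ⟧ V.≈ ⟦ t ⟧ᵗ
    look-≈ []      t = VE.eval-[] t
    look-≈ {(t′ , l) ∷ R} (e ∷ v) t with t ≟ᵗ t′
    ... | yes ≡.refl = V.sym e
    ... | no  _      = look-≈ v t

    lookᵖ-≈ : ∀ {P} → Validᵖ P → ∀ p → ⟦ lookᵖ P p ⟧ˢ S.≈ ⟦ p ⟧ᵖ
    lookᵖ-≈ []      p = SE.eval-[] p
    lookᵖ-≈ {(p′ , l) ∷ P} (e ∷ v) p with p ≟ᵖ p′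
    ... | yes ≡.refl = S.sym e
    ... | no  _      = lookᵖ-≈ v p

    norm-≈ : ∀ {R} → Valid R → ∀ t → ⟦ norm R t ⟧ V.≈ ⟦ t ⟧ᵗ
    norm-≈ v (leaf i) = VE.eval-[] (leaf i)
    norm-≈ {R} v (node p q r) = V.trans
      (eval-bindᵗ (B-additive _ _) (λ p → V.trans
        (eval-bindᵗ (B-additive₂ _ _) (λ q → V.trans
          (eval-bindᵗ (B-additive₃ _ _) (λ r →
            V.trans (look-≈ v (mk p q r)) (mk-≈ p q r))
            (norm R r))
          V.refl) (norm R q))
        V.refl) (norm R p))
      (B-cong (norm-≈ v p) (norm-≈ v q) (norm-≈ v r))

    -- Self-adjointness, read as moving the pairing to a neighbouring edge of the tree.
    shift : ∀ u p q r → ⟨ ⟦ u ⟧ᵗ , ⟦ mk p q r ⟧ᵗ ⟩ S.≈ ⟨ B ⟦ u ⟧ᵗ ⟦ p ⟧ᵗ ⟦ q ⟧ᵗ , ⟦ r ⟧ᵗ ⟩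
    shift u p q r = S.trans (cong (⟨⟩-additive₂ _) (mk-≈ p q r)) (S.sym (adjoint _ _ _ _))

    rootings-≈ : ∀ s t → All (λ p → ⟦ p ⟧ᵖ S.≈ ⟦ s , t ⟧ᵖ) (rootings s t)
    rootings-≈ (leaf i)     t = S.refl ∷ []
    rootings-≈ (node p q r) t = ++⁺ (All.map (λ e → S.trans e at-p) (rootings-≈ p _))
      (++⁺ (All.map (λ e → S.trans e at-q) (rootings-≈ q _))
           (All.map (λ e → S.trans e at-r) (rootings-≈ r _)))
      where
      at-p = shift p q r t
      at-q = S.trans (shift q p r t) (⟨⟩-cong (B-swap₁₂ _ _ _) V.refl)
      at-r = S.trans (shift r p q t)
        (⟨⟩-cong (V.trans (B-swap₁₂ _ _ _) (B-swap₂₃ _ _ _)) V.refl)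

    least-≈ : ∀ {x} p ps → ⟦ p ⟧ᵖ S.≈ x → All (λ q → ⟦ q ⟧ᵖ S.≈ x) ps → ⟦ least p ps ⟧ᵖ S.≈ x
    least-≈ p []       e []       = e
    least-≈ p (q ∷ qs) e (f ∷ fs) with q <ᵖ p
    ... | true  = least-≈ q qs f fs
    ... | false = least-≈ p qs e fs

    canonical-≈ : ∀ s t → ⟦ canonical s t ⟧ᵖ S.≈ ⟦ s , t ⟧ᵖ
    canonical-≈ s t = least-≈ (s , t) _ S.refl
      (++⁺ (rootings-≈ s t) (All.map (λ e → S.trans e (⟨⟩-comm _ _)) (rootings-≈ t s)))

    normᵖ-≈ : ∀ {R P} → Valid R → Validᵖ P → ∀ p → ⟦ normᵖ R P p ⟧ˢ S.≈ ⟦ p ⟧ᵖ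
    normᵖ-≈ {R} v v′ (s , t) = S.trans
      (eval-bindᵗᵖ (⟨⟩-additive _) (λ s →
        eval-bindᵗᵖ (⟨⟩-additive₂ _) (λ t →
          S.trans (lookᵖ-≈ v′ (canonical s t)) (canonical-≈ s t)) (norm R t)) (norm R s))
      (⟨⟩-cong (norm-≈ v s) (norm-≈ v t))

    -- The reflection principle: normalisation preserves values, so a difference that normalises to
    -- the empty combination has value zero. With concrete trees the last premise is `refl`.
    by-norm : ∀ R → Valid R → ∀ l m → bind (norm R) (l ⊝ m) ≡ [] → ⟦ l ⟧ V.≈ ⟦ m ⟧
    by-norm R v l m eq = VG.x∙y⁻¹≈ε⇒x≈y _ _ (V.trans (V.sym (VE.eval-⊝ l m))
      (V.trans (V.sym (eval-bindᵗ (id-additive V) (norm-≈ v) (l ⊝ m))) (V.reflexive (≡.cong ⟦_⟧ eq))))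
      where module VG = IntegerMultiples V

    by-normᵖ : ∀ R P → Valid R → Validᵖ P → ∀ l m →
               SC.bind (normᵖ R P) (l SC.⊝ m) ≡ [] → ⟦ l ⟧ˢ S.≈ ⟦ m ⟧ˢ
    by-normᵖ R P v v′ l m eq = SG.x∙y⁻¹≈ε⇒x≈y _ _ (S.trans (S.sym (SE.eval-⊝ l m))
      (S.trans (S.sym (eval-bindᵖ (id-additive S) (normᵖ-≈ v v′) (l SC.⊝ m)))
        (S.reflexive (≡.cong ⟦_⟧ˢ eq))))
      where module SG = IntegerMultiples S

    pairs-≈ : ∀ s l → ⟦ pairs s l ⟧ˢ S.≈ ⟨ ⟦ s ⟧ᵗ , ⟦ l ⟧ ⟩
    pairs-≈ s = eval-bindᵗᵖ (⟨⟩-additive₂ ⟦ s ⟧ᵗ) (λ t → SE.eval-[] (s , t))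

    pairs-vanish : ∀ s l → ⟦ l ⟧ V.≈ V.ε → ⟦ pairs s l ⟧ˢ S.≈ S.ε
    pairs-vanish s l e =
      S.trans (pairs-≈ s l) (S.trans (⟨⟩-cong V.refl e) (ε-homo (⟨⟩-additive₂ _)))

    -- Each leaf must have a derivative that is itself the value of a combination; then
    -- differentiating stays inside the language of trees.
    module Differentiation (d : Derivation F) (δ : ℕ → Lin)
                           (δ-sound : ∀ i → ⟦ δ i ⟧ V.≈ Derivation.dᵥ d (ρ i)) where
      open Derivation d
      private
        child : ∀ {φ} → Additive V V φ → (c : Tree → Tree) → ∀ t → (∀ t → ⟦ c t ⟧ᵗ V.≈ φ ⟦ t ⟧ᵗ) →
                ⟦ D δ t ⟧ V.≈ dᵥ ⟦ t ⟧ᵗ →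
                ⟦ bind (λ t → [ c t ]) (D δ t) ⟧ V.≈ φ (dᵥ ⟦ t ⟧ᵗ)
        child add c t c≈ e = V.trans
          (eval-bindᵗ add (λ t → V.trans (VE.eval-[] (c t)) (c≈ t)) (D δ t)) (cong add e)

      D-≈ : ∀ t → ⟦ D δ t ⟧ V.≈ dᵥ ⟦ t ⟧ᵗ
      D-≈ (leaf i)     = δ-sound i
      D-≈ (node p q r) = V.trans (VE.eval-⊕ (bind (λ p → [ node p q r ]) (D δ p)) _) (V.trans
        (V.∙-cong (child (B-additive _ _) (λ p → node p q r) p (λ _ → V.refl) (D-≈ p)) (V.trans
          (VE.eval-⊕ (bind (λ q → [ node p q r ]) (D δ q)) _)
          (V.∙-cong (child (B-additive₂ _ _) (λ q → node p q r) q (λ _ → V.refl) (D-≈ q))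
                    (child (B-additive₃ _ _) (λ r → node p q r) r (λ _ → V.refl) (D-≈ r)))))
        (V.sym (leibniz-B _ _ _)))

      Dᵖ-≈ : ∀ p → ⟦ Dᵖ δ p ⟧ˢ S.≈ dₛ ⟦ p ⟧ᵖ
      Dᵖ-≈ (s , t) = S.trans (SE.eval-⊕ (SC.bind (λ s → SC.[ s , t ]) (D δ s)) _) (S.trans
        (S.∙-cong
          (S.trans (eval-bindᵗᵖ (⟨⟩-additive ⟦ t ⟧ᵗ) (λ s → SE.eval-[] (s , t)) (D δ s))
                   (cong (⟨⟩-additive _) (D-≈ s)))
          (S.trans (eval-bindᵗᵖ (⟨⟩-additive₂ ⟦ s ⟧ᵗ) (λ t → SE.eval-[] (s , t)) (D δ t))
                   (cong (⟨⟩-additive₂ _) (D-≈ t))))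
        (S.sym (leibniz-⟨⟩ _ _)))

      differentiate : ∀ l → ⟦ bind (D δ) l ⟧ V.≈ dᵥ ⟦ l ⟧
      differentiate = eval-bindᵗ dᵥ-additive D-≈

      differentiateᵖ : ∀ l → ⟦ SC.bind (Dᵖ δ) l ⟧ˢ S.≈ dₛ ⟦ l ⟧ˢ
      differentiateᵖ = eval-bindᵖ dₛ-additive Dᵖ-≈

      D-vanishes : ∀ l → ⟦ l ⟧ V.≈ V.ε → ⟦ bind (D δ) l ⟧ V.≈ V.ε
      D-vanishes l e = V.trans (differentiate l) (V.trans (cong dᵥ-additive e) (ε-homo dᵥ-additive))

      Dᵖ-vanishes : ∀ l → ⟦ l ⟧ˢ S.≈ S.ε → ⟦ SC.bind (Dᵖ δ) l ⟧ˢ S.≈ S.ε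
      Dᵖ-vanishes l e = S.trans (differentiateᵖ l) (S.trans (cong dₛ-additive e) (ε-homo dₛ-additive))

-- Consequences of the nilpotency of A

module QuarticForms where
  open Trees
  open ≡ using (refl)

  private variable c ℓ : Level

  pattern y = leaf 0

  infixl 7 _∙ᵗ_ _∙ᵖ_
  _∙ᵗ_ : ℤ → Tree → Lin
  c ∙ᵗ t = scale c [ t ]

  _∙ᵖ_ : ℤ → Pair → SC.Lin
  c ∙ᵖ p = SC.scale c SC.[ p ]

  A : Tree → Tree
  A = mk y y

  y₁ y₂ y₃ y₄ W₀ W₁ W₂ W₃ k : Tree
  y₁ = A y
  y₂ = A y₁
  y₃ = A y₂
  y₄ = A y₃
  W₀ = mk y y₁ y₁
  W₁ = A W₀
  W₂ = A W₁
  W₃ = A W₂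
  k  = mk y₁ y₁ y₁

  module Identities
    {v ℓᵥ s ℓₛ} {V : AbelianGroup v ℓᵥ} {S : AbelianGroup s ℓₛ} (F : Form V S)
    (cancel : TorsionFree V) (cancelˢ : TorsionFree S) (nondegenerate : Form.Nondegenerate F)
    (η : AbelianGroup.Carrier V) (δ : AbelianGroup.Carrier V → Derivation F)
    (δ-η : ∀ z → AbelianGroup._≈_ V (Derivation.dᵥ (δ z) η) z) (nilpotent : Form.Nilpotent F η)
    where
    open Form F
    open AbelianGroup V using (_≈_; ε) renaming (Carrier to ∣V∣)
    open AbelianGroup S using () renaming (_≈_ to _≈ˢ_; ε to εˢ)
    open IntegerMultiples V using (_×′_)
    open IntegerMultiples S using () renaming (_×′_ to _×ˢ_)
    private
      module V = AbelianGroup V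
      module S = AbelianGroup S
      module VG = IntegerMultiples V
      module SG = IntegerMultiples S

    environment : ∣V∣ → ∣V∣ → ℕ → ∣V∣
    environment u w 0 = η
    environment u w 1 = w
    environment u w _ = u

    -- 2 (A₃ w + A₂ A w + A₁ A² w), where w = leaf 1 and Aᵢ = B(y, yᵢ, ·).
    relation : Tree → Lin
    relation w = (+ 2 , node y y₃ w)
               ∷ (+ 2 , node y y₂ (node y y w))
               ∷ (+ 2 , node y y₁ (node y y (node y y w)))
               ∷ []

    -- Differentiating y₄ = 0 along z leaves 2 (A₃ + A A₂ + A² A₁) z, the remaining term 3 A⁴ z
    -- being zero. All these operators are self-adjoint, so the pairing of this with w is the
    -- pairing of z with `relation`, and z is arbitrary.
    adjoint-relation : ∀ w → let open Calculus F (environment η w) in ⟦ relation (leaf 1) ⟧ ≈ ε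
    adjoint-relation w = nondegenerate λ z → S.trans (⟨⟩-cong (V.sym (δ-η z)) V.refl) (at z)
      where
      module _ (z : ∣V∣) where
        open Derivation (δ z)
        iterate : ℕ → ∣V∣
        iterate zero    = η
        iterate (suc i) = dᵥ (iterate i)
        module C₁ = Calculus F iterate
        module C₂ = Calculus F (environment (iterate 1) w)
        open C₁.Differentiation (δ z) (λ i → [ leaf (suc i) ]) (λ i → C₁.VE.eval-[] (leaf (suc i)))

        -- The direction is written `leaf 2` here, because `leaf 1` is reserved for w. In `C₂` that
        -- leaf has the value which `leaf 1` has in `C₁`, so the vanishing proved in `C₁` carries
        -- over by computation.
        dy₄ : Lin
        dy₄ = bind (D (λ _ → [ leaf 2 ])) [ y₄ ]

        dy₄-vanishes : C₂.⟦ dy₄ ⟧ ≈ ε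
        dy₄-vanishes = D-vanishes [ y₄ ] (V.trans (C₁.VE.eval-[] y₄) (nilpotent η))

        A⁴ : Rules
        A⁴ = (A (A (A (A (leaf 1)))) , []) ∷ (A (A (A (A (leaf 2)))) , []) ∷ []

        at : ⟨ dᵥ η , C₂.⟦ relation (leaf 1) ⟧ ⟩ ≈ˢ εˢ
        at = S.trans (S.sym (C₂.pairs-≈ (leaf 2) (relation (leaf 1))))
          (S.trans (C₂.by-normᵖ A⁴ [] (nilpotent _ ∷ nilpotent _ ∷ []) []
                     (pairs (leaf 2) (relation (leaf 1))) (pairs (leaf 1) dy₄) refl)
          (C₂.pairs-vanish (leaf 1) dy₄ dy₄-vanishes))

    open Calculus F (λ _ → η) hiding (module V; module S)

    -- A record, since `l` could not be inferred from its value: evaluation is not injective. The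
    -- same holds for the three records that follow.
    record Vanishes (l : Lin) : Set ℓᵥ where
      constructor vanishing
      field proof : ⟦ l ⟧ ≈ ε

    record Vanishesᵖ (l : SC.Lin) : Set ℓₛ where
      constructor vanishing
      field proof : ⟦ l ⟧ˢ ≈ˢ εˢ

    open Vanishes
    open Vanishesᵖ

    infix 4 _↦_ _↦ᵖ_
    record _↦_ (t : Tree) (l : Lin) : Set ℓᵥ where
      constructor rule
      field holds : ⟦ t ⟧ᵗ ≈ ⟦ l ⟧

    record _↦ᵖ_ (p : Pair) (l : SC.Lin) : Set ℓₛ where
      constructor rule
      field holds : ⟦ p ⟧ᵖ ≈ˢ ⟦ l ⟧ˢ

    open _↦_
    open _↦ᵖ_

    -- A right-hand side is not rewritten again, so it must be normal for the older rules;
    -- newer rules take precedence.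
    record Theory : Set (ℓᵥ ⊔ ℓₛ) where
      field
        rules       : Rules
        rules-valid : Valid rules
        pairRules       : PairRules
        pairRules-valid : Validᵖ pairRules

    open Theory

    infixl 3 _▸_ _▸ᵖ_
    _▸_ : ∀ {t l} → Theory → t ↦ l → Theory
    _▸_ {t} {l} T r = record
      { rules           = (t , l) ∷ rules T
      ; rules-valid     = holds r ∷ rules-valid T
      ; pairRules       = pairRules T
      ; pairRules-valid = pairRules-valid T
      }

    _▸ᵖ_ : ∀ {p l} → Theory → p ↦ᵖ l → Theory
    _▸ᵖ_ {p} {l} T r = record
      { rules           = rules T
      ; rules-valid     = rules-valid T
      ; pairRules       = (p , l) ∷ pairRules T
      ; pairRules-valid = holds r ∷ pairRules-valid T
      }

    -- The known relation m turns out to be `suc n` times the difference of `t` and `l`, modulo the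
    -- rules of `T`; torsion-freeness removes the factor. The argument `n` is thus one less than the
    -- coefficient divided by.
    solve : ∀ T n {t l m} → Vanishes m →
            bind (norm (rules T)) (scale (+ suc n) ([ t ] ⊝ l) ⊝ m) ≡ [] → t ↦ l
    solve T n {t} {l} {m} z eq = rule (V.trans (V.sym (VE.eval-[] t)) (VG.x∙y⁻¹≈ε⇒x≈y _ _
      (V.trans (V.sym (VE.eval-⊝ [ t ] l)) (cancel n (V.trans
        (V.sym (VE.eval-scale (+ suc n) ([ t ] ⊝ l)))
        (V.trans (by-norm (rules T) (rules-valid T) (scale (+ suc n) ([ t ] ⊝ l)) m eq) (proof z)))))))

    solveᵖ : ∀ T n {p l m} → Vanishesᵖ m →
             SC.bind (normᵖ (rules T) (pairRules T)) (SC.scale (+ suc n) (SC.[ p ] SC.⊝ l) SC.⊝ m) ≡ [] →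
             p ↦ᵖ l
    solveᵖ T n {p} {l} {m} z eq = rule (S.trans (S.sym (SE.eval-[] p)) (SG.x∙y⁻¹≈ε⇒x≈y _ _
      (S.trans (S.sym (SE.eval-⊝ SC.[ p ] l)) (cancelˢ n (S.trans
        (S.sym (SE.eval-scale (+ suc n) (SC.[ p ] SC.⊝ l)))
        (S.trans (by-normᵖ (rules T) (pairRules T) (rules-valid T) (pairRules-valid T)
                    (SC.scale (+ suc n) (SC.[ p ] SC.⊝ l)) m eq)
                 (proof z)))))))

    vanishes : ∀ {t l} → t ↦ l → Vanishes ([ t ] ⊝ l)
    vanishes {t} {l} e = vanishing (VE.⊝-vanishes [ t ] l (V.trans (VE.eval-[] t) (holds e)))

    vanishesᵖ : ∀ {p l} → p ↦ᵖ l → Vanishesᵖ (SC.[ p ] SC.⊝ l)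
    vanishesᵖ {p} {l} e = vanishing (SE.⊝-vanishes SC.[ p ] l (S.trans (SE.eval-[] p) (holds e)))

    -- Every leaf stands for η, and `δ ⟦ z ⟧` sends η to the value of `z`; the derivative replaces
    -- the leaves by `z`, one at a time.
    along : ∀ z {m} → Vanishes m → Vanishes (bind (D λ _ → z) m)
    along z {m} e = vanishing (D-vanishes m (proof e))
      where open Differentiation (δ ⟦ z ⟧) (λ _ → z) (λ _ → V.sym (δ-η ⟦ z ⟧))

    alongᵖ : ∀ z {m} → Vanishesᵖ m → Vanishesᵖ (SC.bind (Dᵖ λ _ → z) m)
    alongᵖ z {m} e = vanishing (Dᵖ-vanishes m (proof e))
      where open Differentiation (δ ⟦ z ⟧) (λ _ → z) (λ _ → V.sym (δ-η ⟦ z ⟧))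

    paired : ∀ s {l} → Vanishes l → Vanishesᵖ (pairs s l)
    paired s {l} e = vanishing (pairs-vanish s l (proof e))

    combine : ∀ {l m} → Vanishesᵖ l → ∀ c → Vanishesᵖ m → Vanishesᵖ (l SC.⊕ SC.scale c m)
    combine {l} {m} z c z′ = vanishing (S.trans (SE.eval-⊕ l (SC.scale c m))
      (S.trans (S.∙-cong (proof z) (S.trans (SE.eval-scale c m)
        (S.trans (SG.·-cong c (proof z′)) (Additive.ε-homo (SE.·-additive c)))))
        (S.identityˡ S.ε)))

    relation-vanishes : ∀ t → Vanishes (relation t)
    relation-vanishes t = vanishing (adjoint-relation ⟦ t ⟧ᵗ)

    infix 5 _∥_
    _∥_ : Tree → Tree → Pair
    _∥_ = canonical

    -- In `normᵖ` a vector rule fires only where its left side is a subtree of the pair as it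
    -- happens to be rooted. Its consequence for a scalar is therefore recorded separately, under
    -- the canonical root.
    pair-rule : ∀ s {t l} → t ↦ l → s ∥ t ↦ᵖ SC.bind (λ t → SC.[ s ∥ t ]) l
    pair-rule s {t} {l} r = rule (S.trans (canonical-≈ s t) (S.trans (⟨⟩-cong V.refl (holds r))
      (S.sym (eval-bindᵗᵖ (⟨⟩-additive₂ ⟦ s ⟧ᵗ)
        (λ t → S.trans (SE.eval-[] (s ∥ t)) (canonical-≈ s t)) l))))

    V₁₂ V₁₃ V₂₂ V₂₃ V₃₃ B₁₁₂ B₁₂₂ B₁₁₃ A²k A₁W₀ A₂W₀ A₁W₁ : Tree
    V₁₂  = mk y y₁ y₂
    V₁₃  = mk y y₁ y₃
    V₂₂  = mk y y₂ y₂
    V₂₃  = mk y y₂ y₃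
    V₃₃  = mk y y₃ y₃
    B₁₁₂ = mk y₁ y₁ y₂
    B₁₂₂ = mk y₁ y₂ y₂
    B₁₁₃ = mk y₁ y₁ y₃
    A²k  = A (A k)
    A₁W₀ = mk y y₁ W₀
    A₂W₀ = mk y y₂ W₀
    A₁W₁ = mk y y₁ W₁

    T₀ T₁ T₂ T₃ T₄ T₅ T₆ T₇ T₈ T₉ T₁₀ T₁₁ T₁₂ T₁₃ : Theory

    y₄-rule : y₄ ↦ []
    y₄-rule = rule (nilpotent η)

    T₀ = record
      { rules       = (y₄ , []) ∷ []
      ; rules-valid = holds y₄-rule ∷ []
      ; pairRules       = []
      ; pairRules-valid = []
      }

    -- For w = y the relation reads 2 (y₄ + 2 V₁₂), and y₄ = 0.
    V₁₂-rule : V₁₂ ↦ []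
    V₁₂-rule = solve T₀ 3 (relation-vanishes y) refl

    V₂₃-rule : V₂₃ ↦ []
    V₂₃-rule = solve T₀ 3 (relation-vanishes y₂) refl

    T₁ = T₀ ▸ V₁₂-rule ▸ V₂₃-rule

    -- The derivative of y₄ along y₁ is 2 V₁₃ + 2 A V₁₂ + 2 W₂ + 3 A⁴ y₁, in which only the terms
    -- with V₁₃ and W₂ survive.
    V₁₃-rule : V₁₃ ↦ -[1+ 0 ] ∙ᵗ W₂
    V₁₃-rule = solve T₁ 1 (along [ y₁ ] (vanishes y₄-rule)) refl

    V₂₂-rule : V₂₂ ↦ -[1+ 1 ] ∙ᵗ V₁₃
    V₂₂-rule = solve T₁ 1 (relation-vanishes y₁) refl

    V₃₃-rule : V₃₃ ↦ []
    V₃₃-rule = solve T₁ 1 (relation-vanishes y₃) refl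

    V₂₂-rule′ : V₂₂ ↦ + 2 ∙ᵗ W₂
    V₂₂-rule′ = solve (T₁ ▸ V₁₃-rule) 0 (vanishes V₂₂-rule) refl

    T₂ = T₁ ▸ V₁₃-rule ▸ V₂₂-rule′ ▸ V₃₃-rule

    -- The derivative of y₄ along y₂ reduces to 2 A V₂₂, and V₂₂ = 2 W₂.
    W₃-rule : W₃ ↦ []
    W₃-rule = solve T₂ 3 (along [ y₂ ] (vanishes y₄-rule)) refl

    T₃ = T₂ ▸ W₃-rule

    -- Along y₁ the derivatives of y, y₁ and y₂ are y₁, 3 y₂ and 3 y₃ + 2 W₀; this gives B₁₁₂ + 3
    -- V₂₂ + 3 V₁₃ + 2 A₁W₀ = 0.
    B₁₁₂-rule : B₁₁₂ ↦ + 3 ∙ᵗ V₁₃ ⊝ + 2 ∙ᵗ A₁W₀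
    B₁₁₂-rule = solve T₃ 0 (along [ y₁ ] (vanishes V₁₂-rule)) refl

    B₁₂₂-rule : B₁₂₂ ↦ []
    B₁₂₂-rule = solve T₃ 0 (along [ y₂ ] (vanishes V₁₂-rule)) refl

    T₄ = T₃ ▸ B₁₂₂-rule

    -- The relation V₂₂ = -2 V₁₃ is differentiated, not its form with W₂, whose derivative would
    -- bring in A²k as a second unknown. That one is then determined by `A²k-rule`.
    B₁₁₃-rule : B₁₁₃ ↦ -[1+ 1 ] ∙ᵗ A₂W₀ ⊝ + 2 ∙ᵗ A₁W₁
    B₁₁₃-rule = solve T₄ 1 (along [ y₁ ] (vanishes V₂₂-rule)) refl

    A²k-rule : A²k ↦ + 2 ∙ᵗ A₂W₀ ⊝ + 2 ∙ᵗ A₁W₁ ⊝ + 2 ∙ᵗ A A₁W₀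
    A²k-rule = solve (T₄ ▸ B₁₁₃-rule) 0 (along [ y₁ ] (vanishes V₁₃-rule)) refl

    -- Relations between scalars

    φ₄ φ₅ φ₆ φ₇ ω₁ ω₂ : Pair
    φ₄ = k ∥ y
    φ₅ = k ∥ y₁
    φ₆ = k ∥ y₂
    φ₇ = k ∥ y₃
    ω₁ = W₀ ∥ W₁
    ω₂ = W₀ ∥ W₂

    -- Moving one A across the pairing turns ⟨ W₀ , W₃ ⟩ into ⟨ W₁ , W₂ ⟩: both have the same
    -- unrooted tree, so `canonical` returns the same pair.
    W₁W₂-rule : W₁ ∥ W₂ ↦ᵖ []
    W₁W₂-rule = pair-rule W₀ W₃-rule

    T₅ = T₄ ▸ᵖ pair-rule k y₄-rule ▸ᵖ pair-rule (A k) y₄-rule ▸ᵖ pair-rule (A k) V₁₂-rule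
            ▸ᵖ W₁W₂-rule ▸ᵖ pair-rule y₂ W₃-rule ▸ᵖ pair-rule y₁ B₁₂₂-rule
            ▸ᵖ pair-rule W₀ V₁₂-rule ▸ᵖ pair-rule W₁ V₁₂-rule ▸ᵖ pair-rule k V₁₂-rule
            ▸ᵖ pair-rule W₀ V₂₃-rule ▸ᵖ pair-rule W₀ V₁₃-rule ▸ᵖ pair-rule W₀ V₂₂-rule′

    W₁V₁₃-rule : W₁ ∥ V₁₃ ↦ᵖ []
    -- `T₁` does not yet rewrite V₁₃. Under the later rules the paired relation would collapse to
    -- zero and say nothing about this scalar.
    W₁V₁₃-rule = solveᵖ (T₁ ▸ᵖ W₁W₂-rule) 0 (paired W₁ (vanishes V₁₃-rule)) refl

    T₆ = T₅ ▸ᵖ W₁V₁₃-rule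

    -- The star with arms y₁, y₁, y₂, y₃ is both ⟨ y₂ , B₁₁₃ ⟩ and ⟨ y₃ , B₁₁₂ ⟩. The two rules
    -- evaluate it as -4 ω₂ and as 2 ω₂, so 6 ω₂ = 0.
    ω₂-rule : ω₂ ↦ᵖ []
    ω₂-rule = solveᵖ T₆ 5
      (combine (paired y₂ (vanishes B₁₁₃-rule)) -[1+ 0 ] (paired y₃ (vanishes B₁₁₂-rule))) refl

    W₀V₁₃-rule : W₀ ∥ V₁₃ ↦ᵖ []
    W₀V₁₃-rule = solveᵖ (T₁ ▸ᵖ ω₂-rule) 0 (paired W₀ (vanishes V₁₃-rule)) refl

    W₀V₂₂-rule : W₀ ∥ V₂₂ ↦ᵖ []
    W₀V₂₂-rule = solveᵖ (T₁ ▸ᵖ ω₂-rule) 0 (paired W₀ (vanishes V₂₂-rule′)) refl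

    T₇ = T₆ ▸ᵖ ω₂-rule ▸ᵖ W₀V₁₃-rule ▸ᵖ W₀V₂₂-rule

    y₃B₁₁₂-rule : y₃ ∥ B₁₁₂ ↦ᵖ []
    y₃B₁₁₂-rule = solveᵖ T₇ 0 (paired y₂ (vanishes B₁₁₃-rule)) refl

    y₃B₁₁₃-rule : y₃ ∥ B₁₁₃ ↦ᵖ []
    y₃B₁₁₃-rule = solveᵖ T₇ 0 (paired y₃ (vanishes B₁₁₃-rule)) refl

    -- Rooted at another arm, φ₇ is ⟨ y₁ , B₁₁₃ ⟩; of the two terms of B₁₁₃, the one with A₂W₀
    -- contributes ⟨ V₁₂ , W₀ ⟩ = 0.
    φ₇-rule : φ₇ ↦ᵖ -[1+ 1 ] ∙ᵖ ω₁
    φ₇-rule = solveᵖ T₇ 0 (paired y₁ (vanishes B₁₁₃-rule)) refl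

    T₈ = T₇ ▸ᵖ y₃B₁₁₂-rule ▸ᵖ y₃B₁₁₃-rule ▸ᵖ φ₇-rule

    -- After cancellation this is 4 B y₁ y₁ W₀ - 6 A₁W₁ + 6 A₂W₀ + 2 B y y₁ k = 0, a relation that
    -- is used through its pairings with y₁ and y₂.
    d₁B₁₁₂ : Vanishes _
    d₁B₁₁₂ = along [ y₁ ] (vanishes B₁₁₂-rule)

    kW₀-rule : k ∥ W₀ ↦ᵖ + 1 ∙ᵖ ω₁
    kW₀-rule = solveᵖ T₈ 5 (paired y₁ d₁B₁₁₂) refl

    W₀B₁₁₂-rule : W₀ ∥ B₁₁₂ ↦ᵖ []
    W₀B₁₁₂-rule = solveᵖ T₈ 3 (paired y₂ d₁B₁₁₂) refl

    T₉ = T₈ ▸ᵖ W₀B₁₁₂-rule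

    W₀A₁W₀-rule : W₀ ∥ A₁W₀ ↦ᵖ []
    W₀A₁W₀-rule = solveᵖ T₉ 1 (paired W₀ (vanishes B₁₁₂-rule)) refl

    T₁₀ = T₉ ▸ᵖ W₀A₁W₀-rule

    -- Differentiating φ₇ + 2 ω₁ = 0 along y₁ gives 2 ⟨ k , W₁ ⟩ from φ₇ and 4 ⟨ k , W₁ ⟩ from 2 ω₁;
    -- the other terms are known to vanish.
    kW₁-rule : k ∥ W₁ ↦ᵖ []
    kW₁-rule = solveᵖ T₁₀ 5 (alongᵖ [ y₁ ] (vanishesᵖ φ₇-rule)) refl


    kk-rule : k ∥ k ↦ᵖ []
    kk-rule = solveᵖ (T₁₀ ▸ᵖ kW₁-rule) 0 (alongᵖ [ y₁ ] (vanishesᵖ kW₀-rule)) refl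

    T₁₁ = T₁₀ ▸ᵖ kW₁-rule ▸ᵖ kk-rule

    W₀A²k-rule : W₀ ∥ A²k ↦ᵖ + 2 ∙ᵖ (W₀ ∥ A₂W₀) SC.⊝ + 4 ∙ᵖ (W₀ ∥ A₁W₁)
    W₀A²k-rule = solveᵖ T₁₁ 0 (paired W₀ (vanishes A²k-rule)) refl

    W₁B₁₁₂-rule : W₁ ∥ B₁₁₂ ↦ᵖ -[1+ 1 ] ∙ᵖ (W₁ ∥ A₁W₀)
    W₁B₁₁₂-rule = solveᵖ T₁₁ 0 (paired W₁ (vanishes B₁₁₂-rule)) refl

    -- The derivative of φ₇ + 2 ω₁ = 0 along y₂ is 4 ⟨ k , W₂ ⟩ plus terms in ⟨ W₀ , A₂W₀ ⟩ and ⟨ W₀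
    -- , A₁W₁ ⟩. These are exactly 2 ⟨ W₀ , A²k ⟩, which is 2 ⟨ k , W₂ ⟩ again.
    kW₂-rule : k ∥ W₂ ↦ᵖ []
    kW₂-rule = solveᵖ (T₁₁ ▸ B₁₁₂-rule ▸ᵖ W₁B₁₁₂-rule ▸ᵖ pair-rule k V₂₂-rule′) 5
      (combine (alongᵖ [ y₂ ] (vanishesᵖ φ₇-rule)) (+ 2) (vanishesᵖ W₀A²k-rule)) refl

    T₁₂ = T₁₁ ▸ᵖ kW₂-rule

    kV₁₃-rule : k ∥ V₁₃ ↦ᵖ []
    kV₁₃-rule = solveᵖ (T₁ ▸ᵖ kW₂-rule) 0 (paired k (vanishes V₁₃-rule)) refl

    kV₂₂-rule : k ∥ V₂₂ ↦ᵖ []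
    kV₂₂-rule = solveᵖ (T₁ ▸ᵖ kW₂-rule) 0 (paired k (vanishes V₂₂-rule′)) refl

    AkV₁₃-rule : A k ∥ V₁₃ ↦ᵖ []
    AkV₁₃-rule = solveᵖ (T₁ ▸ᵖ pair-rule k W₃-rule) 0 (paired (A k) (vanishes V₁₃-rule)) refl

    -- Both ⟨ y₁ , V₁₃ ⟩ and ⟨ y₁ , W₂ ⟩ are rootings of this scalar, so V₁₃ + W₂ = 0 gives twice
    -- it.
    y₃W₀-rule : y₃ ∥ W₀ ↦ᵖ []
    y₃W₀-rule = solveᵖ T₁ 1 (paired y₁ (vanishes V₁₃-rule)) refl

    -- These rules suffice for the derivatives of φ₇ along y₁, y₂ and y₃ to reduce to zero, which
    -- ends the triangular system at the eigenvalue 16.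
    T₁₃ = T₁₂ ▸ᵖ pair-rule y y₄-rule ▸ᵖ pair-rule y₁ y₄-rule ▸ᵖ pair-rule y₂ y₄-rule
              ▸ᵖ pair-rule W₀ y₄-rule ▸ᵖ pair-rule y₁ V₁₂-rule ▸ᵖ y₃W₀-rule
              ▸ᵖ pair-rule A²k y₄-rule ▸ᵖ pair-rule k V₂₃-rule ▸ᵖ AkV₁₃-rule
              ▸ᵖ kV₁₃-rule ▸ᵖ kV₂₂-rule ▸ᵖ kW₀-rule

    -- y + 2 (y₁ + 3 y₂ + 9 y₃) is the image of y = X + B y y y under the Euler derivation:
    -- E y = X + 3 A (E y), that is E y = (1 - 3A)⁻¹ (y - y₁).
    euler : Lin
    euler = [ y ] ⊕ + 2 ∙ᵗ y₁ ⊕ + 6 ∙ᵗ y₂ ⊕ + 18 ∙ᵗ y₃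

    open Derivation (δ ⟦ euler ⟧) using (dₛ)

    -- q is four times the potential of y₁ = y - X, see gradient.
    q : SC.Lin
    q = SC.[ y ∥ y₁ ] SC.⊝ + 2 ∙ᵖ (y₁ ∥ y₁)

    euler-field : ⟦ euler ⟧ V.∙ (3 ×′ B η η ⟦ euler ⟧) V.⁻¹ ≈ η V.∙ B η η η V.⁻¹
    euler-field = begin
      ⟦ euler ⟧ V.∙ (3 ×′ B η η ⟦ euler ⟧) V.⁻¹
        ≈⟨ V.∙-congˡ (V.⁻¹-cong (V.trans (VE.eval-scale (+ 3) A-euler) (VG.×-congʳ 3 A-euler-≈))) ⟨
      ⟦ euler ⟧ V.∙ ⟦ scale (+ 3) A-euler ⟧ V.⁻¹   ≈⟨ VE.eval-⊝ euler (scale (+ 3) A-euler) ⟨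
      ⟦ euler ⊝ scale (+ 3) A-euler ⟧
        ≈⟨ by-norm (rules T₀) (rules-valid T₀) (euler ⊝ scale (+ 3) A-euler) ([ y ] ⊝ [ y₁ ]) refl ⟩
      ⟦ [ y ] ⊝ [ y₁ ] ⟧                            ≈⟨ VE.eval-⊝ [ y ] [ y₁ ] ⟩
      ⟦ [ y ] ⟧ V.∙ ⟦ [ y₁ ] ⟧ V.⁻¹                 ≈⟨ V.∙-cong (VE.eval-[] y) (V.⁻¹-cong (VE.eval-[] y₁)) ⟩
      η V.∙ B η η η V.⁻¹                            ∎
      where
      open SetoidReasoning V.setoid
      A-euler : Lin
      A-euler = bind (λ t → [ node y y t ]) euler
      A-euler-≈ : ⟦ A-euler ⟧ ≈ B η η ⟦ euler ⟧
      A-euler-≈ = eval-bindᵗ (B-additive₃ η η) {λ t → [ node y y t ]} (λ t → VE.eval-[] (node y y t)) euler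

    -- By symmetry ∇⟨ y , y₁ ⟩ = 4 ⟨ y₁ , ∇y ⟩ and ∇⟨ y₁ , y₁ ⟩ = 6 ⟨ y₁ , A ∇y ⟩. The coefficient
    -- -2 in q thus produces 4 ⟨ y₁ , (1 - 3A) ∇y ⟩, and the hypothesis says that (1 - 3A) ∇y is x.
    gradient : (d : Derivation F) → let open Derivation d renaming (dᵥ to ∇ᵥ; dₛ to ∇ₛ) in
               (x : ∣V∣) → ∇ᵥ η ≈ x V.∙ 3 ×′ B η η (∇ᵥ η) → ∇ₛ ⟦ q ⟧ˢ ≈ˢ 4 ×ˢ ⟨ B η η η , x ⟩
    gradient d x e = begin
      ∇ₛ ⟦ q ⟧ˢ                                            ≈⟨ differentiateᵖ q ⟨
      C₁.⟦ SC.bind (Dᵖ λ i → [ leaf (suc i) ]) q ⟧ˢ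
        ≈⟨ C₁.by-normᵖ [] [] [] [] (SC.bind (Dᵖ λ i → [ leaf (suc i) ]) q) result refl ⟩
      4 ×ˢ ⟨ y₁′ , u ⟩ S.∙ ((12 ×ˢ ⟨ y₁′ , B η η u ⟩) S.⁻¹ S.∙ εˢ)
        ≈⟨ S.∙-cong (SG.×-congʳ 4 expanded) (S.identityʳ _) ⟩
      4 ×ˢ (⟨ y₁′ , x ⟩ S.∙ 3 ×ˢ ⟨ y₁′ , B η η u ⟩) S.∙ (12 ×ˢ ⟨ y₁′ , B η η u ⟩) S.⁻¹
        ≈⟨ S.∙-congʳ (SG.×-distrib-+ _ _ 4) ⟩
      4 ×ˢ ⟨ y₁′ , x ⟩ S.∙ 4 ×ˢ (3 ×ˢ ⟨ y₁′ , B η η u ⟩) S.∙ (12 ×ˢ ⟨ y₁′ , B η η u ⟩) S.⁻¹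
        ≈⟨ S.assoc _ _ _ ⟩
      4 ×ˢ ⟨ y₁′ , x ⟩ S.∙ (4 ×ˢ (3 ×ˢ ⟨ y₁′ , B η η u ⟩) S.∙ (12 ×ˢ ⟨ y₁′ , B η η u ⟩) S.⁻¹)
        ≈⟨ S.∙-congˡ (S.trans (S.∙-congʳ (SG.×-assocˡ _ 4 3)) (S.inverseʳ _)) ⟩
      4 ×ˢ ⟨ y₁′ , x ⟩ S.∙ εˢ                               ≈⟨ S.identityʳ _ ⟩
      4 ×ˢ ⟨ y₁′ , x ⟩                                      ∎
      where
      open SetoidReasoning S.setoid
      open Derivation d renaming (dᵥ to ∇ᵥ; dₛ to ∇ₛ)
      iterate : ℕ → ∣V∣
      iterate zero    = η
      iterate (suc i) = ∇ᵥ (iterate i)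
      module C₁ = Calculus F iterate
      open C₁.Differentiation d (λ i → [ leaf (suc i) ]) (λ i → C₁.VE.eval-[] (leaf (suc i)))
      u y₁′ : ∣V∣
      u   = ∇ᵥ η
      y₁′ = B η η η
      result : SC.Lin
      result = (+ 4 , y₁ , leaf 1) ∷ (-[1+ 11 ] , y₁ , node y y (leaf 1)) ∷ []
      expanded : ⟨ y₁′ , u ⟩ ≈ˢ ⟨ y₁′ , x ⟩ S.∙ 3 ×ˢ ⟨ y₁′ , B η η u ⟩
      expanded = S.trans (⟨⟩-cong V.refl e) (S.trans (Additive.∙-homo (⟨⟩-additive₂ y₁′) _ _)
        (S.∙-congˡ (Additive.×-homo (⟨⟩-additive₂ y₁′) 3 _)))

    potential : AbelianGroup.Carrier S
    potential = ⟦ q ⟧ˢ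

    Eigenrelation : ℕ → SC.Lin → SC.Lin → Set
    Eigenrelation n l m = SC.bind (normᵖ (rules T₁₃) (pairRules T₁₃))
      (SC.bind (Dᵖ λ _ → euler) l SC.⊝ (SC.scale (+ n) l SC.⊕ m)) ≡ []

    eigenrelation : ∀ n l m → Eigenrelation n l m → dₛ ⟦ l ⟧ˢ ≈ˢ ⟦ SC.scale (+ n) l SC.⊕ m ⟧ˢ
    eigenrelation n l m eq = S.trans (S.sym (differentiateᵖ l))
      (by-normᵖ (rules T₁₃) (pairRules T₁₃) (rules-valid T₁₃) (pairRules-valid T₁₃)
         (SC.bind (Dᵖ λ _ → euler) l) (SC.scale (+ n) l SC.⊕ m) eq)
      where open Differentiation (δ ⟦ euler ⟧) (λ _ → euler) (λ _ → V.sym (δ-η ⟦ euler ⟧))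

    -- To be applied with χ the coefficient at an exponent α and e the degree of α, on which the
    -- Euler derivation acts as multiplication by e.
    module _ (T : AbelianGroup c ℓ)
             {χ : AbelianGroup.Carrier S → AbelianGroup.Carrier T} (χ-additive : Additive S T χ)
             (e : ℕ) (χ-eigen : ∀ x → AbelianGroup._≈_ T (χ (dₛ x)) (IntegerMultiples._×′_ T e (χ x)))
             (e-cancel : ∀ j → j ℕ.≤ 6 → ∀ {x} →
                AbelianGroup._≈_ T (IntegerMultiples._×′_ T e x) (IntegerMultiples._×′_ T (4 ℕ.+ 2 ℕ.* j) x) →
                AbelianGroup._≈_ T x (AbelianGroup.ε T)) where
      open AbelianGroup T using () renaming (_≈_ to _≈ᵀ_; ε to εᵀ)
      open IntegerMultiples T using () renaming (_×′_ to _×ᵀ_)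
      private
        module T = AbelianGroup T
        module TG = IntegerMultiples T
      open Additive χ-additive

      χ-vanishes : ∀ {l} → All (λ (_ , p) → χ ⟦ p ⟧ᵖ ≈ᵀ εᵀ) l → χ ⟦ l ⟧ˢ ≈ᵀ εᵀ
      χ-vanishes {[]} [] = ε-homo
      χ-vanishes {(c , p) ∷ l} (z ∷ zs) = T.trans (∙-homo _ _) (T.trans
        (T.∙-cong (T.trans (·-homo c ⟦ p ⟧ᵖ) (T.trans (TG.·-cong c z) (·-ε c))) (χ-vanishes zs))
        (T.identityˡ εᵀ))
        where
        ·-ε : ∀ c → c TG.· εᵀ ≈ᵀ εᵀ
        ·-ε c = Additive.ε-homo (Combinations.Evaluation.·-additive _≟ᵖ_ _<ᵖ_ T (λ _ → εᵀ) c)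

      -- Back substitution: once χ kills the part m with larger eigenvalues, both e and 4 + 2j
      -- multiply χ ⟦ l ⟧ to the same element.
      step : ∀ j → j ℕ.≤ 6 → ∀ l m → Eigenrelation (4 ℕ.+ 2 ℕ.* j) l m →
             All (λ (_ , p) → χ ⟦ p ⟧ᵖ ≈ᵀ εᵀ) m → χ ⟦ l ⟧ˢ ≈ᵀ εᵀ
      step j j≤6 l m eq zs = e-cancel j j≤6 (begin
        e ×ᵀ χ ⟦ l ⟧ˢ                      ≈⟨ χ-eigen _ ⟨
        χ (dₛ ⟦ l ⟧ˢ)                      ≈⟨ cong (eigenrelation (4 ℕ.+ 2 ℕ.* j) l m eq) ⟩
        χ ⟦ SC.scale n l SC.⊕ m ⟧ˢ         ≈⟨ cong (SE.eval-⊕ (SC.scale n l) m) ⟩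
        χ (⟦ SC.scale n l ⟧ˢ S.∙ ⟦ m ⟧ˢ)   ≈⟨ ∙-homo _ _ ⟩
        χ ⟦ SC.scale n l ⟧ˢ T.∙ χ ⟦ m ⟧ˢ
          ≈⟨ T.∙-cong (T.trans (cong (SE.eval-scale n l)) (·-homo n _)) (χ-vanishes zs) ⟩
        n TG.· χ ⟦ l ⟧ˢ T.∙ εᵀ             ≈⟨ T.identityʳ _ ⟩
        n TG.· χ ⟦ l ⟧ˢ                    ∎)
        where
        open SetoidReasoning T.setoid
        n = + (4 ℕ.+ 2 ℕ.* j)

      stepᵖ : ∀ j → j ℕ.≤ 6 → ∀ p m → Eigenrelation (4 ℕ.+ 2 ℕ.* j) SC.[ p ] m →
              All (λ (_ , p) → χ ⟦ p ⟧ᵖ ≈ᵀ εᵀ) m → χ ⟦ p ⟧ᵖ ≈ᵀ εᵀ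
      stepᵖ j j≤6 p m eq zs =
        T.trans (cong (S.sym (SE.eval-[] p))) (step j j≤6 SC.[ p ] m eq zs)

      -- The Euler derivation is triangular on the span of q, ⟨y₁,y₁⟩, ⟨y₁,y₂⟩, φ₄, φ₅, φ₆, φ₇,
      -- with eigenvalues 4, 6, …, 16.
      q-vanishes : χ ⟦ q ⟧ˢ ≈ᵀ εᵀ
      q-vanishes = step 0 (ℕ.m≤m+n 0 6) q ((+ 4 , y₁ ∥ y₁) ∷ []) refl (z₂ ∷ [])
        where
        z₇ = stepᵖ 6 (ℕ.m≤m+n 6 0) φ₇ [] refl []
        z₆ = stepᵖ 5 (ℕ.m≤m+n 5 1) φ₆ ((+ 4 , φ₇) ∷ []) refl (z₇ ∷ [])
        z₅ = stepᵖ 4 (ℕ.m≤m+n 4 2) φ₅ ((+ 24 , φ₆) ∷ (+ 72 , φ₇) ∷ []) refl (z₆ ∷ z₇ ∷ [])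
        z₄ = stepᵖ 3 (ℕ.m≤m+n 3 3) φ₄ ((+ 2 , φ₅) ∷ (+ 6 , φ₆) ∷ (+ 18 , φ₇) ∷ []) refl (z₅ ∷ z₆ ∷ z₇ ∷ [])
        z₃ = stepᵖ 2 (ℕ.m≤m+n 2 4) (y₁ ∥ y₂) ((+ 4 , φ₄) ∷ []) refl (z₄ ∷ [])
        z₂ = stepᵖ 1 (ℕ.m≤m+n 1 5) (y₁ ∥ y₁) ((+ 12 , y₁ ∥ y₂) ∷ []) refl (z₃ ∷ [])

-- Power series in one variable over a commutative ring

module Univariate {c ℓ} (R : CommutativeRing c ℓ) where
  open CommutativeRing R
  open SemiringSum semiring using (sum; sum-cong-≋; ∑-distrib-+; *-distribˡ-sum)
  open CommutativeSemigroupProperties (CommutativeMonoid.commutativeSemigroup +-commutativeMonoid)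
    using (interchange; x∙yz≈y∙xz)
  open SemiringMult semiring using (×-comm-*) renaming (_×_ to _×′_)
  open Multiples +-commutativeMonoid using (×-distrib-+)
  open SetoidReasoning setoid

  PowerSeries : Set c
  PowerSeries = ℕ → Carrier

  infix 4 _≋_
  _≋_ : PowerSeries → PowerSeries → Set ℓ
  f ≋ g = ∀ a → f a ≈ g a

  terms : PowerSeries → PowerSeries → ∀ a → Fin (suc a) → Carrier
  terms f g a i = f (toℕ i) * g (a ∸ toℕ i)

  infixl 7 _⊛_
  _⊛_ : PowerSeries → PowerSeries → PowerSeries
  (f ⊛ g) a = sum (terms f g a)

  one : PowerSeries
  one zero    = 1#
  one (suc _) = 0#

  ⊛-cong : ∀ {f f′ g g′} → f ≋ f′ → g ≋ g′ → f ⊛ g ≋ f′ ⊛ g′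
  ⊛-cong f≋ g≋ a = sum-cong-≋ {suc a} λ i → *-cong (f≋ (toℕ i)) (g≋ (a ∸ toℕ i))

  ⊛-congʳ : ∀ {f f′} g → f ≋ f′ → f ⊛ g ≋ f′ ⊛ g
  ⊛-congʳ g f≋ = ⊛-cong {g = g} f≋ λ _ → refl

  ⊛-congˡ : ∀ f {g g′} → g ≋ g′ → f ⊛ g ≋ f ⊛ g′
  ⊛-congˡ f g≋ = ⊛-cong {f = f} (λ _ → refl) g≋

  ⊛-distribʳ-+ : ∀ h f g a → ((λ i → f i + g i) ⊛ h) a ≈ (f ⊛ h) a + (g ⊛ h) a
  ⊛-distribʳ-+ h f g a = 
    trans (sum-cong-≋ {suc a} λ i → distribʳ (h (a ∸ toℕ i)) (f (toℕ i)) (g (toℕ i)))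
          (∑-distrib-+ (terms f h a) (terms g h a))

  ⊛-*ˡ : ∀ k f g a → ((λ i → k * f i) ⊛ g) a ≈ k * (f ⊛ g) a
  ⊛-*ˡ k f g a = 
    trans (sum-cong-≋ {suc a} λ i → *-assoc k (f (toℕ i)) (g (a ∸ toℕ i)))
          (sym (*-distribˡ-sum k (terms f g a)))

  -- The defining sum splits off f 0; commutativity needs the mirror-image recursion, which splits
  -- off g 0.
  ⊛-last : ∀ f g a → (f ⊛ g) (suc a) ≈ (f ⊛ (g ∘ suc)) a + f (suc a) * g 0
  ⊛-last f g zero    = begin
    f 0 * g 1 + (f 1 * g 0 + 0#)   ≈⟨ +-cong (sym (+-identityʳ _)) (+-identityʳ _) ⟩
    f 0 * g 1 + 0# + f 1 * g 0     ∎
  ⊛-last f g (suc a) = trans (+-congˡ (⊛-last (f ∘ suc) g a)) (sym (+-assoc _ _ _))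

  ⊛-comm : ∀ f g → f ⊛ g ≋ g ⊛ f
  ⊛-comm f g zero    = +-congʳ (*-comm _ _)
  ⊛-comm f g (suc a) = begin
    f 0 * g (suc a) + ((f ∘ suc) ⊛ g) a   ≈⟨ +-cong (*-comm _ _) (⊛-comm (f ∘ suc) g a) ⟩
    g (suc a) * f 0 + (g ⊛ (f ∘ suc)) a   ≈⟨ +-comm _ _ ⟩
    (g ⊛ (f ∘ suc)) a + g (suc a) * f 0   ≈⟨ ⊛-last g f a ⟨
    (g ⊛ f) (suc a)                       ∎

  ⊛-assoc : ∀ f g h → (f ⊛ g) ⊛ h ≋ f ⊛ (g ⊛ h)
  ⊛-assoc f g h zero    = +-congʳ (begin
    (f 0 * g 0 + 0#) * h 0   ≈⟨ *-congʳ (+-identityʳ _) ⟩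
    f 0 * g 0 * h 0          ≈⟨ *-assoc _ _ _ ⟩
    f 0 * (g 0 * h 0)        ≈⟨ *-congˡ (+-identityʳ _) ⟨
    f 0 * (g 0 * h 0 + 0#)   ∎)
  ⊛-assoc f g h (suc a) = begin
    (f ⊛ g) 0 * h (suc a) + (((f ⊛ g) ∘ suc) ⊛ h) a
      ≈⟨ +-cong (trans (*-congʳ (+-identityʳ _)) (*-assoc _ _ _)) (⊛-distribʳ-+ h (λ i → f 0 * g (suc i)) ((f ∘ suc) ⊛ g) a) ⟩
    f 0 * (g 0 * h (suc a)) + (((λ i → f 0 * g (suc i)) ⊛ h) a + (((f ∘ suc) ⊛ g) ⊛ h) a)
      ≈⟨ +-congˡ (+-cong (⊛-*ˡ (f 0) (g ∘ suc) h a) (⊛-assoc (f ∘ suc) g h a)) ⟩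
    f 0 * (g 0 * h (suc a)) + (f 0 * ((g ∘ suc) ⊛ h) a + ((f ∘ suc) ⊛ (g ⊛ h)) a)
      ≈⟨ +-assoc _ _ _ ⟨
    f 0 * (g 0 * h (suc a)) + f 0 * ((g ∘ suc) ⊛ h) a + ((f ∘ suc) ⊛ (g ⊛ h)) a
      ≈⟨ +-congʳ (distribˡ _ _ _) ⟨
    f 0 * (g ⊛ h) (suc a) + ((f ∘ suc) ⊛ (g ⊛ h)) a ∎

  zero-⊛ : ∀ f g → (∀ i → f i ≈ 0#) → ∀ a → (f ⊛ g) a ≈ 0#
  zero-⊛ f g z zero    = trans (+-identityʳ _) (trans (*-congʳ (z 0)) (zeroˡ _))
  zero-⊛ f g z (suc a) = trans
    (+-cong (trans (*-congʳ (z 0)) (zeroˡ _)) (zero-⊛ (f ∘ suc) g (z ∘ suc) a)) (+-identityˡ _)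

  ⊛-identityˡ : ∀ f → one ⊛ f ≋ f
  ⊛-identityˡ f zero    = trans (+-identityʳ _) (*-identityˡ _)
  ⊛-identityˡ f (suc a) = trans
    (+-cong (*-identityˡ _) (zero-⊛ (one ∘ suc) f (λ _ → refl) a)) (+-identityʳ _)

  ⊛-distribˡ-+ : ∀ h f g a → (h ⊛ (λ i → f i + g i)) a ≈ (h ⊛ f) a + (h ⊛ g) a
  ⊛-distribˡ-+ h f g a = trans (⊛-comm h (λ i → f i + g i) a)
    (trans (⊛-distribʳ-+ h f g a) (+-cong (⊛-comm f h a) (⊛-comm g h a)))

  ⊛-isCommutativeRing : IsCommutativeRing _≋_ (λ f g a → f a + g a) _⊛_ (λ f a → - f a) (λ _ → 0#) one
  ⊛-isCommutativeRing = record
    { isRing = record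
      { +-isAbelianGroup = AbelianGroup.isAbelianGroup (Pointwise.abelianGroup ℕ +-abelianGroup)
      ; *-cong           = ⊛-cong
      ; *-assoc          = ⊛-assoc
      ; *-identity       = ⊛-identityˡ , λ f a → trans (⊛-comm f one a) (⊛-identityˡ f a)
      ; distrib          = ⊛-distribˡ-+ , ⊛-distribʳ-+
      }
    ; *-comm = ⊛-comm
    }

  derivative : PowerSeries → PowerSeries
  derivative f a = suc a ×′ f (suc a)

  derivative-⊛ : ∀ f g a →
    derivative (f ⊛ g) a ≈ (derivative f ⊛ g) a + (f ⊛ derivative g) a
  derivative-⊛ f g zero = begin
    f 0 * g 1 + (f 1 * g 0 + 0#) + 0#                  ≈⟨ trans (+-identityʳ _) (+-congˡ (+-identityʳ _)) ⟩
    f 0 * g 1 + f 1 * g 0                              ≈⟨ +-comm _ _ ⟩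
    f 1 * g 0 + f 0 * g 1                              ≈⟨ +-cong (trans (+-identityʳ _) (*-congʳ (+-identityʳ _))) (trans (+-identityʳ _) (*-congˡ (+-identityʳ _))) ⟨
    (f 1 + 0#) * g 0 + 0# + (f 0 * (g 1 + 0#) + 0#)    ∎
  derivative-⊛ f g (suc a) = begin
    suc (suc a) ×′ (f 0 * g (suc (suc a)) + (fs ⊛ g) (suc a))
      ≈⟨ ×-distrib-+ _ _ (suc (suc a)) ⟩
    suc (suc a) ×′ (f 0 * g (suc (suc a))) + ((fs ⊛ g) (suc a) + suc a ×′ (fs ⊛ g) (suc a))
      ≈⟨ +-cong (sym (×-comm-* (suc (suc a)) _ _)) (+-congˡ (derivative-⊛ fs g a)) ⟩
    f 0 * derivative g (suc a) + ((fs ⊛ g) (suc a) + ((derivative fs ⊛ g) a + (fs ⊛ derivative g) a))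
      ≈⟨ +-congˡ (+-assoc _ _ _) ⟨
    f 0 * derivative g (suc a) + ((fs ⊛ g) (suc a) + (derivative fs ⊛ g) a + (fs ⊛ derivative g) a)
      ≈⟨ x∙yz≈y∙xz _ _ _ ⟩
    (fs ⊛ g) (suc a) + (derivative fs ⊛ g) a + (f 0 * derivative g (suc a) + (fs ⊛ derivative g) a)
      ≈⟨ +-congʳ shifted ⟩
    (derivative f ⊛ g) (suc a) + (f ⊛ derivative g) (suc a) ∎
    where
    fs = f ∘ suc
    -- Writing f = f 0 + X fs, the derivative of f is fs + X fs′.
    shifted : (fs ⊛ g) (suc a) + (derivative fs ⊛ g) a ≈ (derivative f ⊛ g) (suc a)
    shifted = begin
      f 1 * g (suc a) + ((fs ∘ suc) ⊛ g) a + (derivative fs ⊛ g) a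
        ≈⟨ +-assoc _ _ _ ⟩
      f 1 * g (suc a) + (((fs ∘ suc) ⊛ g) a + (derivative fs ⊛ g) a)
        ≈⟨ +-cong (*-congʳ (+-identityʳ _)) (⊛-distribʳ-+ g (fs ∘ suc) (derivative fs) a) ⟨
      (f 1 + 0#) * g (suc a) + ((derivative f ∘ suc) ⊛ g) a ∎

-- The ring of power series in several variables

module SeriesRing {c ℓ} (K : CommutativeRing c ℓ) where
  open Polynomials K
  private
    module K = CommutativeRing K
    module KS = SemiringSum K.semiring
    module KM = SemiringMult K.semiring

  -ˢ_ : ∀ {n} → Series n → Series n
  (-ˢ f) α = K.- f α

  rawRing : ℕ → RawRing c ℓ
  rawRing n = record
    { Carrier = Series n ; _≈_ = _≈ˢ_ ; _+_ = _+ˢ_ ; _*_ = _*ˢ_ ; -_ = -ˢ_ ; 0# = constˢ K.0# ; 1# = constˢ K.1# }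

  -- The zero of the series ring is `constˢ 0#`, whose coefficients reduce only after the exponent
  -- has been inspected; this conversion recurs throughout.
  constˢ-0 : ∀ {n} (α : Exponent n) → constˢ K.0# α K.≈ K.0#
  constˢ-0 []          = K.refl
  constˢ-0 (zero  ∷ α) = constˢ-0 α
  constˢ-0 (suc _ ∷ α) = K.refl

  private
    monomorphism-ring : ∀ {n} (R : CommutativeRing c ℓ)
      (⟦_⟧ : Series n → CommutativeRing.Carrier R) →
      let module R = CommutativeRing R in
      (∀ {f g} → f ≈ˢ g → ⟦ f ⟧ R.≈ ⟦ g ⟧) → (∀ {f g} → ⟦ f ⟧ R.≈ ⟦ g ⟧ → f ≈ˢ g) →
      (∀ f g → ⟦ f +ˢ g ⟧ R.≈ ⟦ f ⟧ R.+ ⟦ g ⟧) → (∀ f g → ⟦ f *ˢ g ⟧ R.≈ ⟦ f ⟧ R.* ⟦ g ⟧) →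
      (∀ f → ⟦ -ˢ f ⟧ R.≈ R.- ⟦ f ⟧) → ⟦ constˢ K.0# ⟧ R.≈ R.0# → ⟦ constˢ K.1# ⟧ R.≈ R.1# →
      IsCommutativeRing {A = Series n} _≈ˢ_ _+ˢ_ _*ˢ_ -ˢ_ (constˢ K.0#) (constˢ K.1#)
    monomorphism-ring {n} R ⟦_⟧ cong inj +-homo *-homo -‿homo 0#-homo 1#-homo =
      RingMonomorphism.isCommutativeRing {R₁ = rawRing n} {R₂ = CommutativeRing.rawRing R} record
        { isRingHomomorphism = record
          { isSemiringHomomorphism = record
            { isNearSemiringHomomorphism = record
              { +-isMonoidHomomorphism = record
                { isMagmaHomomorphism = record
                  { isRelHomomorphism = record { cong = cong } ; homo = +-homo }
                ; ε-homo = 0#-homo }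
              ; *-homo = *-homo }
            ; 1#-homo = 1#-homo }
          ; -‿homo = -‿homo }
        ; injective = inj }
        (CommutativeRing.isCommutativeRing R)

  -- Induction on the number of variables: slicing by the exponent of the first variable embeds the
  -- series in n + 1 variables into the univariate series over those in n variables, and the laws
  -- are pulled back.
  ˢ-isCommutativeRing : ∀ n → IsCommutativeRing {A = Series n} _≈ˢ_ _+ˢ_ _*ˢ_ -ˢ_ (constˢ K.0#) (constˢ K.1#)

  seriesRing : ℕ → CommutativeRing c ℓ
  seriesRing n = record { isCommutativeRing = ˢ-isCommutativeRing n }

  module _ {n : ℕ} where
    open SemiringSum (CommutativeRing.semiring (seriesRing n)) using (sum)

    sum-at : ∀ {m} (f : Fin m → Series n) α → sum f α K.≈ KS.sum λ i → f i α
    sum-at {zero}  f α = constˢ-0 α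
    sum-at {suc m} f α = K.+-congˡ (sum-at (f ∘ suc) α)

  slices : ∀ {n} → Series (suc n) → ℕ → Series n
  slices f a α = f (a ∷ α)

  slices-* : ∀ {n} (f g : Series (suc n)) a →
             slices (f *ˢ g) a ≈ˢ Univariate._⊛_ (seriesRing n) (slices f) (slices g) a
  slices-* f g a α = 
    K.sym (sum-at (Univariate.terms (seriesRing _) (slices f) (slices g) a) α)

  ˢ-isCommutativeRing zero = monomorphism-ring K (λ f → f [])
    (λ f≈g → f≈g []) (λ { e [] → e })
    (λ _ _ → K.refl) (λ _ _ → K.refl) (λ _ → K.refl) K.refl K.refl
  ˢ-isCommutativeRing (suc n) = monomorphism-ring
    (record { isCommutativeRing = Univariate.⊛-isCommutativeRing (seriesRing n) }) slices
    (λ f≈g a α → f≈g (a ∷ α)) (λ { e (a ∷ α) → e a α })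
    (λ _ _ _ _ → K.refl) slices-* (λ _ _ _ → K.refl)
    (λ { zero α → K.refl ; (suc a) α → K.sym (constˢ-0 α) })
    (λ { zero α → K.refl ; (suc a) α → K.sym (constˢ-0 α) })

-- Partial derivatives, Euler's identity and the order of vanishing

module SeriesCalculus {c ℓ} (K : CommutativeRing c ℓ) where
  open Polynomials K
  open SeriesRing K public
  module K where
    open CommutativeRing K public
    open RingProperties (CommutativeRing.ring K) public
    open SemiringSum semiring public
    open SemiringMult semiring public using (×-homo-+; ×-comm-*; ×-assoc-*; ×-congʳ; ×-congˡ; ×-assocˡ) renaming (_×_ to _×′_)
    open Multiples +-commutativeMonoid public using (×-distrib-+)
  module S {n : ℕ} where
    open CommutativeRing (seriesRing n) public
    open RingProperties (CommutativeRing.ring (seriesRing n)) public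
    open SemiringSum semiring public
    open SemiringMult semiring public using (×-homo-+; ×-comm-*; ×-assoc-*; ×-congʳ; ×-assocˡ) renaming (_×_ to _×′_)
    open Multiples +-commutativeMonoid public using (×-distrib-+)
    open CommutativeSemigroupProperties (CommutativeMonoid.commutativeSemigroup +-commutativeMonoid) public
      using (interchange)

  private variable n : ℕ

  ×-at : ∀ m (f : Series n) α → (m S.×′ f) α K.≈ m K.×′ f α
  ×-at zero    f α = constˢ-0 α
  ×-at (suc m) f α = K.+-congˡ (×-at m f α)

  module U {n : ℕ} = Univariate (seriesRing n)

  slices-cong : ∀ {f g : Series (suc n)} → (∀ a → slices f a ≈ˢ slices g a) → f ≈ˢ g
  slices-cong e (a ∷ α) = e a α

  -- The slices of h, regarded as a series in one more variable on which it does not depend.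
  concentrated : Series n → ℕ → Series n
  concentrated h zero    = h
  concentrated h (suc _) = S.0#

  concentrated-* : ∀ (h : Series n) g a → U._⊛_ (concentrated h) g a ≈ˢ h *ˢ g a
  concentrated-* h g zero    = S.+-identityʳ _
  concentrated-* h g (suc a) = S.trans
    (S.+-congˡ (U.zero-⊛ (concentrated h ∘ suc) g (λ _ → S.refl) a)) (S.+-identityʳ _)

  lift-* : ∀ (f : Series (suc n)) h → (∀ a → slices f a ≈ˢ concentrated h a) →
           ∀ g a α → (f *ˢ g) (a ∷ α) K.≈ (h *ˢ slices g a) α
  lift-* f h e g a α = K.trans (slices-* f g a α) (K.trans
    (U.⊛-congʳ (slices g) e a α) (concentrated-* h (slices g) a α))

  constˢ-slices : ∀ k a → slices {n} (constˢ k) a ≈ˢ concentrated (constˢ k) a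
  constˢ-slices k zero    α = K.refl
  constˢ-slices k (suc a) α = K.sym (constˢ-0 α)

  constˢ-* : ∀ k (f : Series n) α → (constˢ k *ˢ f) α K.≈ k K.* f α
  constˢ-* k f []      = K.refl
  constˢ-* k f (a ∷ α) = K.trans (lift-* (constˢ k) (constˢ k) (constˢ-slices k) f a α) (constˢ-* k (slices f a) α)

  constˢ-1 : ∀ k (α : Exponent n) → constˢ k α K.≈ k K.* constˢ K.1# α
  constˢ-1 k []          = K.sym (K.*-identityʳ k)
  constˢ-1 k (zero  ∷ α) = constˢ-1 k α
  constˢ-1 k (suc _ ∷ α) = K.sym (K.zeroʳ k)

  constˢ-cong : ∀ {k l} → k K.≈ l → constˢ {n} k ≈ˢ constˢ l
  constˢ-cong e []          = e
  constˢ-cong e (zero  ∷ α) = constˢ-cong e α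
  constˢ-cong e (suc _ ∷ α) = K.refl

  constˢ-homo-* : ∀ k l → constˢ {n} (k K.* l) ≈ˢ constˢ k *ˢ constˢ l
  constˢ-homo-* k l α = begin
    constˢ (k K.* l) α              ≈⟨ constˢ-1 (k K.* l) α ⟩
    k K.* l K.* constˢ K.1# α       ≈⟨ K.*-assoc _ _ _ ⟩
    k K.* (l K.* constˢ K.1# α)     ≈⟨ K.*-congˡ (constˢ-1 l α) ⟨
    k K.* constˢ l α                ≈⟨ constˢ-* k (constˢ l) α ⟨
    (constˢ k *ˢ constˢ l) α        ∎
    where open SetoidReasoning K.setoid

  constˢ-homo-+ : ∀ k l → constˢ {n} (k K.+ l) ≈ˢ constˢ k +ˢ constˢ l
  constˢ-homo-+ k l α = begin
    constˢ (k K.+ l) α                               ≈⟨ constˢ-1 (k K.+ l) α ⟩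
    (k K.+ l) K.* constˢ K.1# α                      ≈⟨ K.distribʳ _ _ _ ⟩
    k K.* constˢ K.1# α K.+ l K.* constˢ K.1# α      ≈⟨ K.+-cong (constˢ-1 k α) (constˢ-1 l α) ⟨
    constˢ k α K.+ constˢ l α                        ∎
    where open SetoidReasoning K.setoid

  -- Partial derivatives

  ∂ : Fin n → Series n → Series n
  ∂ zero    f (a ∷ α) = suc a K.×′ f (suc a ∷ α)
  ∂ (suc i) f (a ∷ α) = ∂ i (slices f a) α

  ∂-cong : ∀ i {f g : Series n} → f ≈ˢ g → ∂ i f ≈ˢ ∂ i g
  ∂-cong zero    e (a ∷ α) = K.×-congʳ (suc a) (e (suc a ∷ α))
  ∂-cong (suc i) e (a ∷ α) = ∂-cong i (λ β → e (a ∷ β)) α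

  ∂-+ : ∀ i (f g : Series n) → ∂ i (f +ˢ g) ≈ˢ ∂ i f +ˢ ∂ i g
  ∂-+ zero    f g (a ∷ α) = K.×-distrib-+ _ _ (suc a)
  ∂-+ (suc i) f g (a ∷ α) = ∂-+ i (slices f a) (slices g a) α

  ∂-0 : ∀ i → ∂ {n} i S.0# ≈ˢ S.0#
  ∂-0 i = S.+-cancelˡ _ _ _ (S.trans (S.sym (∂-+ i S.0# S.0#))
    (S.trans (∂-cong i (S.+-identityˡ _)) (S.sym (S.+-identityʳ _))))

  ∂-sum : ∀ i {m} (f : Fin m → Series n) → ∂ i (S.sum f) ≈ˢ S.sum (∂ i ∘ f)
  ∂-sum i {zero}  f = ∂-0 i
  ∂-sum i {suc m} f = S.trans (∂-+ i (f zero) (S.sum (f ∘ suc))) (S.+-congˡ (∂-sum i (f ∘ suc)))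

  ∂-× : ∀ i m (f : Series n) → ∂ i (m S.×′ f) ≈ˢ m S.×′ ∂ i f
  ∂-× i zero    f = ∂-0 i
  ∂-× i (suc m) f = S.trans (∂-+ i f (m S.×′ f)) (S.+-congˡ (∂-× i m f))

  ∂-zero-slices : ∀ (f : Series (suc n)) a → slices (∂ zero f) a ≈ˢ U.derivative (slices f) a
  ∂-zero-slices f a α = K.sym (×-at (suc a) (slices f (suc a)) α)

  ∂-* : ∀ i (f g : Series n) → ∂ i (f *ˢ g) ≈ˢ ∂ i f *ˢ g +ˢ f *ˢ ∂ i g
  ∂-* zero f g = slices-cong λ a → begin
    slices (∂ zero (f *ˢ g)) a                                    ≈⟨ ∂-zero-slices (f *ˢ g) a ⟩
    U.derivative (slices (f *ˢ g)) a                              ≈⟨ S.×-congʳ (suc a) (slices-* f g (suc a)) ⟩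
    U.derivative (slices f U.⊛ slices g) a                        ≈⟨ U.derivative-⊛ (slices f) (slices g) a ⟩
    (U.derivative (slices f) U.⊛ slices g) a +ˢ (slices f U.⊛ U.derivative (slices g)) a
      ≈⟨ S.+-cong (U.⊛-congʳ (slices g) (∂-zero-slices f) a) (U.⊛-congˡ (slices f) (∂-zero-slices g) a) ⟨
    (slices (∂ zero f) U.⊛ slices g) a +ˢ (slices f U.⊛ slices (∂ zero g)) a
      ≈⟨ S.+-cong (slices-* (∂ zero f) g a) (slices-* f (∂ zero g) a) ⟨
    slices (∂ zero f *ˢ g) a +ˢ slices (f *ˢ ∂ zero g) a          ∎
    where open SetoidReasoning S.setoid
  ∂-* (suc i) f g = slices-cong λ a → begin
    ∂ i (slices (f *ˢ g) a)                                       ≈⟨ ∂-cong i (slices-* f g a) ⟩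
    ∂ i (S.sum (U.terms (slices f) (slices g) a))                 ≈⟨ ∂-sum i (U.terms (slices f) (slices g) a) ⟩
    S.sum (∂ i ∘ U.terms (slices f) (slices g) a)                 ≈⟨ S.sum-cong-≋ {_} {suc a} (λ j → ∂-* i (slices f (toℕ j)) (slices g (a ∸ toℕ j))) ⟩
    S.sum (λ j → U.terms (slices (∂ (suc i) f)) (slices g) a j +ˢ U.terms (slices f) (slices (∂ (suc i) g)) a j)
      ≈⟨ S.∑-distrib-+ (U.terms (slices (∂ (suc i) f)) (slices g) a) (U.terms (slices f) (slices (∂ (suc i) g)) a) ⟩
    (slices (∂ (suc i) f) U.⊛ slices g) a +ˢ (slices f U.⊛ slices (∂ (suc i) g)) a
      ≈⟨ S.+-cong (slices-* (∂ (suc i) f) g a) (slices-* f (∂ (suc i) g) a) ⟨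
    slices (∂ (suc i) f *ˢ g) a +ˢ slices (f *ˢ ∂ (suc i) g) a    ∎
    where open SetoidReasoning S.setoid

  ∂-comm : ∀ i j (f : Series n) → ∂ i (∂ j f) ≈ˢ ∂ j (∂ i f)
  ∂-comm zero    zero    f α = K.refl
  ∂-comm zero    (suc j) f (a ∷ α) = K.sym (K.trans
    (∂-cong j (λ β → K.sym (×-at (suc a) (slices f (suc a)) β)) α)
    (K.trans (∂-× j (suc a) (slices f (suc a)) α) (×-at (suc a) (∂ j (slices f (suc a))) α)))
  ∂-comm (suc i) zero    f (a ∷ α) = K.sym (∂-comm zero (suc i) f (a ∷ α))
  ∂-comm (suc i) (suc j) f (a ∷ α) = ∂-comm i j (slices f a) α

  ×-0 : ∀ m → m K.×′ K.0# K.≈ K.0#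
  ×-0 zero    = K.refl
  ×-0 (suc m) = K.trans (K.+-identityˡ _) (×-0 m)

  ∂-const : ∀ i k → ∂ {n} i (constˢ k) ≈ˢ S.0#
  ∂-const zero    k (a ∷ α) = K.trans (×-0 (suc a)) (K.sym (constˢ-0 (a ∷ α)))
  ∂-const (suc i) k (zero  ∷ α) = ∂-const i k α
  ∂-const (suc i) k (suc a ∷ α) = 
    K.trans (∂-cong i (λ β → K.sym (constˢ-0 β)) α) (K.trans (∂-0 i α) (constˢ-0 α))

  ∂-zeroˢ : ∀ i {f : Series n} → (∀ α → f α K.≈ K.0#) → ∀ α → ∂ i f α K.≈ K.0#
  ∂-zeroˢ i z α = K.trans (∂-cong i (λ β → K.trans (z β) (K.sym (constˢ-0 β))) α)
    (K.trans (∂-0 i α) (constˢ-0 α))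

  ∂-var : ∀ i j → ∂ {n} i (varˢ j) ≈ˢ (if does (i Fin.≟ j) then S.1# else S.0#)
  ∂-var zero    zero    (zero  ∷ α) = K.+-identityʳ _
  ∂-var zero    zero    (suc a ∷ α) = ×-0 (suc (suc a))
  ∂-var zero    (suc j) (a ∷ α) = K.trans (×-0 (suc a)) (K.sym (constˢ-0 (a ∷ α)))
  ∂-var (suc i) zero    (zero        ∷ α) = K.trans (∂-zeroˢ i (λ _ → K.refl) α) (K.sym (constˢ-0 α))
  ∂-var (suc i) zero    (suc zero    ∷ α) = K.trans (∂-const i K.1# α) (constˢ-0 α)
  ∂-var (suc i) zero    (suc (suc _) ∷ α) = ∂-zeroˢ i (λ _ → K.refl) α
  ∂-var (suc i) (suc j) (zero  ∷ α) with does (i Fin.≟ j) | ∂-var i j α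
  ... | true  | e = e
  ... | false | e = e
  ∂-var (suc i) (suc j) (suc a ∷ α) with does (i Fin.≟ j)
  ... | true  = ∂-zeroˢ i (λ _ → K.refl) α
  ... | false = ∂-zeroˢ i (λ _ → K.refl) α

  coeff-D : ∀ i (p : Poly n) → coeff (D i p) ≈ˢ ∂ i (coeff p)
  coeff-D i (con k)  = S.sym (∂-const i k)
  coeff-D i (var j)  = S.trans (indicator (does (i Fin.≟ j))) (S.sym (∂-var i j))
    where
    indicator : ∀ b → coeff (if b then con K.1# else con K.0#) ≈ˢ (if b then S.1# else S.0#)
    indicator true  = S.refl
    indicator false = S.refl
  coeff-D i (p +ᵖ q) = S.trans (S.+-cong (coeff-D i p) (coeff-D i q)) (S.sym (∂-+ i (coeff p) (coeff q)))
  coeff-D i (p *ᵖ q) = S.trans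
    (S.+-cong (S.*-congʳ {x = coeff q} (coeff-D i p)) (S.*-congˡ {x = coeff p} (coeff-D i q)))
    (S.sym (∂-* i (coeff p) (coeff q)))

  varˢ-zero-*-zero : ∀ (f : Series (suc n)) α → (varˢ zero *ˢ f) (zero ∷ α) K.≈ K.0#
  varˢ-zero-*-zero f α = K.trans (K.+-identityʳ _) (K.trans
    (S.*-congʳ {_} {slices f 0} {λ _ → K.0#} {S.0#} (λ β → K.sym (constˢ-0 β)) α)
    (K.trans (S.zeroˡ (slices f 0) α) (constˢ-0 α)))

  varˢ-zero-*-suc : ∀ (f : Series (suc n)) a α → (varˢ zero *ˢ f) (suc a ∷ α) K.≈ f (a ∷ α)
  varˢ-zero-*-suc f a α = begin
    (varˢ zero *ˢ f) (suc a ∷ α)                                 ≈⟨ slices-* (varˢ zero) f (suc a) α ⟩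
    (slices (varˢ zero) U.⊛ slices f) (suc a) α
      ≈⟨ K.+-cong (S.trans (S.*-congʳ {x = slices f (suc a)} (λ β → K.sym (constˢ-0 β))) (S.zeroˡ (slices f (suc a))) α)
                  (U.⊛-congʳ (slices f) shifted a α) ⟩
    constˢ K.0# α K.+ (concentrated S.1# U.⊛ slices f) a α       ≈⟨ K.+-cong (constˢ-0 α) (concentrated-* S.1# (slices f) a α) ⟩
    K.0# K.+ (S.1# *ˢ slices f a) α                              ≈⟨ K.+-identityˡ _ ⟩
    (S.1# *ˢ slices f a) α                                       ≈⟨ S.*-identityˡ (slices f a) α ⟩
    f (a ∷ α)                                                    ∎
    where
    open SetoidReasoning K.setoid
    shifted : ∀ a → slices (varˢ zero) (suc a) ≈ˢ concentrated S.1# a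
    shifted zero    β = K.refl
    shifted (suc a) β = K.sym (constˢ-0 β)

  varˢ-suc-* : ∀ i (f : Series (suc n)) a α → (varˢ (suc i) *ˢ f) (a ∷ α) K.≈ (varˢ i *ˢ slices f a) α
  varˢ-suc-* i = lift-* (varˢ (suc i)) (varˢ i) λ { zero β → K.refl ; (suc a) β → K.sym (constˢ-0 β) }

  -- The first variable contributes its own exponent; the remaining ones act on the slices, where
  -- the identity holds by induction.
  euler-identity : ∀ (f : Series n) α → S.sum (λ i → varˢ i *ˢ ∂ i f) α K.≈ degree α K.×′ f α
  euler-identity f []      = K.refl
  euler-identity f (a ∷ α) = begin
    (varˢ zero *ˢ ∂ zero f) (a ∷ α) K.+ S.sum (λ i → varˢ (suc i) *ˢ ∂ (suc i) f) (a ∷ α)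
      ≈⟨ K.+-cong (first a) (sum-at (λ i → varˢ (suc i) *ˢ ∂ (suc i) f) (a ∷ α)) ⟩
    a K.×′ f (a ∷ α) K.+ K.sum (λ i → (varˢ (suc i) *ˢ ∂ (suc i) f) (a ∷ α))
      ≈⟨ K.+-congˡ (K.sum-cong-≋ λ i → varˢ-suc-* i (∂ (suc i) f) a α) ⟩
    a K.×′ f (a ∷ α) K.+ K.sum (λ i → (varˢ i *ˢ ∂ i (slices f a)) α)
      ≈⟨ K.+-congˡ (sum-at (λ i → varˢ i *ˢ ∂ i (slices f a)) α) ⟨
    a K.×′ f (a ∷ α) K.+ S.sum (λ i → varˢ i *ˢ ∂ i (slices f a)) α
      ≈⟨ K.+-congˡ (euler-identity (slices f a) α) ⟩
    a K.×′ f (a ∷ α) K.+ degree α K.×′ f (a ∷ α)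
      ≈⟨ K.×-homo-+ (f (a ∷ α)) a (degree α) ⟨
    degree (a ∷ α) K.×′ f (a ∷ α) ∎
    where
    open SetoidReasoning K.setoid
    first : ∀ a → (varˢ zero *ˢ ∂ zero f) (a ∷ α) K.≈ a K.×′ f (a ∷ α)
    first zero    = varˢ-zero-*-zero (∂ zero f) α
    first (suc a) = varˢ-zero-*-suc (∂ zero f) a α

  -- Order of vanishing

  Order≥ : ℕ → Series n → Set ℓ
  Order≥ d f = ∀ α → degree α < d → f α K.≈ K.0#

  *-vanishes : ∀ (f g : Series n) α →
    (∀ β γ → degree β ℕ.+ degree γ ≡ degree α → f β K.* g γ K.≈ K.0#) → (f *ˢ g) α K.≈ K.0#
  *-vanishes f g []      h = h [] [] ≡.refl
  *-vanishes f g (a ∷ α) h = K.trans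
    (K.sum-cong-≋ {suc a} λ i → *-vanishes (slices f (toℕ i)) (slices g (a ∸ toℕ i)) α λ β γ e →
      h (toℕ i ∷ β) ((a ∸ toℕ i) ∷ γ) (total (toℕ i) (ℕ.≤-pred (Fin.toℕ<n i)) β γ e))
    (K.sum-replicate-zero (suc a))
    where
    total : ∀ i → i ≤ a → ∀ β γ → degree β ℕ.+ degree γ ≡ degree α →
            i ℕ.+ degree β ℕ.+ ((a ∸ i) ℕ.+ degree γ) ≡ a ℕ.+ degree α
    total i i≤a β γ e = begin
      i ℕ.+ degree β ℕ.+ ((a ∸ i) ℕ.+ degree γ)     ≡⟨ +-interchange i (degree β) (a ∸ i) (degree γ) ⟩
      i ℕ.+ (a ∸ i) ℕ.+ (degree β ℕ.+ degree γ)     ≡⟨ ≡.cong₂ ℕ._+_ (ℕ.m+[n∸m]≡n i≤a) e ⟩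
      a ℕ.+ degree α                                ∎
      where
      open ≡.≡-Reasoning
      open CommutativeSemigroupProperties ℕ.+-commutativeSemigroup renaming (interchange to +-interchange)

  Order≥-* : ∀ {d e} {f g : Series n} → Order≥ d f → Order≥ e g → Order≥ (d ℕ.+ e) (f *ˢ g)
  Order≥-* {d = d} {e} {f} {g} of og α lt = *-vanishes f g α λ β γ eq → product β γ eq
    where
    product : ∀ β γ → degree β ℕ.+ degree γ ≡ degree α → f β K.* g γ K.≈ K.0#
    product β γ eq with degree β ℕ.<? d
    ... | yes β<d = K.trans (K.*-congʳ (of β β<d)) (K.zeroˡ _)
    ... | no  β≮d with degree γ ℕ.<? e
    ...   | yes γ<e = K.trans (K.*-congˡ (og γ γ<e)) (K.zeroʳ _)
    ...   | no  γ≮e = contradiction lt (ℕ.≤⇒≯ (≡.subst (d ℕ.+ e ≤_) eq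
                        (ℕ.+-mono-≤ (ℕ.≮⇒≥ β≮d) (ℕ.≮⇒≥ γ≮e))))

  Order≥-cong : ∀ {d} {f g : Series n} → f ≈ˢ g → Order≥ d f → Order≥ d g
  Order≥-cong e o α lt = K.trans (K.sym (e α)) (o α lt)

  Order≥-≤ : ∀ {d e} {f : Series n} → d ≤ e → Order≥ e f → Order≥ d f
  Order≥-≤ d≤e o α lt = o α (ℕ.≤-trans lt d≤e)

  Order≥-+ : ∀ {d} {f g : Series n} → Order≥ d f → Order≥ d g → Order≥ d (f +ˢ g)
  Order≥-+ o o′ α lt = K.trans (K.+-cong (o α lt) (o′ α lt)) (K.+-identityˡ _)

  Order≥-sum : ∀ {d m} (f : Fin m → Series n) → (∀ i → Order≥ d (f i)) → Order≥ d (S.sum f)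
  Order≥-sum {m = zero}  f o α lt = constˢ-0 α
  Order≥-sum {m = suc m} f o = Order≥-+ (o zero) (Order≥-sum (f ∘ suc) (o ∘ suc))

  Order≥-0 : ∀ (f : Series n) → Order≥ 0 f
  Order≥-0 f α ()

  Order≥-var : ∀ (i : Fin n) → Order≥ 1 (varˢ i)
  Order≥-var zero    (zero  ∷ α) lt = K.refl
  Order≥-var (suc i) (zero  ∷ α) lt = Order≥-var i α lt
  Order≥-var zero    (suc a ∷ α) (s≤s ())
  Order≥-var (suc i) (suc a ∷ α) (s≤s ())

-- Monomial expansions, substitution and homogeneous components

module Evaluation {c ℓ} (K : CommutativeRing c ℓ) where
  open Polynomials K
  open SeriesCalculus K
  open SemiringOps (Semiring.rawSemiring K.semiring) using (sumOver)
  open CommutativeSemigroupProperties (CommutativeMonoid.commutativeSemigroup K.+-commutativeMonoid)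
    using () renaming (interchange to +-interchange)
  private
    variable m n : ℕ
    module E {n : ℕ} = Exp (CommutativeRing.semiring (seriesRing n))
    module C {n : ℕ} = CommutativeSemigroupProperties (CommutativeRing.*-commutativeSemigroup (seriesRing n))

  -- Sums over lists of exponents

  sumOver-cong : ∀ {A : Set} (xs : List A) {f g} → (∀ x → f x K.≈ g x) → sumOver xs f K.≈ sumOver xs g
  sumOver-cong []       e = K.refl
  sumOver-cong (x ∷ xs) e = K.+-cong (e x) (sumOver-cong xs e)

  sumOver-+ : ∀ {A : Set} (xs : List A) f g →
              sumOver xs (λ x → f x K.+ g x) K.≈ sumOver xs f K.+ sumOver xs g
  sumOver-+ []       f g = K.sym (K.+-identityˡ _)
  sumOver-+ (x ∷ xs) f g = K.trans (K.+-congˡ (sumOver-+ xs f g)) (+-interchange _ _ _ _)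

  sumOver-0 : ∀ {A : Set} (xs : List A) {f} → (∀ x → f x K.≈ K.0#) → sumOver xs f K.≈ K.0#
  sumOver-0 []       e = K.refl
  sumOver-0 (x ∷ xs) e = K.trans (K.+-cong (e x) (sumOver-0 xs e)) (K.+-identityˡ _)

  sumOver-++ : ∀ {A : Set} (xs ys : List A) f → sumOver (xs ++ ys) f K.≈ sumOver xs f K.+ sumOver ys f
  sumOver-++ []       ys f = K.sym (K.+-identityˡ _)
  sumOver-++ (x ∷ xs) ys f = K.trans (K.+-congˡ (sumOver-++ xs ys f)) (K.sym (K.+-assoc _ _ _))

  sumOver-map : ∀ {A B : Set} (g : A → B) (xs : List A) f → sumOver (List.map g xs) f K.≈ sumOver xs (f ∘ g)
  sumOver-map g []       f = K.refl
  sumOver-map g (x ∷ xs) f = K.+-congˡ (sumOver-map g xs f)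

  sumOver-concatMap : ∀ {A B : Set} (g : A → List B) (xs : List A) f →
                      sumOver (List.concatMap g xs) f K.≈ sumOver xs (λ x → sumOver (g x) f)
  sumOver-concatMap g []       f = K.refl
  sumOver-concatMap g (x ∷ xs) f =
    K.trans (sumOver-++ (g x) (List.concatMap g xs) f) (K.+-congˡ (sumOver-concatMap g xs f))

  applyUpTo-0 : ∀ (g : ℕ → ℕ) k f → (∀ a → a < k → f (g a) K.≈ K.0#) → sumOver (List.applyUpTo g k) f K.≈ K.0#
  applyUpTo-0 g zero    f z = K.refl
  applyUpTo-0 g (suc k) f z = K.trans
    (K.+-cong (z 0 ℕ.z<s) (applyUpTo-0 (g ∘ suc) k f λ a a<k → z (suc a) (s≤s a<k))) (K.+-identityˡ _)

  applyUpTo-pick : ∀ (g : ℕ → ℕ) k b f → b < k → (∀ a → a ≢ b → a < k → f (g a) K.≈ K.0#) →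
                   sumOver (List.applyUpTo g k) f K.≈ f (g b)
  applyUpTo-pick g (suc k) zero    f b<k z = K.trans
    (K.+-congˡ (applyUpTo-0 (g ∘ suc) k f λ a a<k → z (suc a) (λ ()) (s≤s a<k))) (K.+-identityʳ _)
  applyUpTo-pick g (suc k) (suc b) f (s≤s b<k) z = K.trans
    (K.+-cong (z 0 (λ ()) ℕ.z<s)
      (applyUpTo-pick (g ∘ suc) k b f b<k λ a a≢b a<k → z (suc a) (a≢b ∘ ℕ.suc-injective) (s≤s a<k)))
    (K.+-identityˡ _)

  private
    by-first : ∀ n d f → sumOver (exponentsOfDegree (suc n) d) f K.≈
               sumOver (List.upTo (suc d)) (λ a → sumOver (exponentsOfDegree n (d ∸ a)) (f ∘ (a ∷_)))
    by-first n d f = K.trans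
      (sumOver-concatMap (λ a → List.map (a ∷_) (exponentsOfDegree n (d ∸ a))) (List.upTo (suc d)) f)
      (sumOver-cong (List.upTo (suc d)) λ a → sumOver-map (a ∷_) (exponentsOfDegree n (d ∸ a)) f)

  ofDegree-0 : ∀ n d f → (∀ α → degree α ≡ d → f α K.≈ K.0#) → sumOver (exponentsOfDegree n d) f K.≈ K.0#
  ofDegree-0 zero    zero    f z = K.trans (K.+-identityʳ _) (z [] ≡.refl)
  ofDegree-0 zero    (suc d) f z = K.refl
  ofDegree-0 (suc n) d       f z = K.trans (by-first n d f) (applyUpTo-0 id (suc d) _ λ a a<1+d →
    ofDegree-0 n (d ∸ a) (f ∘ (a ∷_)) λ α e →
      z (a ∷ α) (≡.trans (≡.cong (a ℕ.+_) e) (ℕ.m+[n∸m]≡n (ℕ.≤-pred a<1+d))))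

  -- Each exponent is listed exactly once in its degree; stating this through sums avoids reasoning
  -- about list membership.
  ofDegree-pick : ∀ n β f → (∀ α → α ≢ β → f α K.≈ K.0#) → sumOver (exponentsOfDegree n (degree β)) f K.≈ f β
  ofDegree-pick zero    []      f z = K.+-identityʳ _
  ofDegree-pick (suc n) (b ∷ β) f z = K.trans (by-first n (b ℕ.+ degree β) f) (K.trans
    (applyUpTo-pick id (suc (b ℕ.+ degree β)) b _ (s≤s (ℕ.m≤m+n b (degree β))) λ a a≢b _ →
      sumOver-0 (exponentsOfDegree n _) λ α → z (a ∷ α) λ { ≡.refl → a≢b ≡.refl })
    (≡.subst (λ d → sumOver (exponentsOfDegree n d) (f ∘ (b ∷_)) K.≈ f (b ∷ β)) (≡.sym (ℕ.m+n∸m≡n b (degree β)))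
      (ofDegree-pick n β (f ∘ (b ∷_)) λ α α≢β → z (b ∷ α) λ { ≡.refl → α≢β ≡.refl })))

  upToDegree-0 : ∀ n d f → (∀ α → degree α ≤ d → f α K.≈ K.0#) → sumOver (exponentsUpToDegree n d) f K.≈ K.0#
  upToDegree-0 n d f z = K.trans (sumOver-concatMap (exponentsOfDegree n) (List.upTo (suc d)) f)
    (applyUpTo-0 id (suc d) _ λ e e<1+d →
      ofDegree-0 n e f λ α eq → z α (≡.subst (_≤ d) (≡.sym eq) (ℕ.≤-pred e<1+d)))

  upToDegree-pick : ∀ n d β f → degree β ≤ d → (∀ α → α ≢ β → f α K.≈ K.0#) →
                    sumOver (exponentsUpToDegree n d) f K.≈ f β
  upToDegree-pick n d β f β≤d z = K.trans (sumOver-concatMap (exponentsOfDegree n) (List.upTo (suc d)) f)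
    (K.trans (applyUpTo-pick id (suc d) (degree β) _ (s≤s β≤d) λ e e≢ _ →
      ofDegree-0 n e f λ α eq → z α λ { ≡.refl → e≢ (≡.sym eq) })
    (ofDegree-pick n β f z))

  -- Monomials

  mono : (Fin m → Series n) → Exponent m → Series n
  mono = SemiringOps.monomial (seriesRawSemiring _)

  private
    powers : ∀ (f : Series n) a → Series n
    powers f a = RawSemiringDefs._^_ (seriesRawSemiring _) f a

  mono-+ : ∀ (x : Fin m → Series n) β γ → mono x (Vec.zipWith ℕ._+_ β γ) ≈ˢ mono x β *ˢ mono x γ
  mono-+ x []      []      = S.sym (S.*-identityˡ S.1#)
  mono-+ x (b ∷ β) (c ∷ γ) = S.trans
    (S.*-cong {_} {powers (x zero) (b ℕ.+ c)} (E.^-homo-* (x zero) b c) (mono-+ (x ∘ suc) β γ))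
    (C.interchange (powers (x zero) b) (powers (x zero) c) (mono (x ∘ suc) β) (mono (x ∘ suc) γ))

  mono-0 : ∀ (x : Fin m → Series n) → mono x (Vec.replicate m 0) ≈ˢ S.1#
  mono-0 {zero}  x = S.refl
  mono-0 {suc m} x = S.trans (S.*-congˡ {x = S.1#} (mono-0 (x ∘ suc))) (S.*-identityˡ S.1#)

  unit : Fin m → Exponent m
  unit zero    = 1 ∷ Vec.replicate _ 0
  unit (suc i) = 0 ∷ unit i

  mono-unit : ∀ (x : Fin m → Series n) i → mono x (unit i) ≈ˢ x i
  mono-unit x zero    = S.trans
    (S.*-cong {_} {powers (x zero) 1} (S.*-identityʳ (x zero)) (mono-0 (x ∘ suc))) (S.*-identityʳ (x zero))
  mono-unit x (suc i) = S.trans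
    (S.*-congˡ {x = S.1#} (mono-unit (x ∘ suc) i)) (S.*-identityˡ (x (suc i)))

  Order≥-mono : ∀ (x : Fin m → Series n) → (∀ i → Order≥ 1 (x i)) → ∀ β → Order≥ (degree β) (mono x β)
  Order≥-mono x o []      = Order≥-0 S.1#
  Order≥-mono x o (b ∷ β) = Order≥-* {f = powers (x zero) b} {mono (x ∘ suc) β} (power b) (Order≥-mono (x ∘ suc) (o ∘ suc) β)
    where
    power : ∀ b → Order≥ b (powers (x zero) b)
    power zero    = Order≥-0 S.1#
    power (suc b) = Order≥-* {f = x zero} {powers (x zero) b} (o zero) (power b)

  private
    shifted-mono : ∀ (x : Fin m → Series (suc n)) (x′ : Fin m → Series n) →
      (∀ i a → slices (x i) a ≈ˢ concentrated (x′ i) a) →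
      ∀ β a → slices (mono x β) a ≈ˢ concentrated (mono x′ β) a

    shifted-* : ∀ (f g : Series (suc n)) f′ g′ →
      (∀ a → slices f a ≈ˢ concentrated f′ a) → (∀ a → slices g a ≈ˢ concentrated g′ a) →
      ∀ a → slices (f *ˢ g) a ≈ˢ concentrated (f′ *ˢ g′) a
    shifted-* f g f′ g′ ef eg zero    α =
      K.trans (lift-* f f′ ef g zero α) (S.*-congˡ {x = f′} (eg zero) α)
    shifted-* f g f′ g′ ef eg (suc a) α =
      K.trans (lift-* f f′ ef g (suc a) α) (K.trans (S.*-congˡ {x = f′} (eg (suc a)) α) (S.zeroʳ f′ α))

    shifted-mono x x′ e []      a = constˢ-slices K.1# a
    shifted-mono x x′ e (b ∷ β) =
      shifted-* (powers (x zero) b) (mono (x ∘ suc) β) (powers (x′ zero) b) (mono (x′ ∘ suc) β)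
        (power b) (shifted-mono (x ∘ suc) (x′ ∘ suc) (e ∘ suc) β)
      where
      power : ∀ b a → slices (powers (x zero) b) a ≈ˢ concentrated (powers (x′ zero) b) a
      power zero    = constˢ-slices K.1#
      power (suc b) = shifted-* (x zero) (powers (x zero) b) (x′ zero) (powers (x′ zero) b) (e zero) (power b)

    X₀ : Series (suc n)
    X₀ = varˢ zero

    X₀^-*-same : ∀ b (h : Series (suc n)) {h′} → (∀ a → slices h a ≈ˢ concentrated h′ a) →
                 ∀ α → (powers X₀ b *ˢ h) (b ∷ α) K.≈ h′ α
    X₀^-*-same zero    h e α = K.trans (S.*-identityˡ h (0 ∷ α)) (e 0 α)
    X₀^-*-same (suc b) h e α = K.trans (S.*-assoc X₀ (powers X₀ b) h (suc b ∷ α))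
      (K.trans (varˢ-zero-*-suc (powers X₀ b *ˢ h) b α) (X₀^-*-same b h e α))

    X₀^-*-other : ∀ b (h : Series (suc n)) {h′} → (∀ a → slices h a ≈ˢ concentrated h′ a) →
                  ∀ a α → a ≢ b → (powers X₀ b *ˢ h) (a ∷ α) K.≈ K.0#
    X₀^-*-other zero    h e zero    α a≢b = contradiction ≡.refl a≢b
    X₀^-*-other zero    h e (suc a) α a≢b =
      K.trans (S.*-identityˡ h (suc a ∷ α)) (K.trans (e (suc a) α) (constˢ-0 α))
    X₀^-*-other (suc b) h e zero    α a≢b = K.trans (S.*-assoc X₀ (powers X₀ b) h (0 ∷ α))
      (varˢ-zero-*-zero (powers X₀ b *ˢ h) α)
    X₀^-*-other (suc b) h e (suc a) α a≢b = K.trans (S.*-assoc X₀ (powers X₀ b) h (suc a ∷ α))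
      (K.trans (varˢ-zero-*-suc (powers X₀ b *ˢ h) a α) (X₀^-*-other b h e a α (a≢b ∘ ≡.cong suc)))

    varˢ-shifted : ∀ (β : Exponent n) a → slices (mono (varˢ ∘ suc) β) a ≈ˢ concentrated (mono varˢ β) a
    varˢ-shifted = shifted-mono (varˢ ∘ suc) varˢ λ { i zero α → K.refl ; i (suc a) α → K.sym (constˢ-0 α) }

  mono-varˢ-same : ∀ (β : Exponent n) → mono varˢ β β K.≈ K.1#
  mono-varˢ-same []      = K.refl
  mono-varˢ-same (b ∷ β) =
    K.trans (X₀^-*-same b (mono (varˢ ∘ suc) β) (varˢ-shifted β) β) (mono-varˢ-same β)

  mono-varˢ-other : ∀ (β α : Exponent n) → α ≢ β → mono varˢ β α K.≈ K.0#
  mono-varˢ-other []      []      α≢β = contradiction ≡.refl α≢β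
  mono-varˢ-other (b ∷ β) (a ∷ α) α≢β with a ℕ.≟ b
  ... | yes ≡.refl = K.trans (X₀^-*-same b (mono (varˢ ∘ suc) β) (varˢ-shifted β) α)
                       (mono-varˢ-other β α (α≢β ∘ ≡.cong (b ∷_)))
  ... | no  a≢b    = X₀^-*-other b (mono (varˢ ∘ suc) β) (varˢ-shifted β) a α a≢b

  -- Evaluation of polynomials

  evaluate : Poly m → (Fin m → Series n) → Series n
  evaluate (con k)  x = constˢ k
  evaluate (var i)  x = x i
  evaluate (p +ᵖ q) x = evaluate p x +ˢ evaluate q x
  evaluate (p *ᵖ q) x = evaluate p x *ˢ evaluate q x

  coeff-evaluate : ∀ (p : Poly n) → coeff p ≈ˢ evaluate p varˢ
  coeff-evaluate (con k)  = S.refl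
  coeff-evaluate (var i)  = S.refl
  coeff-evaluate (p +ᵖ q) = S.+-cong (coeff-evaluate p) (coeff-evaluate q)
  coeff-evaluate (p *ᵖ q) = S.*-cong {_} {coeff p} (coeff-evaluate p) (coeff-evaluate q)

  coeff-substᵖ : ∀ (p : Poly m) (F : Fin m → Poly n) → coeff (substᵖ p F) ≈ˢ evaluate p (coeff ∘ F)
  coeff-substᵖ (con k)  F = S.refl
  coeff-substᵖ (var i)  F = S.refl
  coeff-substᵖ (p +ᵖ q) F = S.+-cong (coeff-substᵖ p F) (coeff-substᵖ q F)
  coeff-substᵖ (p *ᵖ q) F = S.*-cong {_} {coeff (substᵖ p F)} (coeff-substᵖ p F) (coeff-substᵖ q F)

  Terms : ℕ → Set c
  Terms m = List (K.Carrier × Exponent m)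

  evalTerms : (Fin m → Series n) → Terms m → Series n
  evalTerms x []            = S.0#
  evalTerms x ((k , β) ∷ L) = constˢ k *ˢ mono x β +ˢ evalTerms x L

  times : K.Carrier → Exponent m → Terms m → Terms m
  times k β []            = []
  times k β ((l , γ) ∷ L) = (k K.* l , Vec.zipWith ℕ._+_ β γ) ∷ times k β L

  product : Terms m → Terms m → Terms m
  product []            M = []
  product ((k , β) ∷ L) M = times k β M ++ product L M

  terms : Poly m → Terms m
  terms (con k)  = (k , Vec.replicate _ 0) ∷ []
  terms (var i)  = (K.1# , unit i) ∷ []
  terms (p +ᵖ q) = terms p ++ terms q
  terms (p *ᵖ q) = product (terms p) (terms q)

  module _ (x : Fin m → Series n) where
    evalTerms-++ : ∀ L M → evalTerms x (L ++ M) ≈ˢ evalTerms x L +ˢ evalTerms x M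
    evalTerms-++ []            M = S.sym (S.+-identityˡ (evalTerms x M))
    evalTerms-++ ((k , β) ∷ L) M = S.trans (S.+-congˡ (evalTerms-++ L M))
      (S.sym (S.+-assoc (constˢ k *ˢ mono x β) (evalTerms x L) (evalTerms x M)))

    evalTerms-times : ∀ k β L → evalTerms x (times k β L) ≈ˢ constˢ k *ˢ mono x β *ˢ evalTerms x L
    evalTerms-times k β []            = S.sym (S.zeroʳ (constˢ k *ˢ mono x β))
    evalTerms-times k β ((l , γ) ∷ L) = S.trans
      (S.+-cong
        (S.trans (S.*-cong {_} {constˢ (k K.* l)} (constˢ-homo-* k l) (mono-+ x β γ))
                 (C.interchange (constˢ k) (constˢ l) (mono x β) (mono x γ)))
        (evalTerms-times k β L))
      (S.sym (S.distribˡ (constˢ k *ˢ mono x β) (constˢ l *ˢ mono x γ) (evalTerms x L)))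

    evalTerms-product : ∀ L M → evalTerms x (product L M) ≈ˢ evalTerms x L *ˢ evalTerms x M
    evalTerms-product []            M = S.sym (S.zeroˡ (evalTerms x M))
    evalTerms-product ((k , β) ∷ L) M = S.trans (evalTerms-++ (times k β M) (product L M)) (S.trans
      (S.+-cong (evalTerms-times k β M) (evalTerms-product L M))
      (S.sym (S.distribʳ (evalTerms x M) (constˢ k *ˢ mono x β) (evalTerms x L))))

    evaluate-terms : ∀ p → evaluate p x ≈ˢ evalTerms x (terms p)
    evaluate-terms (con k)  = S.sym (S.trans (S.+-identityʳ (constˢ k *ˢ mono x (Vec.replicate _ 0)))
      (S.trans (S.*-congˡ {x = constˢ k} (mono-0 x)) (S.*-identityʳ (constˢ k))))
    evaluate-terms (var i)  = S.sym (S.trans (S.+-identityʳ (S.1# *ˢ mono x (unit i)))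
      (S.trans (S.*-identityˡ (mono x (unit i))) (mono-unit x i)))
    evaluate-terms (p +ᵖ q) = S.trans (S.+-cong (evaluate-terms p) (evaluate-terms q))
      (S.sym (evalTerms-++ (terms p) (terms q)))
    evaluate-terms (p *ᵖ q) = S.trans
      (S.*-cong {_} {evaluate p x} (evaluate-terms p) (evaluate-terms q))
      (S.sym (evalTerms-product (terms p) (terms q)))

    -- Only the exponents occurring in L with a nonzero monomial at α need to be of degree ≤ d.
    collect : ∀ d α L → All (λ (_ , β) → degree β ≤ d ⊎ (d < degree β × mono x β α K.≈ K.0#)) L →
              evalTerms x L α K.≈ sumOver (exponentsUpToDegree m d) λ β → evalTerms varˢ L β K.* mono x β α
    collect d α [] [] = K.trans (constˢ-0 α) (K.sym (sumOver-0 (exponentsUpToDegree m d) λ β →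
      K.trans (K.*-congʳ (constˢ-0 β)) (K.zeroˡ _)))
    collect d α ((k , β) ∷ L) (b ∷ bs) = K.sym (begin
      sumOver U (λ γ → ((constˢ k *ˢ mono varˢ β) γ K.+ evalTerms varˢ L γ) K.* mono x γ α)
        ≈⟨ sumOver-cong U (λ γ → K.distribʳ _ _ _) ⟩
      sumOver U (λ γ → (constˢ k *ˢ mono varˢ β) γ K.* mono x γ α K.+ evalTerms varˢ L γ K.* mono x γ α)
        ≈⟨ sumOver-+ U _ _ ⟩
      sumOver U (λ γ → (constˢ k *ˢ mono varˢ β) γ K.* mono x γ α) K.+ sumOver U (λ γ → evalTerms varˢ L γ K.* mono x γ α)
        ≈⟨ K.+-cong (head b) (K.sym (collect d α L bs)) ⟩
      (constˢ k *ˢ mono x β) α K.+ evalTerms x L α ∎)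
      where
      open SetoidReasoning K.setoid
      U = exponentsUpToDegree m d
      off : ∀ γ → γ ≢ β → (constˢ k *ˢ mono varˢ β) γ K.* mono x γ α K.≈ K.0#
      off γ γ≢β = K.trans (K.*-congʳ (K.trans (constˢ-* k (mono varˢ β) γ)
        (K.trans (K.*-congˡ (mono-varˢ-other β γ γ≢β)) (K.zeroʳ k)))) (K.zeroˡ _)
      head : degree β ≤ d ⊎ (d < degree β × mono x β α K.≈ K.0#) →
             sumOver U (λ γ → (constˢ k *ˢ mono varˢ β) γ K.* mono x γ α) K.≈ (constˢ k *ˢ mono x β) α
      head (inj₁ β≤d) = begin
        sumOver U (λ γ → (constˢ k *ˢ mono varˢ β) γ K.* mono x γ α)
          ≈⟨ upToDegree-pick m d β _ β≤d off ⟩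
        (constˢ k *ˢ mono varˢ β) β K.* mono x β α
          ≈⟨ K.*-congʳ (K.trans (constˢ-* k (mono varˢ β) β)
               (K.trans (K.*-congˡ (mono-varˢ-same β)) (K.*-identityʳ k))) ⟩
        k K.* mono x β α
          ≈⟨ constˢ-* k (mono x β) α ⟨
        (constˢ k *ˢ mono x β) α ∎
      head (inj₂ (d<β , z)) = K.trans
        (upToDegree-0 m d _ λ γ γ≤d → off γ λ { ≡.refl → ℕ.<⇒≱ d<β γ≤d })
        (K.sym (K.trans (constˢ-* k (mono x β) α) (K.trans (K.*-congˡ z) (K.zeroʳ k))))

  -- Any common bound on the degrees will do, and a sum bounds each of its summands.
  totalDegree : Terms m → ℕ
  totalDegree []            = 0
  totalDegree ((_ , β) ∷ L) = degree β ℕ.+ totalDegree L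

  bounded : ∀ {d} (L : Terms m) → totalDegree L ≤ d → All (λ (_ , β) → degree β ≤ d) L
  bounded []            L≤d = []
  bounded ((_ , β) ∷ L) L≤d =
    ℕ.≤-trans (ℕ.m≤m+n (degree β) (totalDegree L)) L≤d ∷
    bounded L (ℕ.≤-trans (ℕ.m≤n+m (totalDegree L) (degree β)) L≤d)

  private
    coefficients : ∀ (p : Poly n) → evalTerms varˢ (terms p) ≈ˢ coeff p
    coefficients p = S.sym (S.trans (coeff-evaluate p) (evaluate-terms varˢ p))

  evaluate-coeff : ∀ (p : Poly m) (x : Fin m → Series n) d α → totalDegree (terms p) ≤ d →
    evaluate p x α K.≈ sumOver (exponentsUpToDegree m d) λ β → coeff p β K.* mono x β α
  evaluate-coeff {m} p x d α p≤d = K.trans (evaluate-terms x p α) (K.trans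
    (collect x d α (terms p) (All.map inj₁ (bounded (terms p) p≤d)))
    (sumOver-cong (exponentsUpToDegree m d) λ β → K.*-congʳ (coefficients p β)))

  -- Polynomials are expressions, so equality of coefficients passes to values only through the
  -- expansion into monomials, taken up to a degree that bounds both expressions.
  evaluate-cong : ∀ (p q : Poly m) (x : Fin m → Series n) → p ≈ᵖ q → evaluate p x ≈ˢ evaluate q x
  evaluate-cong {m} p q x p≈q α = K.trans (evaluate-coeff p x d α (ℕ.m≤m+n _ _))
    (K.trans (sumOver-cong (exponentsUpToDegree m d) λ β → K.*-congʳ (p≈q β))
      (K.sym (evaluate-coeff q x d α (ℕ.m≤n+m _ _))))
    where
    d = totalDegree (terms p) ℕ.+ totalDegree (terms q)

  -- `substˢ` cuts the sum off at the degree of α. The monomials beyond it have order greater than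
  -- that degree and do not reach α.
  substˢ-evaluate : ∀ (p : Poly m) (G : Fin m → Series n) → (∀ i → Order≥ 1 (G i)) →
                    substˢ (coeff p) G ≈ˢ evaluate p G
  substˢ-evaluate {m} p G o α = K.sym (K.trans (evaluate-terms G p α) (K.trans
    (collect G (degree α) α (terms p) (All.universal (λ (_ , β) → compare β) (terms p)))
    (sumOver-cong (exponentsUpToDegree m (degree α)) λ β → K.*-congʳ (coefficients p β))))
    where
    compare : ∀ β → degree β ≤ degree α ⊎ (degree α < degree β × mono G β α K.≈ K.0#)
    compare β with degree β ℕ.≤? degree α
    ... | yes β≤α = inj₁ β≤α
    ... | no  β≰α = inj₂ (ℕ.≰⇒> β≰α , Order≥-mono G o β α (ℕ.≰⇒> β≰α))

  -- Homogeneous components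

  private
    coeff-monomial : ∀ (x : Fin m → Poly n) β →
      coeff (SemiringOps.monomial (polyRawSemiring n) x β) ≈ˢ mono (coeff ∘ x) β
    coeff-monomial x []      = S.refl
    coeff-monomial {n = n} x (b ∷ β) =
      S.*-cong {_} {coeff (RawSemiringDefs._^_ (polyRawSemiring n) (x zero) b)} (power b) (coeff-monomial (x ∘ suc) β)
      where
      power : ∀ b → coeff (RawSemiringDefs._^_ (polyRawSemiring n) (x zero) b) ≈ˢ powers (coeff (x zero)) b
      power zero    = S.refl
      power (suc b) = S.*-congˡ {x = coeff (x zero)} (power b)

    coeff-sumOver : ∀ {A : Set} (xs : List A) (f : A → Poly n) α →
      coeff (SemiringOps.sumOver (polyRawSemiring n) xs f) α K.≈ sumOver xs (λ x → coeff (f x) α)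
    coeff-sumOver []       f α = constˢ-0 α
    coeff-sumOver (x ∷ xs) f α = K.+-congˡ (coeff-sumOver xs f α)

    component-term : ∀ (g : Series n) α β →
      coeff (con (g β) *ᵖ SemiringOps.monomial (polyRawSemiring n) var β) α K.≈ g β K.* mono varˢ β α
    component-term {n} g α β = K.trans
      (S.*-congˡ {x = constˢ (g β)} (coeff-monomial var β) α) (constˢ-* (g β) (mono varˢ β) α)

    coeff-component : ∀ d (g : Series n) α → coeff (homogeneousComponent d g) α K.≈
      sumOver (exponentsOfDegree n d) (λ β → g β K.* mono varˢ β α)
    coeff-component {n} d g α = K.trans (coeff-sumOver (exponentsOfDegree n d) _ α)
      (sumOver-cong (exponentsOfDegree n d) (component-term g α))

    component-off : ∀ (g : Series n) α β → β ≢ α → g β K.* mono varˢ β α K.≈ K.0#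
    component-off g α β β≢α = K.trans (K.*-congˡ (mono-varˢ-other β α (β≢α ∘ ≡.sym))) (K.zeroʳ _)

  homogeneousComponent-same : ∀ (g : Series n) α → coeff (homogeneousComponent (degree α) g) α K.≈ g α
  homogeneousComponent-same {n} g α = K.trans (coeff-component (degree α) g α) (K.trans
    (ofDegree-pick n α _ (component-off g α))
    (K.trans (K.*-congˡ (mono-varˢ-same α)) (K.*-identityʳ _)))

  homogeneousComponent-other : ∀ d (g : Series n) α → degree α ≢ d →
                               coeff (homogeneousComponent d g) α K.≈ K.0#
  homogeneousComponent-other {n} d g α α≢d = K.trans (coeff-component d g α)
    (ofDegree-0 n d _ λ β e → component-off g α β λ { ≡.refl → α≢d e })

open Trees using (Form; Derivation)
open QuarticForms using (module Identities)

-- Contractions, and the form defined by a constant symmetric tensor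

module Contraction {c ℓ} (R : CommutativeRing c ℓ) where
  open CommutativeRing R
  open SemiringSum semiring
  open CommutativeSemigroupProperties *-commutativeSemigroup using (x∙yz≈y∙xz)
  open SetoidReasoning setoid

  -- This one operation serves as the pairing, as contraction with a tensor index and as the
  -- derivative along a field.
  contract : ∀ {n} → (Fin n → Carrier) → (Fin n → Carrier) → Carrier
  contract u f = sum λ i → u i * f i

  private variable n m : ℕ

  contract-cong : ∀ {u u′ f f′ : Fin n → Carrier} → (∀ i → u i ≈ u′ i) → (∀ i → f i ≈ f′ i) →
                  contract u f ≈ contract u′ f′
  contract-cong eu ef = sum-cong-≋ λ i → *-cong (eu i) (ef i)

  contract-congˡ : ∀ (u : Fin n → Carrier) {f f′} → (∀ i → f i ≈ f′ i) → contract u f ≈ contract u f′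
  contract-congˡ u = contract-cong {u = u} (λ _ → refl)

  contract-+ˡ : ∀ (u v f : Fin n → Carrier) → contract (λ i → u i + v i) f ≈ contract u f + contract v f
  contract-+ˡ u v f = trans (sum-cong-≋ λ i → distribʳ (f i) (u i) (v i))
    (∑-distrib-+ (λ i → u i * f i) (λ i → v i * f i))

  contract-+ʳ : ∀ (u f g : Fin n → Carrier) → contract u (λ i → f i + g i) ≈ contract u f + contract u g
  contract-+ʳ u f g = trans (sum-cong-≋ λ i → distribˡ (u i) (f i) (g i))
    (∑-distrib-+ (λ i → u i * f i) (λ i → u i * g i))

  contract-comm : ∀ (u v : Fin n → Carrier) → contract u v ≈ contract v u
  contract-comm u v = sum-cong-≋ λ i → *-comm (u i) (v i)

  contract-* : ∀ (u f : Fin n → Carrier) x → x * contract u f ≈ contract u (λ i → x * f i)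
  contract-* u f x = trans (*-distribˡ-sum x (λ i → u i * f i)) (sum-cong-≋ λ i → x∙yz≈y∙xz x (u i) (f i))

  contract-sum : ∀ (u : Fin n → Carrier) (f : Fin n → Fin m → Carrier) →
                 contract u (λ i → sum (f i)) ≈ sum (λ j → contract u λ i → f i j)
  contract-sum u f = trans (sum-cong-≋ λ i → *-distribˡ-sum (u i) (f i)) (∑-comm λ i j → u i * f i j)

  contract-swap : ∀ (u : Fin n → Carrier) (v : Fin m → Carrier) (f : Fin n → Fin m → Carrier) →
    contract u (λ i → contract v (f i)) ≈ contract v (λ j → contract u λ i → f i j)
  contract-swap u v f = trans (contract-sum u λ i j → v j * f i j)
    (sum-cong-≋ λ j → sym (contract-* u (λ i → f i j) (v j)))

  indicator : Fin n → Fin n → Carrier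
  indicator i j = if does (i Fin.≟ j) then 1# else 0#

  contract-0 : ∀ (f : Fin n → Carrier) → contract (λ _ → 0#) f ≈ 0#
  contract-0 {n} f = trans (sum-cong-≋ λ i → zeroˡ (f i)) (sum-replicate-zero n)

  contract-indicator : ∀ (i : Fin n) f → contract (indicator i) f ≈ f i
  contract-indicator zero    f = trans (+-cong (*-identityˡ _) (contract-0 (f ∘ suc))) (+-identityʳ _)
  contract-indicator (suc i) f = trans (+-cong (zeroˡ _) (contract-indicator i (f ∘ suc))) (+-identityˡ _)

  indicator-sym : ∀ (i j : Fin n) → indicator i j ≡ indicator j i
  indicator-sym zero    zero    = ≡.refl
  indicator-sym zero    (suc j) = ≡.refl
  indicator-sym (suc i) zero    = ≡.refl
  indicator-sym (suc i) (suc j) = indicator-sym i j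

module TensorForm {c ℓ} (K : CommutativeRing c ℓ) (n : ℕ)
  (b : Fin n → Fin n → Fin n → Fin n → CommutativeRing.Carrier K)
  (b-swap₁₂ : ∀ i j k l → CommutativeRing._≈_ K (b i j k l) (b j i k l))
  (b-swap₂₃ : ∀ i j k l → CommutativeRing._≈_ K (b i j k l) (b i k j l))
  (b-swap₃₄ : ∀ i j k l → CommutativeRing._≈_ K (b i j k l) (b i j l k)) where
  open Polynomials K
  open SeriesCalculus K
  open Contraction (seriesRing n)
  open SetoidReasoning (S.setoid {n})

  V S⁺ : AbelianGroup c ℓ
  S⁺ = S.+-abelianGroup {n}
  V  = Pointwise.abelianGroup (Fin n) S⁺

  Vecˢ : Set c
  Vecˢ = Fin n → Series n

  β : Fin n → Fin n → Fin n → Fin n → Series n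
  β i j k l = constˢ (b i j k l)

  B : Vecˢ → Vecˢ → Vecˢ → Vecˢ
  B u v w l = contract u λ i → contract v λ j → contract w λ k → β i j k l

  -- A cyclic rotation exchanges the output index with an argument, which is what self-adjointness
  -- of B amounts to.
  b-rotate : ∀ i j k l → b i j k l K.≈ b j k l i
  b-rotate i j k l = K.trans (b-swap₁₂ i j k l) (K.trans (b-swap₂₃ j i k l) (b-swap₃₄ j k i l))

  form : Form V S⁺
  form = record
    { B = B
    ; ⟨_,_⟩ = contract
    ; B-additive = λ v w → record
      { cong   = λ e l → contract-cong e λ _ → S.refl
      ; ∙-homo = λ u u′ l → contract-+ˡ u u′ _ }
    ; ⟨⟩-additive = λ v → record
      { cong   = λ e → contract-cong {f = v} e λ _ → S.refl
      ; ∙-homo = λ u u′ → contract-+ˡ u u′ v }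
    ; B-swap₁₂ = λ u v w l → S.trans (contract-swap u v λ i j → contract w λ k → β i j k l)
        (contract-congˡ v λ j → contract-congˡ u λ i → contract-congˡ w λ k → constˢ-cong (b-swap₁₂ i j k l))
    ; B-swap₂₃ = λ u v w l → contract-congˡ u λ i → S.trans (contract-swap v w λ j k → β i j k l)
        (contract-congˡ w λ k → contract-congˡ v λ j → constˢ-cong (b-swap₂₃ i j k l))
    ; ⟨⟩-comm = contract-comm
    ; adjoint = λ u v w x → begin
        contract (B u v w) x
          ≈⟨ contract-comm (B u v w) x ⟩
        contract x (λ l → contract u λ i → contract v λ j → contract w λ k → β i j k l)
          ≈⟨ contract-swap x u (λ l i → contract v λ j → contract w λ k → β i j k l) ⟩
        contract u (λ i → contract x λ l → contract v λ j → contract w λ k → β i j k l)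
          ≈⟨ contract-congˡ u (λ i → contract-swap x v λ l j → contract w λ k → β i j k l) ⟩
        contract u (λ i → contract v λ j → contract x λ l → contract w λ k → β i j k l)
          ≈⟨ contract-congˡ u (λ i → contract-congˡ v λ j → contract-swap x w λ l k → β i j k l) ⟩
        contract u (λ i → contract v λ j → contract w λ k → contract x λ l → β i j k l)
          ≈⟨ contract-congˡ u (λ i → contract-congˡ v λ j → contract-congˡ w λ k → contract-congˡ x λ l →
               constˢ-cong (b-rotate i j k l)) ⟩
        contract u (B v w x) ∎
    }

  module F = Form form

  nondegenerate : ∀ {u : Vecˢ} → (∀ z → contract z u ≈ˢ S.0#) → ∀ i → u i ≈ˢ S.0#
  nondegenerate {u} h i = S.trans (S.sym (contract-indicator i u)) (h (indicator i))

  record IsDerivation (d : Series n → Series n) : Set (c ⊔ ℓ) where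
    field
      cong    : ∀ {f g} → f ≈ˢ g → d f ≈ˢ d g
      +-homo  : ∀ f g → d (f +ˢ g) ≈ˢ d f +ˢ d g
      leibniz : ∀ f g → d (f *ˢ g) ≈ˢ d f *ˢ g +ˢ f *ˢ d g
      const   : ∀ k → d (constˢ k) ≈ˢ S.0#

    sum-homo : ∀ {m} (f : Fin m → Series n) → d (S.sum f) ≈ˢ S.sum (d ∘ f)
    sum-homo {zero}  f = const K.0#
    sum-homo {suc m} f = S.trans (+-homo (f zero) (S.sum (f ∘ suc))) (S.+-congˡ (sum-homo (f ∘ suc)))

    leibniz-contract : ∀ {m} (u f : Fin m → Series n) →
                       d (contract u f) ≈ˢ contract (d ∘ u) f +ˢ contract u (d ∘ f)
    leibniz-contract u f = S.trans (sum-homo λ i → u i *ˢ f i) (S.trans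
      (S.sum-cong-≋ λ i → leibniz (u i) (f i))
      (S.∑-distrib-+ (λ i → d (u i) *ˢ f i) (λ i → u i *ˢ d (f i))))

    leibniz-contract-const : ∀ {m} (u f : Fin m → Series n) → (∀ i → d (f i) ≈ˢ S.0#) →
                             d (contract u f) ≈ˢ contract (d ∘ u) f
    leibniz-contract-const u f z = S.trans (leibniz-contract u f) (S.trans
      (S.+-congˡ (S.trans (contract-congˡ u z) (S.trans (contract-comm u (λ _ → S.0#)) (contract-0 u))))
      (S.+-identityʳ _))

  derivation : ∀ {d} → IsDerivation d → Derivation form
  derivation {d} isD = record
    { dᵥ = d ∘_
    ; dₛ = d
    ; dᵥ-additive = record { cong = λ e i → cong (e i) ; ∙-homo = λ u v i → +-homo (u i) (v i) }
    ; dₛ-additive = record { cong = cong ; ∙-homo = +-homo }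
    ; leibniz-B = λ u v w l → begin
        d (B u v w l)
          ≈⟨ leibniz-contract u (λ i → contract v λ j → contract w λ k → β i j k l) ⟩
        B (d ∘ u) v w l +ˢ contract u (λ i → d (contract v λ j → contract w λ k → β i j k l))
          ≈⟨ S.+-congˡ (contract-congˡ u λ i → leibniz-contract v λ j → contract w λ k → β i j k l) ⟩
        B (d ∘ u) v w l +ˢ contract u (λ i → contract (d ∘ v) (λ j → contract w λ k → β i j k l) +ˢ
                                            contract v (λ j → d (contract w λ k → β i j k l)))
          ≈⟨ S.+-congˡ (contract-+ʳ u _ _) ⟩
        B (d ∘ u) v w l +ˢ (B u (d ∘ v) w l +ˢ contract u (λ i → contract v λ j → d (contract w λ k → β i j k l)))
          ≈⟨ S.+-congˡ (S.+-congˡ (contract-congˡ u λ i → contract-congˡ v λ j →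
               leibniz-contract-const w (λ k → β i j k l) λ k → const (b i j k l))) ⟩
        B (d ∘ u) v w l +ˢ (B u (d ∘ v) w l +ˢ B u v (d ∘ w) l) ∎
    ; leibniz-⟨⟩ = leibniz-contract
    }
    where open IsDerivation isD

  ∂-isDerivation : ∀ i → IsDerivation (∂ i)
  ∂-isDerivation i = record
    { cong = ∂-cong i ; +-homo = ∂-+ i ; leibniz = ∂-* i ; const = ∂-const i }

  along : Vecˢ → Series n → Series n
  along u f = contract u λ i → ∂ i f

  along-isDerivation : ∀ u → IsDerivation (along u)
  along-isDerivation u = record
    { cong    = λ e → contract-congˡ u λ i → ∂-cong i e
    ; +-homo  = λ f g → S.trans (contract-congˡ u λ i → ∂-+ i f g) (contract-+ʳ u _ _)
    ; leibniz = λ f g → begin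
        contract u (λ i → ∂ i (f *ˢ g))
          ≈⟨ contract-congˡ u (λ i → ∂-* i f g) ⟩
        contract u (λ i → ∂ i f *ˢ g +ˢ f *ˢ ∂ i g)
          ≈⟨ contract-+ʳ u (λ i → ∂ i f *ˢ g) (λ i → f *ˢ ∂ i g) ⟩
        contract u (λ i → ∂ i f *ˢ g) +ˢ contract u (λ i → f *ˢ ∂ i g)
          ≈⟨ S.+-cong (contract-congˡ u λ i → S.*-comm (∂ i f) g) S.refl ⟩
        contract u (λ i → g *ˢ ∂ i f) +ˢ contract u (λ i → f *ˢ ∂ i g)
          ≈⟨ S.+-cong (contract-* u (λ i → ∂ i f) g) (contract-* u (λ i → ∂ i g) f) ⟨
        g *ˢ along u f +ˢ f *ˢ along u g
          ≈⟨ S.+-congʳ (S.*-comm g (along u f)) ⟩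
        along u f *ˢ g +ˢ f *ˢ along u g ∎
    ; const   = λ k → S.trans (contract-congˡ u λ i → ∂-const i k)
        (S.trans (contract-comm u (λ _ → S.0#)) (contract-0 u))
    }

  along-var : ∀ u l → along u (varˢ l) ≈ˢ u l
  along-var u l = begin
    contract u (λ i → ∂ i (varˢ l))   ≈⟨ contract-congˡ u (λ i → ∂-var i l) ⟩
    contract u (λ i → indicator i l)  ≈⟨ contract-congˡ u (λ i → S.reflexive (indicator-sym i l)) ⟩
    contract u (indicator l)          ≈⟨ contract-comm u (indicator l) ⟩
    contract (indicator l) u          ≈⟨ contract-indicator l u ⟩
    u l                               ∎

  -- The formal solution of y = X + B y y y

  module VG = AbelianGroup V
  module G = AbelianGroupProperties V
  open AbelianGroup V using () renaming (_≈_ to _≈ᵛ_; _∙_ to _+ᵛ_; _⁻¹ to -ᵛ_)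

  Orderᵛ : ℕ → Vecˢ → Set ℓ
  Orderᵛ d u = ∀ i → Order≥ d (u i)

  Order≥-contract : ∀ {d e} (u f : Vecˢ) → Orderᵛ d u → Orderᵛ e f → Order≥ (d ℕ.+ e) (contract u f)
  Order≥-contract u f o o′ = Order≥-sum _ λ i → Order≥-* {f = u i} {f i} (o i) (o′ i)

  Order-B : ∀ {d e g} u v w → Orderᵛ d u → Orderᵛ e v → Orderᵛ g w → Orderᵛ (d ℕ.+ (e ℕ.+ (g ℕ.+ 0))) (B u v w)
  Order-B u v w o o′ o″ l = Order≥-contract u _ o λ i → Order≥-contract v _ o′ λ j →
    Order≥-contract w _ o″ λ k → Order≥-0 (β i j k l)

  _-ᵛ_ : Vecˢ → Vecˢ → Vecˢ
  u -ᵛ v = u +ᵛ -ᵛ v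

  Order-+ᵛ : ∀ {d} {u v : Vecˢ} → Orderᵛ d u → Orderᵛ d v → Orderᵛ d (u +ᵛ v)
  Order-+ᵛ o o′ i = Order≥-+ (o i) (o′ i)

  Order-congᵛ : ∀ {d} {u v : Vecˢ} → u ≈ᵛ v → Orderᵛ d u → Orderᵛ d v
  Order-congᵛ e o i = Order≥-cong (e i) (o i)

  Φ : Vecˢ → Vecˢ
  Φ u = B u u u

  telescope : ∀ a b c → (a -ᵛ b) +ᵛ (b -ᵛ c) ≈ᵛ a -ᵛ c
  telescope a b c = VG.trans (VG.assoc a (-ᵛ b) (b -ᵛ c)) (VG.∙-congˡ {x = a}
    (VG.trans (VG.sym (VG.assoc (-ᵛ b) b (-ᵛ c)))
      (VG.trans (VG.∙-congʳ (VG.inverseˡ b)) (VG.identityˡ (-ᵛ c)))))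

  private
    additive-difference : ∀ {φ} → Additive V V φ → ∀ u v → φ (u -ᵛ v) ≈ᵛ φ u -ᵛ φ v
    additive-difference add u v =
      VG.trans (Additive.∙-homo add u (-ᵛ v)) (VG.∙-congˡ (Additive.⁻¹-homo add v))

  -- The difference telescopes into three terms, each with a - b in one slot. The two other
  -- arguments have order at least 1 and raise the order by two; one is enough for Φ to be
  -- contracting.
  Φ-difference : ∀ {d} a b → Orderᵛ 1 a → Orderᵛ 1 b → Orderᵛ d (a -ᵛ b) → Orderᵛ (suc d) (Φ a -ᵛ Φ b)
  Φ-difference {d} a b oa ob o = Order-congᵛ expand (Order-+ᵛ
    (λ i → Order≥-≤ (ℕ.≤-trans (ℕ.n≤1+n (suc d)) (ℕ.≤-reflexive (ℕ.+-comm 2 d))) (Order-B (a -ᵛ b) a a o oa oa i))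
    (Order-+ᵛ
      (λ i → Order≥-≤ (s≤s (ℕ.m≤m+n d 1)) (Order-B b (a -ᵛ b) a ob o oa i))
      (λ i → Order≥-≤ (s≤s (ℕ.≤-trans (ℕ.m≤m+n d 0) (ℕ.n≤1+n _))) (Order-B b b (a -ᵛ b) ob ob o i))))
    where
    expand : B (a -ᵛ b) a a +ᵛ (B b (a -ᵛ b) a +ᵛ B b b (a -ᵛ b)) ≈ᵛ Φ a -ᵛ Φ b
    expand = VG.trans
      (VG.∙-cong (additive-difference (F.B-additive a a) a b)
        (VG.trans (VG.∙-cong (additive-difference (F.B-additive₂ b a) a b) (additive-difference (F.B-additive₃ b b) a b))
                  (telescope (B b a a) (B b b a) (Φ b))))
      (telescope (Φ a) (B b a a) (Φ b))

  all-orders : ∀ {u : Vecˢ} → (∀ d → Orderᵛ d u) → ∀ i α → u i α K.≈ K.0#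
  all-orders o i α = o (suc (degree α)) i α ℕ.≤-refl

  vanishing-difference : ∀ {a b : Vecˢ} → (∀ d → Orderᵛ d (a -ᵛ b)) → a ≈ᵛ b
  vanishing-difference {a} {b} o = G.x∙y⁻¹≈ε⇒x≈y a b
    λ i α → K.trans (all-orders o i α) (K.sym (constˢ-0 α))

  -- The difference of a and b has the order of Φ a - Φ b, which is larger.
  injective : ∀ a b → Orderᵛ 1 a → Orderᵛ 1 b → a -ᵛ Φ a ≈ᵛ b -ᵛ Φ b → a ≈ᵛ b
  injective a b oa ob e = vanishing-difference order
    where
    a≈ : a ≈ᵛ (b -ᵛ Φ b) +ᵛ Φ a
    a≈ = VG.trans (VG.sym (G.//-rightDividesˡ (Φ a) a)) (VG.∙-congʳ {Φ a} e)
    difference : a -ᵛ b ≈ᵛ Φ a -ᵛ Φ b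
    difference = VG.trans (VG.∙-congʳ { -ᵛ b} (VG.trans a≈ (VG.assoc b (-ᵛ Φ b) (Φ a))))
      (VG.trans (G.xyx⁻¹≈y b (-ᵛ Φ b +ᵛ Φ a)) (VG.comm (-ᵛ Φ b) (Φ a)))
    order : ∀ d → Orderᵛ d (a -ᵛ b)
    order zero    i = Order≥-0 _
    order (suc d) = Order-congᵛ (VG.sym difference) (Φ-difference a b oa ob (order d))

  iterate : ℕ → Vecˢ
  iterate zero    = varˢ
  iterate (suc k) = varˢ +ᵛ Φ (iterate k)

  iterate-order : ∀ k → Orderᵛ 1 (iterate k)
  iterate-order zero    = Order≥-var
  iterate-order (suc k) = Order-+ᵛ Order≥-var
    λ i → Order≥-≤ (s≤s z≤n) (Order-B (iterate k) (iterate k) (iterate k) (iterate-order k) (iterate-order k) (iterate-order k) i)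

  cancel-X : ∀ u v → (varˢ +ᵛ u) -ᵛ (varˢ +ᵛ v) ≈ᵛ u -ᵛ v
  cancel-X u v = VG.trans (VG.∙-congˡ (VG.sym (G.⁻¹-∙-comm varˢ v)))
    (VG.trans (λ i → S.interchange (varˢ i) (u i) (-ˢ varˢ i) (-ˢ v i))
      (VG.trans (VG.∙-congʳ (VG.inverseʳ varˢ)) (VG.identityˡ (u -ᵛ v))))

  iterate-step : ∀ k → Orderᵛ k (iterate (suc k) -ᵛ iterate k)
  iterate-step zero    i = Order≥-0 _
  iterate-step (suc k) = Order-congᵛ (VG.sym (cancel-X (Φ (iterate (suc k))) (Φ (iterate k))))
    (Φ-difference (iterate (suc k)) (iterate k) (iterate-order (suc k)) (iterate-order k) (iterate-step k))

  -- The coefficient at α is stable from the iterate with number degree α + 1 on, so the limit is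
  -- read off along a diagonal.
  solution : Vecˢ
  solution i α = iterate (suc (degree α)) i α

  iterate-stable : ∀ k i α → degree α < k → iterate k i α K.≈ solution i α
  iterate-stable (suc k) i α (s≤s α≤k) with ℕ.m≤n⇒m<n∨m≡n α≤k
  ... | inj₂ ≡.refl = K.refl
  ... | inj₁ α<k    = K.trans (K.x∙y⁻¹≈ε⇒x≈y _ _ (iterate-step k i α α<k)) (iterate-stable k i α α<k)

  solution-near : ∀ k → Orderᵛ k (iterate k -ᵛ solution)
  solution-near k i α α<k = K.x≈y⇒x∙y⁻¹≈ε (iterate-stable k i α α<k)

  solution-order : Orderᵛ 1 solution
  solution-order i α α<1 = K.trans (K.sym (iterate-stable 1 i α α<1)) (iterate-order 1 i α α<1)

  -- Iterate k + 1 agrees with both sides up to order k + 1, for every k.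
  solution-≈ : solution ≈ᵛ varˢ +ᵛ Φ solution
  solution-≈ = VG.sym (vanishing-difference λ { zero i → Order≥-0 _ ; (suc k) → Order-congᵛ
      (telescope (varˢ +ᵛ Φ solution) (iterate (suc k)) solution)
      (Order-+ᵛ
        (Order-congᵛ (VG.sym (cancel-X (Φ solution) (Φ (iterate k))))
          (Φ-difference solution (iterate k) solution-order (iterate-order k) (flip-order (solution-near k))))
        (solution-near (suc k))) })
    where
    flip-order : ∀ {d a b} → Orderᵛ d (a -ᵛ b) → Orderᵛ d (b -ᵛ a)
    flip-order {a = a} {b} o i α α<d =
      K.x≈y⇒x∙y⁻¹≈ε (K.sym (K.x∙y⁻¹≈ε⇒x≈y (a i α) (b i α) (o i α α<d)))

-- Division by positive integers in an algebra over the rationals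

natℚ : ℕ → ℚ
natℚ zero    = 0ℚ
natℚ (suc n) = 1ℚ ℚ.+ natℚ n

natℚ-nonNegative : ∀ n → ℚ.NonNegative (natℚ n)

natℚ-positive : ∀ n → ℚ.Positive (natℚ (suc n))
natℚ-positive n = ℚ.pos+nonNeg⇒pos 1ℚ (natℚ n) {{natℚ-nonNegative n}}

natℚ-nonNegative zero    = _
natℚ-nonNegative (suc n) = ℚ.pos⇒nonNeg (natℚ (suc n)) {{natℚ-positive n}}

1/[1+_] : ℕ → ℚ
1/[1+ n ] = ℚ.1/_ (natℚ (suc n)) {{ℚ.pos⇒nonZero (natℚ (suc n)) {{natℚ-positive n}}}}

module Division {c ℓ} (A : CommutativeℚAlgebra c ℓ) where
  open CommutativeℚAlgebra A
  open SeriesCalculus ring using (module K; module S)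
  open RingMorphisms.IsRingHomomorphism fromℚ-isRingHomomorphism
  open SetoidReasoning K.setoid

  -- `natℚ` follows the recursion that defines multiples, so the homomorphism laws apply step by
  -- step.
  fromℚ-natℚ : ∀ n → fromℚ (natℚ n) K.≈ n K.×′ K.1#
  fromℚ-natℚ zero    = 0#-homo
  fromℚ-natℚ (suc n) = K.trans (+-homo 1ℚ (natℚ n)) (K.+-cong 1#-homo (fromℚ-natℚ n))

  _/1+_ : K.Carrier → ℕ → K.Carrier
  x /1+ n = fromℚ 1/[1+ n ] K.* x

  divide-× : ∀ n x → (suc n K.×′ x) /1+ n K.≈ x
  divide-× n x = begin
    fromℚ 1/[1+ n ] K.* (suc n K.×′ x)                ≈⟨ K.*-congˡ (K.×-congʳ (suc n) (K.*-identityˡ x)) ⟨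
    fromℚ 1/[1+ n ] K.* (suc n K.×′ (K.1# K.* x))     ≈⟨ K.*-congˡ (K.×-assoc-* (suc n) K.1# x) ⟨
    fromℚ 1/[1+ n ] K.* ((suc n K.×′ K.1#) K.* x)     ≈⟨ K.*-assoc _ _ _ ⟨
    fromℚ 1/[1+ n ] K.* (suc n K.×′ K.1#) K.* x       ≈⟨ K.*-congʳ (K.*-congˡ (fromℚ-natℚ (suc n))) ⟨
    fromℚ 1/[1+ n ] K.* fromℚ (natℚ (suc n)) K.* x    ≈⟨ K.*-congʳ (*-homo 1/[1+ n ] (natℚ (suc n))) ⟨
    fromℚ (1/[1+ n ] ℚ.* natℚ (suc n)) K.* x          ≡⟨ ≡.cong (λ r → fromℚ r K.* x) inverse ⟩
    fromℚ 1ℚ K.* x                                    ≈⟨ K.*-congʳ 1#-homo ⟩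
    K.1# K.* x                                        ≈⟨ K.*-identityˡ x ⟩
    x                                                 ∎
    where
    inverse : 1/[1+ n ] ℚ.* natℚ (suc n) ≡ 1ℚ
    inverse = ℚ.*-inverseˡ (natℚ (suc n)) {{ℚ.pos⇒nonZero (natℚ (suc n)) {{natℚ-positive n}}}}

  ×-divide : ∀ n x → suc n K.×′ (x /1+ n) K.≈ x
  ×-divide n x = K.trans (K.sym (K.×-comm-* (suc n) _ x)) (divide-× n x)

  ×-cancel : ∀ n {x y} → suc n K.×′ x K.≈ suc n K.×′ y → x K.≈ y
  ×-cancel n {x} {y} e = K.trans (K.sym (divide-× n x)) (K.trans (K.*-congˡ e) (divide-× n y))

  ×-cancel-0 : ∀ n {x} → suc n K.×′ x K.≈ K.0# → x K.≈ K.0#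
  ×-cancel-0 n {x} e = K.trans (K.sym (divide-× n x)) (K.trans (K.*-congˡ e) (K.zeroʳ _))

  private
    excess-0 : ∀ {m m′ x} → m < m′ → m K.×′ x K.≈ m′ K.×′ x → x K.≈ K.0#
    excess-0 {m} {m′} {x} m<m′ e with ℕ.m≤n⇒∃[o]m+o≡n m<m′
    ... | d , ≡.refl = ×-cancel-0 d (K.+-identityʳ-unique (m K.×′ x) (suc d K.×′ x) (begin
      m K.×′ x K.+ suc d K.×′ x   ≈⟨ K.×-homo-+ x m (suc d) ⟨
      (m ℕ.+ suc d) K.×′ x        ≡⟨ ≡.cong (K._×′ x) (ℕ.+-suc m d) ⟩
      (suc m ℕ.+ d) K.×′ x        ≈⟨ e ⟨
      m K.×′ x                    ∎))

  -- This separates degrees: a coefficient that is multiplied alike by its own degree and by a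
  -- different eigenvalue is zero.
  ×-injectiveˡ : ∀ m m′ {x} → m ≢ m′ → m K.×′ x K.≈ m′ K.×′ x → x K.≈ K.0#
  ×-injectiveˡ m m′ m≢m′ e with ℕ.<-cmp m m′
  ... | tri< m<m′ _ _ = excess-0 m<m′ e
  ... | tri≈ _ m≡m′ _ = contradiction m≡m′ m≢m′
  ... | tri> _ _ m′<m = excess-0 m′<m (K.sym e)

  ×ˢ-cancel : ∀ m {n} {f g : Polynomials.Series ring n} → suc m S.×′ f S.≈ suc m S.×′ g → f S.≈ g
  ×ˢ-cancel m {f = f} {g} e α = ×-cancel m
    (K.trans (K.sym (×-at′ (suc m) f α)) (K.trans (e α) (×-at′ (suc m) g α)))
    where open SeriesCalculus ring using () renaming (×-at to ×-at′)

-- Series supported in given degrees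

module Homogeneous {c ℓ} (K : CommutativeRing c ℓ) where
  open Polynomials K
  open SeriesCalculus K
  private variable n : ℕ

  ZeroIn : (ℕ → Set) → Series n → Set ℓ
  ZeroIn Z f = ∀ α → Z (degree α) → f α K.≈ K.0#

  -- The predicate is arbitrary because splitting off the first exponent a changes Z into its
  -- translate by a, and the induction needs that one.
  ZeroIn-∂ : ∀ i Z (f : Series n) → ZeroIn Z f → ZeroIn (Z ∘ suc) (∂ i f)
  ZeroIn-∂ zero    Z f z (a ∷ α) p = K.trans (K.×-congʳ (suc a) (z (suc a ∷ α) p)) (×-0 (suc a))
  ZeroIn-∂ (suc i) Z f z (a ∷ α) p = ZeroIn-∂ i (λ e → Z (a ℕ.+ e)) (slices f a)
    (λ β → z (a ∷ β)) α (≡.subst Z (≡.sym (ℕ.+-suc a (degree α))) p)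

  Homogeneous : ℕ → Series n → Set ℓ
  Homogeneous d = ZeroIn (_≢ d)

  Homogeneous-∂ : ∀ i {d} (f : Series n) → Homogeneous (suc d) f → Homogeneous d (∂ i f)
  Homogeneous-∂ i {d} f h α α≢d = ZeroIn-∂ i (_≢ suc d) f h α (α≢d ∘ ℕ.suc-injective)

  0⃗ : Exponent n
  0⃗ = Vec.replicate _ 0

  constˢ-degree : ∀ k (α : Exponent n) → degree α ≢ 0 → constˢ k α K.≈ K.0#
  constˢ-degree k []          α≢0 = contradiction ≡.refl α≢0
  constˢ-degree k (zero  ∷ α) α≢0 = constˢ-degree k α α≢0
  constˢ-degree k (suc a ∷ α) α≢0 = K.refl

  varˢ-degree : ∀ (i : Fin n) α → degree α ≢ 1 → varˢ i α K.≈ K.0#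
  varˢ-degree zero    (zero        ∷ α) α≢1 = K.refl
  varˢ-degree zero    (suc zero    ∷ α) α≢1 = constˢ-degree K.1# α (α≢1 ∘ ≡.cong suc)
  varˢ-degree zero    (suc (suc _) ∷ α) α≢1 = K.refl
  varˢ-degree (suc i) (zero        ∷ α) α≢1 = varˢ-degree i α α≢1
  varˢ-degree (suc i) (suc _       ∷ α) α≢1 = K.refl

  Homogeneous-0 : ∀ (f : Series n) → Homogeneous 0 f → f ≈ˢ constˢ (f 0⃗)
  Homogeneous-0 f h []          = K.refl
  Homogeneous-0 f h (zero  ∷ α) = Homogeneous-0 (slices f 0) (λ β → h (0 ∷ β)) α
  Homogeneous-0 f h (suc a ∷ α) = h (suc a ∷ α) λ ()

  open Contraction

  euler-homogeneous : ∀ d (f : Series n) → Homogeneous d f →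
                      contract (seriesRing n) varˢ (λ i → ∂ i f) ≈ˢ d S.×′ f
  euler-homogeneous d f h α = K.trans (euler-identity f α) (K.trans (multiple (degree α ℕ.≟ d)) (K.sym (×-at d f α)))
    where
    multiple : _ → degree α K.×′ f α K.≈ d K.×′ f α
    multiple (yes ≡.refl) = K.refl
    multiple (no  α≢d)    = K.trans (K.×-congʳ (degree α) (h α α≢d))
      (K.trans (×-0 (degree α)) (K.sym (K.trans (K.×-congʳ d (h α α≢d)) (×-0 d))))

-- The tensor of a cubic map with symmetric Jacobian

module SymmetricCubic {c ℓ} (A : CommutativeℚAlgebra c ℓ) (n : ℕ) where
  open CommutativeℚAlgebra A using () renaming (ring to K)
  open Polynomials K
  open PolyMatrices n
  open SeriesCalculus K
  open Evaluation K
  open Homogeneous K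
  open Division A
  open Contraction (seriesRing n) hiding (indicator-sym)
  open SetoidReasoning (S.setoid {n})

  private
    ×-contract : ∀ m (u f : Fin n → Series n) → contract u (λ i → m S.×′ f i) ≈ˢ m S.×′ contract u f
    ×-contract zero    u f = S.trans (contract-comm u (λ _ → S.0#)) (contract-0 u)
    ×-contract (suc m) u f = S.trans (contract-+ʳ u f (λ i → m S.×′ f i)) (S.+-congˡ (×-contract m u f))

    ×-constˢ : ∀ m k → constˢ {n} (m K.×′ k) ≈ˢ m S.×′ constˢ k
    ×-constˢ zero    k = S.refl
    ×-constˢ (suc m) k = S.trans (constˢ-homo-+ k (m K.×′ k)) (S.+-congˡ (×-constˢ m k))

    constˢ-‿1 : ∀ (f : Series n) → constˢ (K.- K.1#) *ˢ f ≈ˢ -ˢ f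
    constˢ-‿1 f α = K.trans (constˢ-* (K.- K.1#) f α) (K.-1*x≈-x (f α))

  module Map (H : PolyMap n) (symmetric : IsSymmetric (J (X -ᵐ H))) (cubic : ∀ i → IsHomogeneous 3 (H i)) where
    h : Fin n → Series n
    h l = coeff (H l)

    ∂-h-sym : ∀ i j → ∂ i (h j) ≈ˢ ∂ j (h i)
    ∂-h-sym i j = S.-‿injective (S.+-cancelˡ (∂ i (varˢ j)) _ _ (begin
      ∂ i (varˢ j) +ˢ -ˢ ∂ i (h j)       ≈⟨ coeff-J i j ⟨
      coeff (J (X -ᵐ H) i j)             ≈⟨ symmetric i j ⟩
      coeff (J (X -ᵐ H) j i)             ≈⟨ coeff-J j i ⟩
      ∂ j (varˢ i) +ˢ -ˢ ∂ j (h i)       ≈⟨ S.+-congʳ (∂-var-sym j i) ⟩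
      ∂ i (varˢ j) +ˢ -ˢ ∂ j (h i)       ∎))
      where
      ∂-var-sym : ∀ i j → ∂ {n} i (varˢ j) ≈ˢ ∂ j (varˢ i)
      ∂-var-sym i j = S.trans (∂-var i j)
        (S.trans (S.reflexive (Contraction.indicator-sym (seriesRing n) i j)) (S.sym (∂-var j i)))
      coeff-J : ∀ i j → coeff (J (X -ᵐ H) i j) ≈ˢ ∂ i (varˢ j) +ˢ -ˢ ∂ i (h j)
      coeff-J i j = S.+-cong (coeff-D i (var j)) (begin
        constˢ K.0# *ˢ h j +ˢ constˢ (K.- K.1#) *ˢ coeff (D i (H j))
          ≈⟨ S.+-cong (S.zeroˡ (h j)) (constˢ-‿1 (coeff (D i (H j)))) ⟩
        S.0# +ˢ -ˢ coeff (D i (H j))   ≈⟨ S.+-identityˡ _ ⟩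
        -ˢ coeff (D i (H j))           ≈⟨ S.-‿cong (coeff-D i (H j)) ⟩
        -ˢ ∂ i (h j)                   ∎)

    t : Fin n → Fin n → Fin n → Fin n → K.Carrier
    t i j k l = ∂ k (∂ j (∂ i (h l))) 0⃗

    -- H l = Σ b i j k l Xᵢ Xⱼ Xₖ
    b : Fin n → Fin n → Fin n → Fin n → K.Carrier
    b i j k l = t i j k l /1+ 5

    b-swap₁₂ : ∀ i j k l → b i j k l K.≈ b j i k l
    b-swap₁₂ i j k l = K.*-congˡ (∂-cong k (∂-comm j i (h l)) 0⃗)

    b-swap₂₃ : ∀ i j k l → b i j k l K.≈ b i k j l
    b-swap₂₃ i j k l = K.*-congˡ (∂-comm k j (∂ i (h l)) 0⃗)

    -- Here the symmetry of the Jacobian enters; the two preceding swaps are the commutation of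
    -- partial derivatives.
    b-swap₃₄ : ∀ i j k l → b i j k l K.≈ b i j l k
    b-swap₃₄ i j k l = K.*-congˡ (S.trans (to-front k l) (S.trans
      (∂-cong j (∂-cong i (∂-h-sym k l))) (S.sym (to-front l k))) 0⃗)
      where
      to-front : ∀ k l → ∂ k (∂ j (∂ i (h l))) ≈ˢ ∂ j (∂ i (∂ k (h l)))
      to-front k l = S.trans (∂-comm k j (∂ i (h l))) (∂-cong j (∂-comm k i (h l)))

    open TensorForm K n b b-swap₁₂ b-swap₂₃ b-swap₃₄

    third-derivative : ∀ i j k l → ∂ k (∂ j (∂ i (h l))) ≈ˢ 6 S.×′ β i j k l
    third-derivative i j k l = begin
      ∂ k (∂ j (∂ i (h l)))        ≈⟨ Homogeneous-0 _ (Homogeneous-∂ k _ (Homogeneous-∂ j _ (Homogeneous-∂ i (h l) (cubic l)))) ⟩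
      constˢ (t i j k l)           ≈⟨ constˢ-cong (×-divide 5 (t i j k l)) ⟨
      constˢ (6 K.×′ b i j k l)    ≈⟨ ×-constˢ 6 (b i j k l) ⟩
      6 S.×′ β i j k l             ∎

    -- Euler's identity, applied in degree 2 and then in degree 1, gives 2 ∂ᵢ h as the contraction
    -- of 6 b with X twice.
    first-derivative : ∀ i l → ∂ i (h l) ≈ˢ 3 S.×′ contract varˢ λ j → contract varˢ λ k → β i j k l
    first-derivative i l = ×ˢ-cancel 1 (begin
      2 S.×′ ∂ i (h l)
        ≈⟨ euler-homogeneous 2 (∂ i (h l)) (Homogeneous-∂ i (h l) (cubic l)) ⟨
      contract varˢ (λ j → ∂ j (∂ i (h l)))
        ≈⟨ contract-congˡ varˢ (λ j → S.trans (S.sym (S.+-identityʳ _))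
             (S.sym (euler-homogeneous 1 (∂ j (∂ i (h l))) (Homogeneous-∂ j _ (Homogeneous-∂ i (h l) (cubic l)))))) ⟩
      contract varˢ (λ j → contract varˢ λ k → ∂ k (∂ j (∂ i (h l))))
        ≈⟨ contract-congˡ varˢ (λ j → contract-congˡ varˢ λ k → third-derivative i j k l) ⟩
      contract varˢ (λ j → contract varˢ λ k → 6 S.×′ β i j k l)
        ≈⟨ contract-congˡ varˢ (λ j → ×-contract 6 varˢ λ k → β i j k l) ⟩
      contract varˢ (λ j → 6 S.×′ contract varˢ λ k → β i j k l)
        ≈⟨ ×-contract 6 varˢ (λ j → contract varˢ λ k → β i j k l) ⟩
      6 S.×′ contract varˢ (λ j → contract varˢ λ k → β i j k l)
        ≈⟨ S.×-assocˡ _ 2 3 ⟨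
      2 S.×′ (3 S.×′ contract varˢ λ j → contract varˢ λ k → β i j k l) ∎)

    h-tensor : ∀ l → h l ≈ˢ B varˢ varˢ varˢ l
    h-tensor l = ×ˢ-cancel 2 (begin
      3 S.×′ h l                            ≈⟨ euler-homogeneous 3 (h l) (cubic l) ⟨
      contract varˢ (λ i → ∂ i (h l))       ≈⟨ contract-congˡ varˢ (λ i → first-derivative i l) ⟩
      contract varˢ (λ i → 3 S.×′ contract varˢ λ j → contract varˢ λ k → β i j k l)
        ≈⟨ ×-contract 3 varˢ (λ i → contract varˢ λ j → contract varˢ λ k → β i j k l) ⟩
      3 S.×′ B varˢ varˢ varˢ l             ∎)

    contractᵖ : (Fin n → Poly n) → (Fin n → Poly n) → Poly n
    contractᵖ u f = RawSemiringDefs.sum (polyRawSemiring n) λ i → u i *ᵖ f i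

    evaluate-sum : ∀ {m} (f : Fin m → Poly n) (x : Vecˢ) →
      evaluate (RawSemiringDefs.sum (polyRawSemiring n) f) x ≈ˢ S.sum (λ i → evaluate (f i) x)
    evaluate-sum {zero}  f x = S.refl
    evaluate-sum {suc m} f x = S.+-congˡ (evaluate-sum (f ∘ suc) x)

    evaluate-contract : ∀ u f (x : Vecˢ) → evaluate (contractᵖ u f) x ≈ˢ
                        contract (λ i → evaluate (u i) x) (λ i → evaluate (f i) x)
    evaluate-contract u f x = evaluate-sum (λ i → u i *ᵖ f i) x

    -- `evaluate-cong` compares expressions, so the tensor formula is first written as one. It can
    -- then be transported from the coefficients to values at arbitrary series; `Jᵖ` serves
    -- likewise.
    Hᵖ : PolyMap n
    Hᵖ l = contractᵖ var λ i → contractᵖ var λ j → contractᵖ var λ k → con (b i j k l)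

    evaluate-Hᵖ : ∀ l x → evaluate (Hᵖ l) x ≈ˢ B x x x l
    evaluate-Hᵖ l x = S.trans (evaluate-contract var _ x) (contract-congˡ x λ i →
      S.trans (evaluate-contract var _ x) (contract-congˡ x λ j → evaluate-contract var _ x))

    evaluate-H : ∀ l x → evaluate (H l) x ≈ˢ B x x x l
    evaluate-H l x = S.trans (evaluate-cong (H l) (Hᵖ l) x (begin
      h l                    ≈⟨ h-tensor l ⟩
      B varˢ varˢ varˢ l     ≈⟨ evaluate-Hᵖ l varˢ ⟨
      evaluate (Hᵖ l) varˢ   ≈⟨ coeff-evaluate (Hᵖ l) ⟨
      coeff (Hᵖ l)           ∎)) (evaluate-Hᵖ l x)

    Jᵖ : Fin n → Fin n → Poly n
    Jᵖ i l = contractᵖ var λ j → contractᵖ var λ k → con (3 K.×′ b i j k l)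

    evaluate-Jᵖ : ∀ i l x → evaluate (Jᵖ i l) x ≈ˢ 3 S.×′ contract x λ j → contract x λ k → β i j k l
    evaluate-Jᵖ i l x = begin
      evaluate (Jᵖ i l) x
        ≈⟨ S.trans (evaluate-contract var _ x) (contract-congˡ x λ j → evaluate-contract var _ x) ⟩
      contract x (λ j → contract x λ k → constˢ (3 K.×′ b i j k l))
        ≈⟨ contract-congˡ x (λ j → S.trans (contract-congˡ x λ k → ×-constˢ 3 (b i j k l)) (×-contract 3 x λ k → β i j k l)) ⟩
      contract x (λ j → 3 S.×′ contract x λ k → β i j k l)
        ≈⟨ ×-contract 3 x (λ j → contract x λ k → β i j k l) ⟩
      3 S.×′ contract x (λ j → contract x λ k → β i j k l) ∎

    evaluate-J : ∀ i l x → evaluate (J H i l) x ≈ˢ 3 S.×′ contract x λ j → contract x λ k → β i j k l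
    evaluate-J i l x = S.trans (evaluate-cong (J H i l) (Jᵖ i l) x (begin
      coeff (D i (H l))        ≈⟨ coeff-D i (H l) ⟩
      ∂ i (h l)                ≈⟨ first-derivative i l ⟩
      3 S.×′ contract varˢ (λ j → contract varˢ λ k → β i j k l)  ≈⟨ evaluate-Jᵖ i l varˢ ⟨
      evaluate (Jᵖ i l) varˢ   ≈⟨ coeff-evaluate (Jᵖ i l) ⟨
      coeff (Jᵖ i l)           ∎)) (evaluate-Jᵖ i l x)

    act : Vecˢ → Matrix n → Vecˢ → Vecˢ
    act x M w i = contract (λ j → evaluate (M i j) x) w

    open AbelianGroup V using () renaming (_≈_ to _≈ᵛ_; _∙_ to _+ᵛ_; _⁻¹ to -ᵛ_; ε to 0ᵛ)
    open IntegerMultiples V using () renaming (_×′_ to _×ᵛ_)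
    private module VM = IntegerMultiples V

    act-* : ∀ x M M′ w → act x (M *ᴹ M′) w ≈ᵛ act x M (act x M′ w)
    act-* x M M′ w i = begin
      contract (λ k → evaluate ((M *ᴹ M′) i k) x) w
        ≈⟨ contract-cong {f = w} (λ k → evaluate-sum (λ j → M i j *ᵖ M′ j k) x) (λ _ → S.refl) ⟩
      contract (λ k → contract p λ j → q j k) w
        ≈⟨ contract-comm (λ k → contract p λ j → q j k) w ⟩
      contract w (λ k → contract p λ j → q j k)
        ≈⟨ contract-swap w p (λ k j → q j k) ⟩
      contract p (λ j → contract w (q j))
        ≈⟨ contract-congˡ p (λ j → contract-comm w (q j)) ⟩
      contract p (act x M′ w) ∎
      where
      p = λ j → evaluate (M i j) x
      q = λ j k → evaluate (M′ j k) x

    act-1 : ∀ x w → act x 1ᴹ w ≈ᵛ w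
    act-1 x w i = S.trans (contract-cong {f = w} (λ j → entry (does (i Fin.≟ j))) (λ _ → S.refl)) (contract-indicator i w)
      where
      entry : ∀ c → evaluate (if c then con K.1# else con K.0#) x ≈ˢ (if c then S.1# else S.0#)
      entry true  = S.refl
      entry false = S.refl

    -- Acting by the Jacobian contracts w with the component index of H, whereas B contracts it with
    -- an argument; the rotation of b identifies the two.
    act-J : ∀ x w → act x (J H) w ≈ᵛ 3 ×ᵛ B x x w
    act-J x w i = begin
      contract (λ l → evaluate (J H i l) x) w
        ≈⟨ contract-cong {f = w} (λ l → evaluate-J i l x) (λ _ → S.refl) ⟩
      contract (λ l → 3 S.×′ contract x λ j → contract x λ k → β i j k l) w
        ≈⟨ contract-comm (λ l → 3 S.×′ contract x λ j → contract x λ k → β i j k l) w ⟩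
      contract w (λ l → 3 S.×′ contract x λ j → contract x λ k → β i j k l)
        ≈⟨ ×-contract 3 w (λ l → contract x λ j → contract x λ k → β i j k l) ⟩
      3 S.×′ contract w (λ l → contract x λ j → contract x λ k → β i j k l)
        ≈⟨ S.×-congʳ 3 (contract-swap w x λ l j → contract x λ k → β i j k l) ⟩
      3 S.×′ contract x (λ j → contract w λ l → contract x λ k → β i j k l)
        ≈⟨ S.×-congʳ 3 (contract-congˡ x λ j → contract-swap w x λ l k → β i j k l) ⟩
      3 S.×′ contract x (λ j → contract x λ k → contract w λ l → β i j k l)
        ≈⟨ S.×-congʳ 3 (contract-congˡ x λ j → contract-congˡ x λ k → contract-congˡ w λ l → constˢ-cong (b-rotate i j k l)) ⟩
      3 S.×′ B x x w i ∎

    ×ᵛ-at : ∀ m (u : Vecˢ) i → (m ×ᵛ u) i ≈ˢ m S.×′ u i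
    ×ᵛ-at zero    u i = S.refl
    ×ᵛ-at (suc m) u i = S.+-congˡ (×ᵛ-at m u i)

    ×ˢ-cancel-0 : ∀ m {f : Series n} → suc m S.×′ f ≈ˢ S.0# → f ≈ˢ S.0#
    ×ˢ-cancel-0 m {f} e α = K.trans (×-cancel-0 m (K.trans (K.sym (×-at (suc m) f α))
      (K.trans (e α) (constˢ-0 α)))) (K.sym (constˢ-0 α))

    ×ᵛ-cancel-0 : ∀ m {u : Vecˢ} → suc m ×ᵛ u ≈ᵛ 0ᵛ → u ≈ᵛ 0ᵛ
    ×ᵛ-cancel-0 m {u} e i = ×ˢ-cancel-0 m (S.trans (S.sym (×ᵛ-at (suc m) u i)) (e i))

    -- The formal inverse and its degrees

    module Inverse (nilpotent : J H ^ᴹ 4 ≈ᴹ 0ᴹ) where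
      module _ (x : Vecˢ) where
        J′ : ℕ → Vecˢ → Vecˢ
        J′ zero    w = w
        J′ (suc m) w = 3 ×ᵛ B x x (J′ m w)

        J′-×3 : ∀ m w → J′ m (3 ×ᵛ w) ≈ᵛ 3 ×ᵛ J′ m w
        J′-×3 zero    w = VG.refl
        J′-×3 (suc m) w = VM.×-congʳ 3 (VG.trans (Additive.cong (F.B-additive₃ x x) (J′-×3 m w))
          (Additive.×-homo (F.B-additive₃ x x) 3 (J′ m w)))

        J′-shift : ∀ m w → J′ m (3 ×ᵛ B x x w) ≈ᵛ J′ (suc m) w
        J′-shift zero    w = VG.refl
        J′-shift (suc m) w = VM.×-congʳ 3 (Additive.cong (F.B-additive₃ x x) (J′-shift m w))

        -- The innermost factor 3A is replaced by A, its 3 being moved to the front and divided out.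
        lower : ∀ m {w} → J′ (suc m) w ≈ᵛ 0ᵛ → J′ m (B x x w) ≈ᵛ 0ᵛ
        lower m {w} e = ×ᵛ-cancel-0 2
          (VG.trans (VG.sym (J′-×3 m (B x x w))) (VG.trans (J′-shift m w) e))

        act-^ : ∀ m w → act x (J H ^ᴹ m) w ≈ᵛ J′ m w
        act-^ zero    w = act-1 x w
        act-^ (suc m) w = VG.trans (act-* x (J H) (J H ^ᴹ m) w) (VG.trans (act-J x _)
          (VM.×-congʳ 3 (Additive.cong (F.B-additive₃ x x) (act-^ m w))))

        -- The nilpotency hypothesis is a polynomial identity, so it may be evaluated at any tuple
        -- of series, in particular at the formal inverse.
        J′⁴-vanishes : ∀ w → J′ 4 w ≈ᵛ 0ᵛ
        J′⁴-vanishes w = VG.trans (VG.sym (act-^ 4 w)) λ i → S.trans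
          (contract-cong {f = w} (λ j → evaluate-cong ((J H ^ᴹ 4) i j) (con K.0#) x (nilpotent i j)) (λ _ → S.refl))
          (contract-0 w)

        A⁴-vanishes : ∀ w → B x x (B x x (B x x (B x x w))) ≈ᵛ 0ᵛ
        A⁴-vanishes w = lower 0 (lower 1 (lower 2 (lower 3 (J′⁴-vanishes w))))

      y : Vecˢ
      y = solution

      y-derivative : ∀ {d} → IsDerivation d → d ∘ y ≈ᵛ (d ∘ varˢ) +ᵛ 3 ×ᵛ B y y (d ∘ y)
      y-derivative {d} isD i = begin
        d (y i)                                   ≈⟨ cong (solution-≈ i) ⟩
        d (varˢ i +ˢ Φ y i)                       ≈⟨ +-homo (varˢ i) (Φ y i) ⟩
        d (varˢ i) +ˢ d (Φ y i)                   ≈⟨ S.+-congˡ (Derivation.leibniz-B (derivation isD) y y y i) ⟩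
        d (varˢ i) +ˢ (B dy y y i +ˢ (B y dy y i +ˢ B y y dy i))
          ≈⟨ S.+-congˡ (S.+-cong
               (S.trans (F.B-swap₁₂ dy y y i) (F.B-swap₂₃ y dy y i))
               (S.+-cong (F.B-swap₂₃ y dy y i) (S.sym (S.+-identityʳ _)))) ⟩
        d (varˢ i) +ˢ 3 S.×′ B y y dy i           ∎
        where
        open IsDerivation isD
        dy = d ∘ y

      tripled-A : Additive V V (λ u → 3 ×ᵛ B y y u)
      tripled-A = record
        { cong   = λ e → VM.×-congʳ 3 (Additive.cong (F.B-additive₃ y y) e)
        ; ∙-homo = λ u v → VG.trans (VM.×-congʳ 3 (Additive.∙-homo (F.B-additive₃ y y) u v))
            (VM.×-distrib-+ (B y y u) (B y y v) 3)
        }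

      -- The derivation with coefficients (1 - 3A) z sends y to z, because (1 - 3A) ∂y = ∂X.
      coefficients : Vecˢ → Vecˢ
      coefficients z = z +ᵛ -ᵛ (3 ×ᵛ B y y z)

      -- The error e = dy - z satisfies e = 3A e. Four applications of this identity annihilate it,
      -- so 1 - 3A need not be inverted.
      along-y : ∀ z → along (coefficients z) ∘ y ≈ᵛ z
      along-y z = VM.x∙y⁻¹≈ε⇒x≈y dy z (VG.trans (fixed 4) (J′⁴-vanishes y _))
        where
        dy e : Vecˢ
        dy = along (coefficients z) ∘ y
        e  = dy +ᵛ -ᵛ z
        p r : Vecˢ
        p = 3 ×ᵛ B y y z
        r = 3 ×ᵛ B y y dy
        once : e ≈ᵛ 3 ×ᵛ B y y e
        once = VG.trans (VG.∙-congʳ { -ᵛ z } (VG.trans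
            (VG.trans (y-derivative (along-isDerivation (coefficients z)))
              (VG.∙-congʳ {r} λ i → along-var (coefficients z) i))
            (VG.assoc z (-ᵛ p) r)))
          (VG.trans (VM.xyx⁻¹≈y z (-ᵛ p +ᵛ r)) (VG.trans (VG.comm (-ᵛ p) r)
          (VG.sym (VG.trans (Additive.∙-homo tripled-A dy (-ᵛ z)) (VG.∙-congˡ {r} (Additive.⁻¹-homo tripled-A z))))))
        fixed : ∀ m → e ≈ᵛ J′ y m e
        fixed zero    = VG.refl
        fixed (suc m) = VG.trans once (Additive.cong tripled-A (fixed m))

      δ : Vecˢ → Derivation form
      δ z = derivation (along-isDerivation (coefficients z))

      module I = Identities form ×ᵛ-cancel-0 ×ˢ-cancel-0 nondegenerate y δ along-y (A⁴-vanishes y)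

      ∂-potential : ∀ i → ∂ i I.potential ≈ˢ 4 S.×′ Φ y i
      ∂-potential i = S.trans
        (I.gradient (derivation (∂-isDerivation i)) (∂ i ∘ varˢ) (y-derivative (∂-isDerivation i)))
        (S.×-congʳ 4 (begin
          contract (Φ y) (λ l → ∂ i (varˢ l))   ≈⟨ contract-congˡ (Φ y) (∂-var i) ⟩
          contract (Φ y) (indicator i)          ≈⟨ contract-comm (Φ y) (indicator i) ⟩
          contract (indicator i) (Φ y)          ≈⟨ contract-indicator i (Φ y) ⟩
          Φ y i                                 ∎))

      y-fixed : y +ᵛ -ᵛ Φ y ≈ᵛ varˢ
      y-fixed = VG.trans (VG.∙-congʳ solution-≈) (VM.//-rightDividesʳ (Φ y) varˢ)

      -- For z the value of `I.euler`, the coefficients (1 - 3A) z are y - Φ y = X, so the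
      -- derivation is the sum of the Xᵢ ∂ᵢ.
      euler-eigen : ∀ α f → along (coefficients _) f α K.≈ degree α K.×′ f α
      euler-eigen α f = K.trans (contract-cong {f = λ i → ∂ i f} (VG.trans I.euler-field y-fixed) (λ _ → S.refl) α)
        (euler-identity f α)

      -- This holds for the degrees outside 4, 6, ..., 16, where the potential has to vanish; `Odd`
      -- likewise describes the degrees outside 3, 5, ..., 15.
      Even : ℕ → Set
      Even e = ∀ j → j ≤ 6 → e ≢ 4 ℕ.+ 2 ℕ.* j

      Odd : ℕ → Set
      Odd e = ∀ j → j ≤ 6 → e ≢ 3 ℕ.+ 2 ℕ.* j

      potential-degrees : ZeroIn Even I.potential
      potential-degrees α even = I.q-vanishes K.+-abelianGroup
        (record { cong = λ e → e α ; ∙-homo = λ _ _ → K.refl })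
        (degree α) (euler-eigen α)
        (λ j j≤6 → ×-injectiveˡ (degree α) (4 ℕ.+ 2 ℕ.* j) (even j j≤6))

      -- Four times Φ y i is a partial derivative of the potential, so each possible degree drops by
      -- one.
      Φ-degrees : ∀ i → ZeroIn Odd (Φ y i)
      Φ-degrees i α odd = ×-cancel-0 3 (K.trans (K.sym (×-at 4 (Φ y i) α)) (K.trans (K.sym (∂-potential i α))
        (ZeroIn-∂ i Even I.potential potential-degrees α λ j j≤6 e → odd j j≤6 (ℕ.suc-injective e))))

      y-at : ∀ i α → y i α K.≈ varˢ i α K.+ Φ y i α
      y-at i α = solution-≈ i α

      y-degree-1 : ∀ i α → Odd (degree α) → y i α K.≈ varˢ i α
      y-degree-1 i α odd = K.trans (y-at i α) (K.trans (K.+-congˡ (Φ-degrees i α odd)) (K.+-identityʳ _))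

      -- Built from the constructed solution, so that it exists before any formal inverse is given;
      -- `P-components` rewrites it for a given one.
      P : PolyMap n
      P = X +ᵐ N y 1 +ᵐ N y 2 +ᵐ N y 3 +ᵐ N y 4 +ᵐ N y 5 +ᵐ N y 6 +ᵐ N y 7

      module _ (x : K.Carrier) (c : ℕ → K.Carrier) where
        -- Associated to the left like the sum in `P`, so that the case 7 unfolds to a coefficient
        -- of `P`.
        leftSum : ℕ → K.Carrier
        leftSum zero    = x
        leftSum (suc m) = leftSum m K.+ c (suc m)

        leftSum-0 : ∀ m → (∀ j → j < m → c (suc j) K.≈ K.0#) → leftSum m K.≈ x
        leftSum-0 zero    z = K.refl
        leftSum-0 (suc m) z = K.trans
          (K.+-cong (leftSum-0 m λ j j<m → z j (ℕ.m<n⇒m<1+n j<m)) (z m ℕ.≤-refl)) (K.+-identityʳ _)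

        leftSum-pick : x K.≈ K.0# → ∀ m j → j < m → (∀ i → i < m → i ≢ j → c (suc i) K.≈ K.0#) →
                       leftSum m K.≈ c (suc j)
        leftSum-pick x≈0 (suc m) j j<1+m z with j ℕ.≟ m
        ... | yes ≡.refl = K.trans
          (K.+-congʳ (K.trans (leftSum-0 m λ i i<m → z i (ℕ.m<n⇒m<1+n i<m) (ℕ.<⇒≢ i<m)) x≈0)) (K.+-identityˡ _)
        ... | no  j≢m    = K.trans
          (K.+-cong (leftSum-pick x≈0 m j (ℕ.≤∧≢⇒< (ℕ.≤-pred j<1+m) j≢m) λ i i<m → z i (ℕ.m<n⇒m<1+n i<m))
                    (z m ℕ.≤-refl (j≢m ∘ ≡.sym)))
          (K.+-identityʳ _)

      N-degree : ∀ j → 2 ℕ.* suc j ℕ.+ 1 ≡ 3 ℕ.+ 2 ℕ.* j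
      N-degree j = ≡.trans (ℕ.+-comm (2 ℕ.* suc j) 1) (≡.cong suc (ℕ.*-suc 2 j))

      coeff-P : ∀ i → coeff (P i) ≈ˢ y i
      coeff-P i α with ℕ.anyUpTo? (λ j → degree α ℕ.≟ 3 ℕ.+ 2 ℕ.* j) 7
      -- In degree 3 + 2j only the component with index j + 1 contributes, since X lives in degree
      -- 1.
      ... | yes (j , j<7 , e) = K.trans
        (leftSum-pick (varˢ i α) (λ m → coeff (N y m i) α)
          (varˢ-degree i α (λ e′ → contradiction (≡.trans (≡.sym e) e′) λ ())) 7 j j<7
          λ m _ m≢j → homogeneousComponent-other (2 ℕ.* suc m ℕ.+ 1) (y i) α λ e′ →
            m≢j (ℕ.*-cancelˡ-≡ m j 2 (ℕ.+-cancelˡ-≡ 3 _ _ (≡.trans (≡.sym (N-degree m)) (≡.trans (≡.sym e′) e)))))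
        (≡.subst (λ d → coeff (homogeneousComponent d (y i)) α K.≈ y i α) (≡.trans e (≡.sym (N-degree j)))
          (homogeneousComponent-same (y i) α))
      ... | no ¬odd = K.trans
        (leftSum-0 (varˢ i α) (λ m → coeff (N y m i) α) 7 λ j j<7 →
          homogeneousComponent-other (2 ℕ.* suc j ℕ.+ 1) (y i) α λ e → ¬odd (j , j<7 , ≡.trans e (N-degree j)))
        (K.sym (y-degree-1 i α λ j j≤6 e → ¬odd (j , s≤s j≤6 , e)))

      degree-P : ∀ i → DegreeAtMost 15 (P i)
      degree-P i α 15<α = K.trans (coeff-P i α) (K.trans
        (y-degree-1 i α λ j j≤6 e → ℕ.<⇒≱ 15<α
          (≡.subst (_≤ 15) (≡.sym e) (ℕ.+-monoʳ-≤ 3 (ℕ.*-monoʳ-≤ 2 j≤6))))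
        (varˢ-degree i α λ e → ℕ.<⇒≱ 15<α (≡.subst (_≤ 15) (≡.sym e) (s≤s z≤n))))

      F′ : PolyMap n
      F′ = X -ᵐ H

      evaluate-F : ∀ x → (λ i → evaluate (F′ i) x) ≈ᵛ x +ᵛ -ᵛ Φ x
      evaluate-F x i = S.+-congˡ (S.trans (constˢ-‿1 (evaluate (H i) x)) (S.-‿cong (evaluate-H i x)))

      coeff-F : (coeff ∘ F′) ≈ᵛ varˢ +ᵛ -ᵛ Φ varˢ
      coeff-F = VG.trans (λ i → coeff-evaluate (F′ i)) (evaluate-F varˢ)

      evaluate-congʳ : ∀ p {x x′ : Vecˢ} → x ≈ᵛ x′ → evaluate p x ≈ˢ evaluate p x′
      evaluate-congʳ (con k)  e = S.refl
      evaluate-congʳ (var i)  e = e i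
      evaluate-congʳ (p +ᵖ q) e = S.+-cong (evaluate-congʳ p e) (evaluate-congʳ q e)
      evaluate-congʳ (p *ᵖ q) {x} e = S.*-cong {_} {evaluate p x} (evaluate-congʳ p e) (evaluate-congʳ q e)

      evaluate-substᵖ : ∀ p (G : PolyMap n) (x : Vecˢ) →
                        evaluate (substᵖ p G) x ≈ˢ evaluate p (λ i → evaluate (G i) x)
      evaluate-substᵖ (con k)  G x = S.refl
      evaluate-substᵖ (var i)  G x = S.refl
      evaluate-substᵖ (p +ᵖ q) G x = S.+-cong (evaluate-substᵖ p G x) (evaluate-substᵖ q G x)
      evaluate-substᵖ (p *ᵖ q) G x =
        S.*-cong {_} {evaluate (substᵖ p G) x} (evaluate-substᵖ p G x) (evaluate-substᵖ q G x)

      F∘P : F′ ∘ᵐ P ≈ᵐ X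
      F∘P i = begin
        coeff (substᵖ (F′ i) P)        ≈⟨ coeff-substᵖ (F′ i) P ⟩
        evaluate (F′ i) (coeff ∘ P)    ≈⟨ evaluate-congʳ (F′ i) coeff-P ⟩
        evaluate (F′ i) y              ≈⟨ evaluate-F y i ⟩
        y i +ˢ -ˢ Φ y i                ≈⟨ y-fixed i ⟩
        varˢ i                         ∎

      -- P ∘ F and X have the same image under F.
      P∘F : P ∘ᵐ F′ ≈ᵐ X
      P∘F i = S.trans (coeff-substᵖ (P i) F′) (injective w varˢ w-order Order≥-var same i)
        where
        f w : Vecˢ
        f = coeff ∘ F′
        w i = evaluate (P i) f
        f-order : Orderᵛ 1 f
        f-order = Order-congᵛ (VG.sym coeff-F) (Order-+ᵛ Order≥-var λ i α α<1 →
          K.trans (K.-‿cong (Order-B varˢ varˢ varˢ Order≥-var Order≥-var Order≥-var i α (ℕ.≤-trans α<1 (s≤s z≤n)))) K.-0#≈0#)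
        w-order : Orderᵛ 1 w
        w-order i α α<1 = K.trans (K.sym (substˢ-evaluate (P i) f f-order α))
          (upToDegree-0 n (degree α) _ λ β β≤α → K.trans
            (K.*-congʳ (K.trans (coeff-P i β) (solution-order i β (ℕ.≤-<-trans β≤α α<1)))) (K.zeroˡ _))
        same : w +ᵛ -ᵛ Φ w ≈ᵛ varˢ +ᵛ -ᵛ Φ varˢ
        same = VG.trans (VG.sym (evaluate-F w)) (VG.trans
          (λ i → S.trans (S.sym (evaluate-substᵖ (F′ i) P f)) (evaluate-cong (substᵖ (F′ i) P) (var i) f (F∘P i)))
          coeff-F)

      -- F ∘ G = X says that G - Φ G = X = y - Φ y, and `injective` applies to these two series maps
      -- without constant term.
      formal-inverse-unique : ∀ G → IsFormalInverse F′ G → G ≈ᵛ y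
      formal-inverse-unique G inv = injective G y G-order solution-order (VG.trans
        (VG.sym (evaluate-F G)) (VG.trans
          (λ i → S.trans (S.sym (substˢ-evaluate (F′ i) G G-order)) (F∘G=X i)) (VG.sym y-fixed)))
        where
        open IsFormalInverse inv
        G-order : Orderᵛ 1 G
        G-order i α α<1 = K.trans (G=X+higher i α (ℕ.<⇒≤ α<1)) (Order≥-var i α α<1)

      homogeneousComponent-cong : ∀ d {f g : Series n} → f ≈ˢ g → homogeneousComponent d f ≈ᵖ homogeneousComponent d g
      homogeneousComponent-cong d {f} {g} e α with degree α ℕ.≟ d
      ... | yes ≡.refl = K.trans (homogeneousComponent-same f α)
                           (K.trans (e α) (K.sym (homogeneousComponent-same g α)))
      ... | no  α≢d    = K.trans (homogeneousComponent-other d f α α≢d)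
                           (K.sym (homogeneousComponent-other d g α α≢d))

      P-components : ∀ G → IsFormalInverse F′ G →
        P ≈ᵐ X +ᵐ N G 1 +ᵐ N G 2 +ᵐ N G 3 +ᵐ N G 4 +ᵐ N G 5 +ᵐ N G 6 +ᵐ N G 7
      P-components G inv i = S.+-cong (S.+-cong (S.+-cong (S.+-cong (S.+-cong (S.+-cong (S.+-congˡ
        (same 1)) (same 2)) (same 3)) (same 4)) (same 5)) (same 6)) (same 7)
        where
        same : ∀ m → N y m i ≈ᵖ N G m i
        same m = homogeneousComponent-cong (2 ℕ.* m ℕ.+ 1) (S.sym (formal-inverse-unique G inv i))

theorem3p19 : ∀ {c ℓ} (A : CommutativeℚAlgebra c ℓ) →
    let open Polynomials (CommutativeℚAlgebra.ring A) in
    (n : ℕ) → 1 ≤ n →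
    let open PolyMatrices n in
    (H : PolyMap n) →
    let F = X -ᵐ H in
    IsSymmetric (J F) →
    (∀ i → IsHomogeneous 3 (H i)) →
    J H ^ᴹ 4 ≈ᴹ 0ᴹ →
    Σ[ P ∈ PolyMap n ]
    IsInverse F P
    × (∀ G → IsFormalInverse F G →
    P ≈ᵐ X +ᵐ N G 1 +ᵐ N G 2 +ᵐ N G 3 +ᵐ N G 4 +ᵐ N G 5 +ᵐ N G 6 +ᵐ N G 7)
    × (∀ i → DegreeAtMost 15 (P i))
theorem3p19 A n _ H symmetric cubic nilpotent =
  M.P , (M.F∘P , M.P∘F) , M.P-components , M.degree-P
  where module M = SymmetricCubic.Map.Inverse A n H symmetric cubic nilpotent
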